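{- There is an absolute constant $c>0$ such that, for every integer $d\ge 1$, there is a constant $C_d>0$ with the following property. Let $H$ be a weakly $d$-degenerate ordered $3$-graph on $t$ vertices. Then, for every positive integer $n$, \[ r_<\bigl(H,K_3^{(3)}(n)\bigr)\le t\,2^{C_d n^{2-c/d}} . \]
   Context: An ordered $k$-graph is a (finite) $k$-uniform hypergraph equipped with a linear order on its vertex set. An ordered $k$-graph $G$ contains an ordered copy of an ordered $k$-graph $H$ if there is an order-preserving injection $\phi\colon V(H)\to V(G)$ such that $\phi(e)\in E(G)$ for every $e\in E(H)$. For ordered $k$-graphs $G$ and $H$, the ordered Ramsey number $r_<(G,H)$ is the smallest integer $N$ such that every red-blue coloring of the edges of the naturally ordered complete $k$-graph on $[N]=\{1,\dots,N\}$ contains a blue ordered copy of $G$ or a red ordered copy of $H$. $K_3^{(3)}(n)$ denotes the ordered complete tripartite $3$-graph on $3n$ vertices whose three vertex classes are consecutive intervals of size $n$, arranged from left to right; its edges are all triples with exactly one vertex in each class. An ordered $3$-graph $H$ on $t$ vertices is weakly $d$-degenerate if its vertices admit an ordering $u_1,\ldots,u_t$ (not necessarily related to the given linear order on $V(H)$) such that, for every $i$, \[ \bigl|\{e\in E(H): u_i\in e \text{ and } e\cap\{u_1,\ldots,u_{i-1}\}\ne\varnothing\}\bigr|\le d. \] -}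

module Defs where

open import Algebra.Definitions.RawSemiring using ()
open import Data.Fin.Base as Fin using (Fin; quotient)
open import Data.Fin.Permutation using (Permutation′; _⟨$⟩ʳ_)
import Data.Fin.Properties as Fin
open import Data.Fin.Subset using (Subset; inside; outside; _∈_; _∩_; ∣_∣)
open import Data.Fin.Subset.Properties using (_∈?_)
open import Data.Integer.Base as ℤ using (ℤ; +_; -[1+_])
open import Data.List.Base as List using (List; []; _∷_; _++_; length; filter)
open import Data.Nat.Base as ℕ using (ℕ; zero; suc; NonZero)
import Data.Nat.Properties as ℕ
open import Data.Product.Base using (Σ-syntax; ∃-syntax; _×_; _,_; proj₁)
open import Data.Rational.Unnormalised.Base as ℚ using (ℚᵘ; 0ℚᵘ; _/_; ↥_; ↧ₙ_)
open import Data.Sum.Base using (_⊎_)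
import Data.Vec.Base as Vec
open import Function.Definitions using (Injective)
open import Level using (0ℓ)
open import Relation.Binary.Core using (_Preserves_⟶_)
open import Relation.Binary.PropositionalEquality using (_≡_)
open import Relation.Nullary.Decidable using (Dec; yes; no; does; _×-dec_)
open import Relation.Unary using (Pred; Decidable)

subsets : ∀ t → List (Subset t)
subsets zero    = Vec.[] ∷ []
subsets (suc t) = List.map (inside Vec.∷_) (subsets t) ++ List.map (outside Vec.∷_) (subsets t)

card : ∀ {t} {P : Pred (Subset t) 0ℓ} → Decidable P → ℕ
card {t} P? = length (filter P? (subsets t))

image : ∀ {t N} → (Fin t → Fin N) → Subset t → Subset N
image φ e = Vec.tabulate λ v → does (Fin.any? λ u → (u ∈? e) ×-dec (φ u Fin.≟ v))

-- The ordered vertex set is Fin t with its natural order: every linear order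
-- on t elements is uniquely isomorphic to it.
record OrderedGraph (k t : ℕ) : Set₁ where
  field
    Edge    : Pred (Subset t) 0ℓ
    edge?   : Decidable Edge
    uniform : ∀ {e} → Edge e → ∣ e ∣ ≡ k

open OrderedGraph public

Contains : ∀ {k N t} → OrderedGraph k N → OrderedGraph k t → Set
Contains {N = N} {t = t} G H =
  Σ[ φ ∈ (Fin t → Fin N) ]
    Injective _≡_ _≡_ φ ×
    φ Preserves Fin._≤_ ⟶ Fin._≤_ ×
    (∀ e → Edge H e → Edge G (image φ e))

data Colour : Set where
  red blue : Colour

_≟ᶜ_ : (c c′ : Colour) → Dec (c ≡ c′)
red  ≟ᶜ red  = yes _≡_.refl
red  ≟ᶜ blue = no λ ()
blue ≟ᶜ red  = no λ ()
blue ≟ᶜ blue = yes _≡_.refl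

Colouring : ℕ → ℕ → Set
Colouring k N = (e : Subset N) → .(∣ e ∣ ≡ k) → Colour

colourClass : ∀ {k N} → Colouring k N → Colour → OrderedGraph k N
colourClass {k} χ c = record
  { Edge    = λ e → Σ[ p ∈ ∣ e ∣ ≡ k ] χ e p ≡ c
  ; edge?   = dec
  ; uniform = proj₁
  }
  where
  dec : Decidable (λ e → Σ[ p ∈ ∣ e ∣ ≡ k ] χ e p ≡ c)
  dec e with ∣ e ∣ ℕ.≟ k
  ... | no ¬p = no λ (p , _) → ¬p p
  ... | yes p with χ e p ≟ᶜ c
  ...   | yes q = yes (p , q)
  ...   | no ¬q = no λ (_ , q) → ¬q q

Arrows : ∀ {k s t} → ℕ → OrderedGraph k s → OrderedGraph k t → Set
Arrows {k} N G H =
  (χ : Colouring k N) →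
    Contains (colourClass χ blue) G ⊎ Contains (colourClass χ red) H

-- r = r_<(G, H)
IsRamseyNumber : ∀ {k s t} → OrderedGraph k s → OrderedGraph k t → ℕ → Set
IsRamseyNumber G H r = Arrows r G H × (∀ M → Arrows M G H → r ℕ.≤ M)

-- quotient n sends vertex number j * n + i (with i < n) to j, so the classes
-- are consecutive intervals of size n.
class : ∀ n → Fin 3 → Subset (3 ℕ.* n)
class n j = Vec.tabulate λ v → does (quotient n v Fin.≟ j)

-- K₃⁽³⁾(n)
completeTripartite : ∀ n → OrderedGraph 3 (3 ℕ.* n)
completeTripartite n = record
  { Edge    = λ e → ∣ e ∣ ≡ 3 × (∀ j → ∣ e ∩ class n j ∣ ≡ 1)
  ; edge?   = λ e → (∣ e ∣ ℕ.≟ 3) ×-dec Fin.all? (λ j → ∣ e ∩ class n j ∣ ℕ.≟ 1)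
  ; uniform = proj₁
  }

-- e is an edge that contains u_i and meets {u_1, …, u_{i-1}}.
BackEdge : ∀ {t} → OrderedGraph 3 t → Permutation′ t → Fin t → Pred (Subset t) 0ℓ
BackEdge H u i e =
  Edge H e × (u ⟨$⟩ʳ i) ∈ e × ∃[ j ] (j Fin.< i × (u ⟨$⟩ʳ j) ∈ e)

backEdge? : ∀ {t} (H : OrderedGraph 3 t) u i → Decidable (BackEdge H u i)
backEdge? H u i e =
  edge? H e ×-dec ((u ⟨$⟩ʳ i) ∈? e) ×-dec
    Fin.any? (λ j → (j Fin.<? i) ×-dec ((u ⟨$⟩ʳ j) ∈? e))

WeaklyDegenerate : ∀ {t} → ℕ → OrderedGraph 3 t → Set
WeaklyDegenerate {t} d H =
  Σ[ u ∈ Permutation′ t ] (∀ i → card (backEdge? H u i) ℕ.≤ d)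

_^ℤ_ : (b : ℕ) .{{_ : NonZero b}} → ℤ → ℚᵘ
b ^ℤ (+ a)    = + (b ℕ.^ a) / 1
b ^ℤ -[1+ a ] = (+ 1 / (b ℕ.^ suc a)) {{ℕ.m^n≢0 b (suc a)}}

_^ℕ_ : ℚᵘ → ℕ → ℚᵘ
_^ℕ_ = Algebra.Definitions.RawSemiring._^_ ℚ.+-*-rawSemiring

-- The real number b ^ s (b a positive integer, s = p / q rational) is at most
-- the rational y:  b ^ (p / q) ≤ y  iff  0 ≤ y  and  b ^ p ≤ y ^ q.
PowerAtMost : (b : ℕ) .{{_ : NonZero b}} → ℚᵘ → ℚᵘ → Set
PowerAtMost b s y = 0ℚᵘ ℚ.≤ y × (b ^ℤ (↥ s)) ℚ.≤ (y ^ℕ (↧ₙ s))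

-- The real inequality  r ≤ t · 2 ^ (C · n ^ s), for C ≥ 0.  Real numbers are
-- handled through their rational upper bounds: since the right-hand side is
-- continuous and nondecreasing in n ^ s, it is the infimum of t · z over all
-- rationals y ≥ n ^ s and z ≥ 2 ^ (C · y).
ExpBound : (r t : ℕ) (C : ℚᵘ) (n : ℕ) .{{_ : NonZero n}} → ℚᵘ → Set
ExpBound r t C n s =
  ∀ y z → PowerAtMost n s y → PowerAtMost 2 (C ℚ.* y) z →
    (+ r / 1) ℚ.≤ (+ t / 1) ℚ.* z

{-# OPTIONS --safe #-}
-- The vertices of H are embedded greedily in the degeneracy order.  Each vertex
-- v is confined to an interval of length M (1 + f v), where f v is the number
-- of edges whose first vertex in that order is v; as the edges number at most
-- d t, the intervals have total length at most (1 + d) M t.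
--
-- Embedding the first vertex of an edge leaves a bipartite blue link graph
-- between the intervals of the other two, and embedding the middle one shrinks
-- the candidate set of the last to a neighbourhood in that graph.  With
-- a ≈ n^(1 / 8d), the intersection of s links has density at least a^(- s) on
-- every rectangle whose sides are at least the fraction 1 / b ≈ a^(- d) of
-- their intervals, so a candidate set never shrinks below that fraction.
--
-- A vertex is bad for a given intersection G of links if on some such rectangle
-- its own link keeps less than the fraction 1 / a of G.  If an interval had too
-- many bad vertices there would be a red copy of K₃⁽³⁾(n): some m × u biclique,
-- m = a^O(d) n and u = 2^O(n / a), consists of pairs that lie in many of the
-- rectangles of the bad vertices but in few of their blue links.  The trace of
-- most links on it has density O(1 / a), hence avoids some n × n biclique, and
-- there are only m^n u^n = 2^O(n² / a) of these, so that n vertices share one.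
-- Thus each edge with first vertex v has at most 2^O(n² / a) bad vertices in the
-- interval of v, and taking M above this number leaves room to avoid them all.
module Submission where

open import Defs
open import Data.Bool.Base using (Bool; true; false; _∧_; not; T; if_then_else_)
import Data.Bool.Properties as Bool
open import Data.Empty using (⊥-elim)
open import Data.Fin.Base as Fin using (Fin; zero; suc; toℕ)
open import Data.Fin.Permutation using (Permutation′; _⟨$⟩ʳ_; _⟨$⟩ˡ_; inverseˡ; inverseʳ)
import Data.Fin.Properties as Fin
open import Data.Fin.Subset using (Subset; inside; outside)
import Data.Fin.Subset as Sub
import Data.Fin.Subset.Properties as Sub
open import Data.Integer.Base as ℤ using (+_; -[1+_])
import Data.Integer.Properties as ℤ
open import Data.List.Base as List using (List; []; _∷_; _++_; length; filterᵇ; filter; map; allFin)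
import Data.List.Membership.DecPropositional as DecMem
open import Data.List.Membership.Propositional using (_∈_)
import Data.List.Membership.Propositional.Properties as Mem
import Data.List.Properties as List
open import Data.List.Relation.Unary.All as All using (All; []; _∷_)
import Data.List.Relation.Unary.All.Properties as All
open import Data.List.Relation.Unary.AllPairs as AllPairs using (AllPairs; []; _∷_)
import Data.List.Relation.Unary.AllPairs.Properties as AllPairs
open import Data.List.Relation.Unary.Any using (here; there)
import Data.List.Relation.Unary.Unique.DecPropositional as DecUnique
open import Data.List.Relation.Unary.Unique.Propositional using (Unique)
import Data.List.Relation.Unary.Unique.Propositional.Properties as Unique
open import Data.Nat.Base
  using (ℕ; zero; suc; _+_; _∸_; _^_; _≤_; z≤n; s≤s; s<s; z<s; NonZero) renaming (_*_ to _·_; _<_ to _<ⁿ_)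
import Data.Nat.Base as ℕ
import Data.Nat.DivMod as ℕ using (m≡m%n+[m/n]*n; m%n<n; m/n*n≤m)
open import Data.Nat.Properties as ℕ using (≤-trans; ≤-refl; ≤-reflexive; module ≤-Reasoning)
open import Data.Nat.Tactic.RingSolver using (solve-∀)
open import Data.Product.Base using (Σ-syntax; ∃-syntax; _×_; _,_; proj₁; proj₂; ∃)
open import Data.Rational.Unnormalised.Base as ℚ using (ℚᵘ; mkℚᵘ; 0ℚᵘ; _/_; _-_; _*_; _<_; ↥_; ↧ₙ_)
open import Data.Sum.Base using (_⊎_; inj₁; inj₂)
open import Data.Vec.Base as Vec using (lookup; tabulate)
import Data.Vec.Properties as Vec
open import Function.Base using (_∘_; case_of_; id)
open import Relation.Binary.Definitions using (DecidableEquality; tri<; tri≈; tri>)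
open import Relation.Binary.PropositionalEquality
  using (_≡_; _≢_; refl; sym; trans; cong; cong₂; subst; subst₂; module ≡-Reasoning)
open import Relation.Nullary.Decidable
  using (Dec; yes; no; does; _×-dec_; _⊎-dec_; _→-dec_; ¬?; map′; dec-true; dec-false; decidable-stable)
open import Relation.Nullary.Negation using (¬_; contradiction)

-- Weak degeneracy bounds the edges in which a vertex is middle or last, but not those that start at
-- it. A first vertex therefore cannot afford a proportional loss per edge: the pigeonhole must
-- supply an absolute bound on its bad vertices, which a longer interval pays for. A middle vertex
-- has at most d edges and can afford a proportional loss.
--
-- Density has to be demanded on all large rectangles, because the candidate sets that a link graph
-- will meet depend on later choices. The rectangle witnessing badness then varies with the vertex,
-- and two averagings, over pairs and then over vertices, replace these rectangles by a single
-- biclique.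
--
-- The exponent 1 / 8d: an m × u biclique in a graph of density 1 / z costs a factor (4z)^m. With a
-- = 16r its logarithm is O(r^(3d+2) n) for fixed d, which fits into n² / r once r^(3d+3) ≤ n.
-- Taking r ≈ n^(1 / 8d) ensures this.
--
-- All inequalities are between natural numbers with denominators cleared; since `a` is `γ + 8`, the
-- ratio 1 - 8 / a appears as γ / a.

variable
  A B : Set

∑ : List A → (A → ℕ) → ℕ
∑ []       f = 0
∑ (x ∷ xs) f = f x + ∑ xs f

syntax ∑ xs (λ x → e) = ∑[ x ← xs ] e

⟦_⟧ : Bool → ℕ
⟦ true ⟧  = 1
⟦ false ⟧ = 0

⟦_⟧≤1 : ∀ p → ⟦ p ⟧ ≤ 1
⟦ true ⟧≤1  = ≤-refl
⟦ false ⟧≤1 = z≤n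

⟦∧⟧ : ∀ p q → ⟦ p ∧ q ⟧ ≡ ⟦ p ⟧ · ⟦ q ⟧
⟦∧⟧ true  q = sym (ℕ.+-identityʳ ⟦ q ⟧)
⟦∧⟧ false q = refl

⟦⟧-mono : ∀ p q → (p ≡ true → q ≡ true) → ⟦ p ⟧ ≤ ⟦ q ⟧
⟦⟧-mono true  q p⇒q rewrite p⇒q refl = ≤-refl
⟦⟧-mono false q p⇒q = z≤n

∧-true : ∀ {p q} → p ∧ q ≡ true → p ≡ true × q ≡ true
∧-true {true} {true} refl = refl , refl

true-∧ : ∀ {p q} → p ≡ true → q ≡ true → p ∧ q ≡ true
true-∧ refl refl = refl

does⇒ : ∀ {P : Set} (P? : Dec P) → does P? ≡ true → P
does⇒ (yes p) _ = p

≤ᵇ-true : ∀ m n → (m ℕ.≤ᵇ n) ≡ true → m ≤ n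
≤ᵇ-true m n eq = ℕ.≤ᵇ⇒≤ m n (subst T (sym eq) _)

≤ᵇ-false : ∀ m n → (m ℕ.≤ᵇ n) ≡ false → n <ⁿ m
≤ᵇ-false m n eq = ℕ.≰⇒> λ m≤n → subst T eq (ℕ.≤⇒≤ᵇ m≤n)

-- Weighted sums over lists

∑-cong : ∀ (xs : List A) {f g} → (∀ x → f x ≡ g x) → ∑ xs f ≡ ∑ xs g
∑-cong []       f≗g = refl
∑-cong (x ∷ xs) f≗g = cong₂ _+_ (f≗g x) (∑-cong xs f≗g)

∑-mono : ∀ (xs : List A) {f g} → (∀ {x} → x ∈ xs → f x ≤ g x) → ∑ xs f ≤ ∑ xs g
∑-mono []       f≤g = z≤n
∑-mono (x ∷ xs) f≤g = ℕ.+-mono-≤ (f≤g (here refl)) (∑-mono xs (f≤g ∘ there))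

∑-+ : ∀ (xs : List A) f g → ∑[ x ← xs ] (f x + g x) ≡ ∑ xs f + ∑ xs g
∑-+ []       f g = refl
∑-+ (x ∷ xs) f g = trans (cong (_ ℕ.+_) (∑-+ xs f g)) (interchange (f x) (g x) (∑ xs f) (∑ xs g))
  where
  interchange : ∀ a b c d → a + b + (c + d) ≡ a + c + (b + d)
  interchange = solve-∀

∑-*ˡ : ∀ c (xs : List A) f → ∑[ x ← xs ] (c · f x) ≡ c · ∑ xs f
∑-*ˡ c []       f = sym (ℕ.*-zeroʳ c)
∑-*ˡ c (x ∷ xs) f = trans (cong (_ ℕ.+_) (∑-*ˡ c xs f)) (sym (ℕ.*-distribˡ-+ c _ _))

∑-*ʳ : ∀ c (xs : List A) f → ∑[ x ← xs ] (f x · c) ≡ ∑ xs f · c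
∑-*ʳ c []       f = refl
∑-*ʳ c (x ∷ xs) f = trans (cong (_ ℕ.+_) (∑-*ʳ c xs f)) (sym (ℕ.*-distribʳ-+ c (f x) _))

∑-const : ∀ (xs : List A) c → ∑[ _ ← xs ] c ≡ length xs · c
∑-const []       c = refl
∑-const (x ∷ xs) c = cong (c ℕ.+_) (∑-const xs c)

∑-≤-const : ∀ (xs : List A) f c → (∀ {x} → x ∈ xs → f x ≤ c) → ∑ xs f ≤ length xs · c
∑-≤-const xs f c f≤c = ≤-trans (∑-mono xs f≤c) (≤-reflexive (∑-const xs c))

∑-≥-const : ∀ (xs : List A) f c → (∀ {x} → x ∈ xs → c ≤ f x) → length xs · c ≤ ∑ xs f
∑-≥-const xs f c c≤f = ≤-trans (≤-reflexive (sym (∑-const xs c))) (∑-mono xs c≤f)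

∑-swap : ∀ (xs : List A) (ys : List B) (f : A → B → ℕ) →
         ∑[ x ← xs ] ∑[ y ← ys ] f x y ≡ ∑[ y ← ys ] ∑[ x ← xs ] f x y
∑-swap []       ys f = sym (trans (∑-const ys 0) (ℕ.*-zeroʳ (length ys)))
∑-swap (x ∷ xs) ys f = trans (cong (∑ ys (f x) ℕ.+_) (∑-swap xs ys f)) (sym (∑-+ ys (f x) _))

∑-<⇒∃ : ∀ (xs : List A) f g → ∑ xs f <ⁿ ∑ xs g → ∃[ x ] x ∈ xs × f x <ⁿ g x
∑-<⇒∃ (x ∷ xs) f g ∑f<∑g with f x ℕ.<? g x
... | yes fx<gx = x , here refl , fx<gx
... | no  fx≮gx =
  let y , y∈xs , fy<gy = ∑-<⇒∃ xs f g (ℕ.≰⇒> λ ∑g≤∑f →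
        ℕ.<⇒≱ ∑f<∑g (ℕ.+-mono-≤ (ℕ.≮⇒≥ fx≮gx) ∑g≤∑f))
  in y , there y∈xs , fy<gy

∑-filterᵇ : ∀ p (xs : List A) f → ∑ (filterᵇ p xs) f ≡ ∑[ x ← xs ] (⟦ p x ⟧ · f x)
∑-filterᵇ p []       f = refl
∑-filterᵇ p (x ∷ xs) f with p x
... | true  = cong₂ _+_ (sym (ℕ.+-identityʳ (f x))) (∑-filterᵇ p xs f)
... | false = ∑-filterᵇ p xs f

length-filterᵇ : ∀ p (xs : List A) → length (filterᵇ p xs) ≡ ∑[ x ← xs ] ⟦ p x ⟧
length-filterᵇ p []       = refl
length-filterᵇ p (x ∷ xs) with p x
... | true  = cong suc (length-filterᵇ p xs)
... | false = length-filterᵇ p xs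

∈-filterᵇ⁻ : ∀ p {x} (xs : List A) → x ∈ filterᵇ p xs → x ∈ xs × p x ≡ true
∈-filterᵇ⁻ p (y ∷ ys) x∈ with p y in py
∈-filterᵇ⁻ p (y ∷ ys) (here refl) | true = here refl , py
∈-filterᵇ⁻ p (y ∷ ys) (there x∈)  | true = let x∈ys , px = ∈-filterᵇ⁻ p ys x∈ in there x∈ys , px
... | false = let x∈ys , px = ∈-filterᵇ⁻ p ys x∈ in there x∈ys , px

filterᵇ-unique : ∀ p {xs : List A} → Unique xs → Unique (filterᵇ p xs)
filterᵇ-unique p = Unique.filter⁺ _

-- Averaging: an element failing the test contributes less than `L + g x` to the sum of `f`, and one
-- passing it at most `K`, so the surplus `length xs · L` is paid by the latter. Subtracting `g`
-- lets a single average make `f` large and keep `g` below it at the same time.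
many-large : ∀ (xs : List A) f g K L → (∀ x → f x ≤ K) →
             2 · (length xs · L) + ∑ xs g ≤ ∑ xs f →
             length xs · L ≤ K · length (filterᵇ (λ x → L + g x ℕ.≤ᵇ f x) xs)
many-large {A = A} xs f g K L f≤K large = ℕ.+-cancelˡ-≤ (length xs · L + ∑ xs g) _ _ (begin
  length xs · L + ∑ xs g + length xs · L            ≡⟨ assoc (length xs · L) (∑ xs g) ⟩
  2 · (length xs · L) + ∑ xs g                      ≤⟨ large ⟩
  ∑ xs f                                            ≤⟨ ∑-mono xs (λ {x} _ → pointwise x) ⟩
  ∑[ x ← xs ] (L + g x + K · ⟦ big x ⟧)             ≡⟨ ∑-+ xs _ _ ⟩
  ∑[ x ← xs ] (L + g x) + ∑[ x ← xs ] (K · ⟦ big x ⟧)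
    ≡⟨ cong₂ _+_ (∑-+ xs _ g) (∑-*ˡ K xs _) ⟩
  ∑[ _ ← xs ] L + ∑ xs g + K · ∑[ x ← xs ] ⟦ big x ⟧
    ≡⟨ cong₂ (λ u v → u + ∑ xs g + K · v) (∑-const xs L) (sym (length-filterᵇ big xs)) ⟩
  length xs · L + ∑ xs g + K · length (filterᵇ big xs) ∎)
  where
  open ≤-Reasoning
  big : A → Bool
  big x = L + g x ℕ.≤ᵇ f x
  assoc : ∀ u v → u + v + u ≡ 2 · u + v
  assoc = solve-∀
  pointwise : ∀ x → f x ≤ L + g x + K · ⟦ big x ⟧
  pointwise x with L + g x ℕ.≤ᵇ f x in eq
  ... | true  = ≤-trans (f≤K x) (≤-trans (≤-reflexive (sym (ℕ.*-identityʳ K))) (ℕ.m≤n+m _ (L + g x)))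
  ... | false = ≤-trans (ℕ.<⇒≤ (≤ᵇ-false (L + g x) (f x) eq)) (ℕ.m≤m+n (L + g x) _)

remove : ∀ {x} {xs : List A} → x ∈ xs → Unique xs →
         ∃[ ys ] length xs ≡ suc (length ys) × Unique ys × All (x ≢_) ys ×
                 (∀ {y} → y ∈ ys → y ∈ xs) × (∀ f → ∑ xs f ≡ f x + ∑ ys f)
remove (here refl) (x∉ ∷ u) = _ , refl , u , x∉ , there , λ f → refl
remove {x = x} {z ∷ xs} (there x∈) (z∉ ∷ u) =
  let ys , len , uys , x∉ys , ys⊆ , ∑≡ = remove x∈ u in
  z ∷ ys , cong suc len ,
  All.tabulate (All.lookup z∉ ∘ ys⊆) ∷ uys ,
  (λ x≡z → All.lookup z∉ x∈ (sym x≡z)) ∷ x∉ys ,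
  (λ { (here e) → here e ; (there y∈) → there (ys⊆ y∈) }) ,
  λ f → trans (cong (f z ℕ.+_) (∑≡ f)) (comm (f z) (f x) (∑ ys f))
  where
  comm : ∀ a b c → a + (b + c) ≡ b + (a + c)
  comm = solve-∀

-- Bicliques by greedy choice

Biclique : (A → B → Bool) → List A → List B → Set
Biclique R xs ys = ∀ {x y} → x ∈ xs → y ∈ ys → R x y ≡ true

-- Every vertex of Y has degree at least the fraction γ / α of X, even after
-- any k vertices of X are deleted; hence each of k successive vertices of X
-- may be chosen adjacent to the fraction γ / α of what remains of Y.
greedy-biclique : ∀ (R : A → B → Bool) α γ p → 0 <ⁿ α → ∀ k (X : List A) (Y : List B) →
  Unique X → length X ≤ p → 0 <ⁿ length Y →
  (∀ {y} → y ∈ Y → γ · p + α · k ≤ α · ∑[ x ← X ] ⟦ R x y ⟧) →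
  ∃[ xs ] ∃[ ys ] length xs ≡ k × Unique xs × (∀ {x} → x ∈ xs → x ∈ X) ×
    (Unique Y → Unique ys) × (∀ {y} → y ∈ ys → y ∈ Y) × Biclique R xs ys ×
    γ ^ k · length Y ≤ α ^ k · length ys
greedy-biclique R α γ p 0<α zero X Y uX X≤p 0<Y deg =
  [] , Y , refl , [] , (λ ()) , id , id , (λ ()) , ≤-refl
greedy-biclique {A = A} R α γ p 0<α (suc k) X Y uX X≤p 0<Y deg =
  let x , x∈X , x-large          = ∑-<⇒∃ X _ _ average
      X′ , len , uX′ , x∉X′ , X′⊆X , ∑X≡ = remove x∈X uX
      Y₁                         = filterᵇ (R x) Y
      Y₁-large                   = subst (λ s → γ · length Y <ⁿ α · s) (sym (length-filterᵇ (R x) Y)) x-large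
      xs , ys , |xs| , uxs , xs⊆ , uys , ys⊆ , bi , size =
        greedy-biclique R α γ p 0<α k X′ Y₁ uX′
          (≤-trans (ℕ.n≤1+n _) (≤-trans (≤-reflexive (sym len)) X≤p))
          (positive (length Y₁) Y₁-large)
          (λ {y} y∈ → drop-one y x X′ (∑X≡ (λ x′ → ⟦ R x′ y ⟧)) (deg (proj₁ (∈-filterᵇ⁻ (R x) Y y∈))))
  in x ∷ xs , ys , cong suc |xs| ,
     All.tabulate (λ x′∈ → All.lookup x∉X′ (xs⊆ x′∈)) ∷ uxs ,
     (λ { (here refl) → x∈X ; (there x′∈) → X′⊆X (xs⊆ x′∈) }) ,
     (λ uY → uys (filterᵇ-unique (R x) uY)) ,
     (λ y∈ → proj₁ (∈-filterᵇ⁻ (R x) Y (ys⊆ y∈))) ,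
     (λ { (here refl) y∈ → proj₂ (∈-filterᵇ⁻ (R x) Y (ys⊆ y∈)) ; (there x′∈) y∈ → bi x′∈ y∈ }) ,
     (begin
       γ · γ ^ k · length Y      ≡⟨ rearrange γ (γ ^ k) (length Y) ⟩
       γ ^ k · (γ · length Y)    ≤⟨ ℕ.*-monoʳ-≤ (γ ^ k) (ℕ.<⇒≤ Y₁-large) ⟩
       γ ^ k · (α · length Y₁)   ≡⟨ rearrange′ (γ ^ k) α (length Y₁) ⟩
       α · (γ ^ k · length Y₁)   ≤⟨ ℕ.*-monoʳ-≤ α size ⟩
       α · (α ^ k · length ys)   ≡⟨ ℕ.*-assoc α (α ^ k) _ ⟨
       α · α ^ k · length ys     ∎)
  where
  open ≤-Reasoning
  rearrange : ∀ a b c → a · b · c ≡ b · (a · c)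
  rearrange = solve-∀
  rearrange′ : ∀ a b c → a · (b · c) ≡ b · (a · c)
  rearrange′ = solve-∀
  positive : ∀ m → γ · length Y <ⁿ α · m → 0 <ⁿ m
  positive zero    lt = contradiction (subst (γ · length Y <ⁿ_) (ℕ.*-zeroʳ α) lt) λ ()
  positive (suc m) _  = z<s
  -- The summand `α · suc k` makes the inequality strict; strictness keeps `Y₁` nonempty for the
  -- next round.
  average : ∑[ x ← X ] (γ · length Y) <ⁿ ∑[ x ← X ] (α · ∑[ y ← Y ] ⟦ R x y ⟧)
  average = begin-strict
    ∑[ x ← X ] (γ · length Y)                    ≡⟨ ∑-const X _ ⟩
    length X · (γ · length Y)                    ≤⟨ ℕ.*-monoˡ-≤ _ X≤p ⟩
    p · (γ · length Y)                           ≡⟨ ℕ.+-identityʳ _ ⟨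
    p · (γ · length Y) + 0                       <⟨ ℕ.+-monoʳ-< _ (ℕ.*-mono-< 0<Y (ℕ.*-mono-< 0<α (z<s {k}))) ⟩
    p · (γ · length Y) + length Y · (α · suc k)  ≡⟨ factor p γ (length Y) (α · suc k) ⟩
    length Y · (γ · p + α · suc k)               ≤⟨ ∑-≥-const Y _ _ deg ⟩
    ∑[ y ← Y ] (α · ∑[ x ← X ] ⟦ R x y ⟧)        ≡⟨ ∑-*ˡ α Y _ ⟩
    α · ∑[ y ← Y ] ∑[ x ← X ] ⟦ R x y ⟧          ≡⟨ cong (α ·_) (∑-swap X Y (λ x y → ⟦ R x y ⟧)) ⟨
    α · ∑[ x ← X ] ∑[ y ← Y ] ⟦ R x y ⟧          ≡⟨ ∑-*ˡ α X _ ⟨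
    ∑[ x ← X ] (α · ∑[ y ← Y ] ⟦ R x y ⟧)        ∎
    where
    factor : ∀ a b c e → a · (b · c) + c · e ≡ c · (b · a + e)
    factor = solve-∀
  -- Deleting one vertex of `X` lowers a degree by at most 1, which is what the reserve `α · suc k`
  -- loses on becoming `α · k`. The bound `p` refers to the original `X` throughout.
  drop-one : ∀ y x (X′ : List A) → ∑[ x′ ← X ] ⟦ R x′ y ⟧ ≡ ⟦ R x y ⟧ + ∑[ x′ ← X′ ] ⟦ R x′ y ⟧ →
             γ · p + α · suc k ≤ α · ∑[ x′ ← X ] ⟦ R x′ y ⟧ →
             γ · p + α · k ≤ α · ∑[ x′ ← X′ ] ⟦ R x′ y ⟧
  drop-one y x X′ ∑≡ le = ℕ.+-cancelˡ-≤ α _ _ (begin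
    α + (γ · p + α · k)                      ≡⟨ shift α (γ · p) k ⟩
    γ · p + α · suc k                        ≤⟨ le ⟩
    α · ∑[ x′ ← X ] ⟦ R x′ y ⟧               ≡⟨ cong (α ·_) ∑≡ ⟩
    α · (⟦ R x y ⟧ + s)                      ≤⟨ ℕ.*-monoʳ-≤ α (ℕ.+-monoˡ-≤ s ⟦ R x y ⟧≤1) ⟩
    α · suc s                                ≡⟨ ℕ.*-suc α s ⟩
    α + α · s                                ∎)
    where
    s = ∑[ x′ ← X′ ] ⟦ R x′ y ⟧
    shift : ∀ a b k → a + (b + a · k) ≡ b + a · suc k
    shift = solve-∀

∑-complement : ∀ (p : A → Bool) xs → ∑[ x ← xs ] ⟦ not (p x) ⟧ + ∑[ x ← xs ] ⟦ p x ⟧ ≡ length xs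
∑-complement p xs = begin
  ∑[ x ← xs ] ⟦ not (p x) ⟧ + ∑[ x ← xs ] ⟦ p x ⟧   ≡⟨ ∑-+ xs _ _ ⟨
  ∑[ x ← xs ] (⟦ not (p x) ⟧ + ⟦ p x ⟧)              ≡⟨ ∑-cong xs (λ x → complement (p x)) ⟩
  ∑[ _ ← xs ] 1                                       ≡⟨ ∑-const xs 1 ⟩
  length xs · 1                                       ≡⟨ ℕ.*-identityʳ _ ⟩
  length xs                                           ∎
  where
  open ≡-Reasoning
  complement : ∀ b → ⟦ not b ⟧ + ⟦ b ⟧ ≡ 1
  complement true  = refl
  complement false = refl

*-cancelˡ-≤-pos : ∀ k {m n} → 0 <ⁿ k → k · m ≤ k · n → m ≤ n
*-cancelˡ-≤-pos (suc k) _ = ℕ.*-cancelˡ-≤ (suc k)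

*-cancelʳ-≤-pos : ∀ k {m n} → 0 <ⁿ k → m · k ≤ n · k → m ≤ n
*-cancelʳ-≤-pos (suc k) _ = ℕ.*-cancelʳ-≤ _ _ (suc k)

*-pos : ∀ {m n} → 0 <ⁿ m → 0 <ⁿ n → 0 <ⁿ m · n
*-pos = ℕ.*-mono-<

^-pos : ∀ {m} n → 0 <ⁿ m → 0 <ⁿ m ^ n
^-pos zero    0<m = z<s
^-pos (suc n) 0<m = *-pos 0<m (^-pos n 0<m)

*-pos⁻ʳ : ∀ m {n} → 0 <ⁿ m · n → 0 <ⁿ n
*-pos⁻ʳ m {zero}  lt = contradiction (subst (0 <ⁿ_) (ℕ.*-zeroʳ m) lt) λ ()
*-pos⁻ʳ m {suc n} lt = z<s

take-length : ∀ n (xs : List A) → n ≤ length xs → length (List.take n xs) ≡ n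
take-length n xs n≤ = trans (List.length-take n xs) (ℕ.m≤n⇒m⊓n≡m n≤)

take-⊆ : ∀ n {xs : List A} {x} → x ∈ List.take n xs → x ∈ xs
take-⊆ (suc n) {x ∷ xs} (here eq)  = here eq
take-⊆ (suc n) {x ∷ xs} (there x∈) = there (take-⊆ n x∈)

Grid : {A B : Set} → (A → B → Bool) → ℕ → List A → List B → Set
Grid R n X Y = ∃[ xs ] ∃[ ys ] (length xs ≡ n × length ys ≡ n) × (Unique xs × Unique ys) ×
  ((∀ {x} → x ∈ xs → x ∈ X) × (∀ {y} → y ∈ ys → y ∈ Y)) × Biclique R xs ys

-- The hypothesis on c makes X and Y large in [m] and [u] and bounds the
-- density of c between them by 2 / (γ + 8).
sparse⇒grid : ∀ (c : A → B → Bool) n γ z e m u X Y →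
  0 <ⁿ n → 0 <ⁿ γ → 0 <ⁿ z → 0 <ⁿ m → 0 <ⁿ u →
  Unique X → Unique Y → length X ≤ m → length Y ≤ u →
  2 · z · ((γ + 8) · n) ≤ m → 4 · z · (n · 2 ^ e) ≤ u → (γ + 8) ^ n ≤ 2 ^ e · γ ^ n →
  m · u + z · ((γ + 8) · ∑[ y ← Y ] ∑[ x ← X ] ⟦ c x y ⟧) ≤ 2 · z · (length X · length Y) →
  Grid (λ x y → not (c x y)) n X Y
sparse⇒grid {A = A} {B = B} c n γ z e m u X Y 0<n 0<γ 0<z 0<m 0<u uX uY X≤m Y≤u m-large u-large growth sparse =
  let xs , ys , |xs| , uxs , xs⊆ , uys , ys⊆ , bi , size =
        greedy-biclique (λ x y → not (c x y)) a γ (length X) (ℕ.<-≤-trans 0<γ (ℕ.m≤m+n γ 8)) n X Y₁ uX ≤-refl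
          (ℕ.<-≤-trans (*-pos 0<n (^-pos e (z<s {1}))) Y₁-large) degree
      -- The n greedy choices keep the fraction (γ / a)^n of `Y₁`, which `growth` bounds below by
      -- 2^(- e).
      n≤ys = *-cancelˡ-≤-pos (γ ^ n · 2 ^ e) (*-pos (^-pos n 0<γ) (^-pos e (z<s {1}))) (begin
        γ ^ n · 2 ^ e · n             ≡⟨ assoc (γ ^ n) (2 ^ e) n ⟩
        γ ^ n · (n · 2 ^ e)           ≤⟨ ℕ.*-monoʳ-≤ (γ ^ n) Y₁-large ⟩
        γ ^ n · length Y₁             ≤⟨ size ⟩
        a ^ n · length ys             ≤⟨ ℕ.*-monoˡ-≤ (length ys) growth ⟩
        2 ^ e · γ ^ n · length ys     ≡⟨ cong (_· length ys) (ℕ.*-comm (2 ^ e) (γ ^ n)) ⟩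
        γ ^ n · 2 ^ e · length ys     ∎)
  in xs , List.take n ys , (|xs| , take-length n ys n≤ys) ,
     (uxs , Unique.take⁺ n (uys (filterᵇ-unique sparse-at uY))) ,
     (xs⊆ , λ y∈ → proj₁ (∈-filterᵇ⁻ sparse-at Y (ys⊆ (take-⊆ n y∈)))) ,
     λ x∈ y∈ → bi x∈ (take-⊆ n y∈)
  where
  open ≤-Reasoning
  a = γ + 8
  β = ∑[ y ← Y ] ∑[ x ← X ] ⟦ c x y ⟧
  sparse-at : B → Bool
  sparse-at y = a · ∑[ x ← X ] ⟦ c x y ⟧ ℕ.≤ᵇ 4 · length X
  Y₁ = filterᵇ sparse-at Y
  assoc : ∀ p q n → p · q · n ≡ p · (n · q)
  assoc = solve-∀
  0<2z : 0 <ⁿ 2 · z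
  0<2z = *-pos (z<s {1}) 0<z
  m≤X : m ≤ 2 · z · length X
  m≤X = *-cancelʳ-≤-pos u 0<u (begin
    m · u                              ≤⟨ ℕ.m≤m+n (m · u) _ ⟩
    m · u + z · (a · β)                ≤⟨ sparse ⟩
    2 · z · (length X · length Y)      ≤⟨ ℕ.*-monoʳ-≤ (2 · z) (ℕ.*-monoʳ-≤ (length X) Y≤u) ⟩
    2 · z · (length X · u)             ≡⟨ ℕ.*-assoc (2 · z) (length X) u ⟨
    2 · z · length X · u               ∎)
  u≤Y : u ≤ 2 · z · length Y
  u≤Y = *-cancelʳ-≤-pos m 0<m (begin
    u · m                              ≡⟨ ℕ.*-comm u m ⟩
    m · u                              ≤⟨ ℕ.m≤m+n (m · u) _ ⟩
    m · u + z · (a · β)                ≤⟨ sparse ⟩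
    2 · z · (length X · length Y)      ≤⟨ ℕ.*-monoʳ-≤ (2 · z) (ℕ.*-monoˡ-≤ (length Y) X≤m) ⟩
    2 · z · (m · length Y)             ≡⟨ assoc (2 · z) (length Y) m ⟨
    2 · z · length Y · m               ∎)
  0<X : 0 <ⁿ length X
  0<X = *-pos⁻ʳ (2 · z) (ℕ.<-≤-trans 0<m m≤X)
  an≤X : a · n ≤ length X
  an≤X = *-cancelˡ-≤-pos (2 · z) 0<2z (≤-trans m-large m≤X)
  aβ≤ : a · β ≤ 2 · (length X · length Y)
  aβ≤ = *-cancelˡ-≤-pos z 0<z (begin
    z · (a · β)                        ≤⟨ ℕ.m≤n+m _ (m · u) ⟩
    m · u + z · (a · β)                ≤⟨ sparse ⟩
    2 · z · (length X · length Y)      ≡⟨ assoc′ z _ ⟩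
    z · (2 · (length X · length Y))    ∎)
    where
    assoc′ : ∀ z w → 2 · z · w ≡ z · (2 · w)
    assoc′ = solve-∀
  -- Markov's inequality: the threshold 4 / a of `sparse-at` is twice the bound 2 / a on the mean
  -- density, so at least half of `Y` passes.
  Y≤2Y₁ : length Y ≤ 2 · length Y₁
  Y≤2Y₁ = *-cancelˡ-≤-pos (2 · length X) (*-pos (z<s {1}) 0<X)
    (ℕ.+-cancelˡ-≤ (2 · (length X · length Y)) _ _ (begin
    2 · (length X · length Y) + 2 · length X · length Y
      ≡⟨ double (length X) (length Y) ⟩
    length Y · (4 · length X)
      ≤⟨ ∑-≥-const Y _ _ (λ {y} _ → pointwise y) ⟩
    ∑[ y ← Y ] (a · ∑[ x ← X ] ⟦ c x y ⟧ + 4 · length X · ⟦ sparse-at y ⟧)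
      ≡⟨ ∑-+ Y _ _ ⟩
    ∑[ y ← Y ] (a · ∑[ x ← X ] ⟦ c x y ⟧) + ∑[ y ← Y ] (4 · length X · ⟦ sparse-at y ⟧)
      ≡⟨ cong₂ _+_ (∑-*ˡ a Y _) (∑-*ˡ (4 · length X) Y _) ⟩
    a · β + 4 · length X · ∑[ y ← Y ] ⟦ sparse-at y ⟧
      ≤⟨ ℕ.+-mono-≤ aβ≤ (≤-reflexive (cong (4 · length X ·_) (sym (length-filterᵇ sparse-at Y)))) ⟩
    2 · (length X · length Y) + 4 · length X · length Y₁
      ≡⟨ cong (2 · (length X · length Y) ℕ.+_) (regroup (length X) (length Y₁)) ⟩
    2 · (length X · length Y) + 2 · length X · (2 · length Y₁) ∎))
    where
    double : ∀ p q → 2 · (p · q) + 2 · p · q ≡ q · (4 · p)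
    double = solve-∀
    regroup : ∀ p q → 4 · p · q ≡ 2 · p · (2 · q)
    regroup = solve-∀
    pointwise : ∀ y → 4 · length X ≤ a · ∑[ x ← X ] ⟦ c x y ⟧ + 4 · length X · ⟦ sparse-at y ⟧
    pointwise y with sparse-at y in eq
    ... | true  = ≤-trans (≤-reflexive (sym (ℕ.*-identityʳ (4 · length X)))) (ℕ.m≤n+m _ (a · _))
    ... | false = ≤-trans (ℕ.<⇒≤ (≤ᵇ-false (a · _) (4 · length X) eq)) (ℕ.m≤m+n (a · _) _)
  Y₁-large : n · 2 ^ e ≤ length Y₁
  Y₁-large = *-cancelˡ-≤-pos (4 · z) (*-pos (z<s {3}) 0<z) (begin
    4 · z · (n · 2 ^ e)           ≤⟨ u-large ⟩
    u                             ≤⟨ u≤Y ⟩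
    2 · z · length Y              ≤⟨ ℕ.*-monoʳ-≤ (2 · z) Y≤2Y₁ ⟩
    2 · z · (2 · length Y₁)       ≡⟨ regroup z (length Y₁) ⟩
    4 · z · length Y₁             ∎)
    where
    regroup : ∀ p q → 2 · p · (2 · q) ≡ 4 · p · q
    regroup = solve-∀
  -- This is the origin of the 8 in `γ + 8`: 4 covers the neighbours under `c`, and 4 the n vertices
  -- of `X` that may have been deleted.
  degree : ∀ {y} → y ∈ Y₁ → γ · length X + a · n ≤ a · ∑[ x ← X ] ⟦ not (c x y) ⟧
  degree {y} y∈ = ℕ.+-cancelʳ-≤ (a · bl) _ _ (begin
    γ · length X + a · n + a · bl
      ≤⟨ ℕ.+-mono-≤ (ℕ.+-monoʳ-≤ (γ · length X) (≤-trans an≤X (ℕ.m≤n*m (length X) 4)))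
                    (≤ᵇ-true (a · bl) (4 · length X) (proj₂ (∈-filterᵇ⁻ sparse-at Y y∈))) ⟩
    γ · length X + 4 · length X + 4 · length X  ≡⟨ collect γ (length X) ⟩
    a · length X                                ≡⟨ cong (a ·_) (∑-complement (λ x → c x y) X) ⟨
    a · (∑[ x ← X ] ⟦ not (c x y) ⟧ + bl)       ≡⟨ ℕ.*-distribˡ-+ a _ bl ⟩
    a · ∑[ x ← X ] ⟦ not (c x y) ⟧ + a · bl     ∎)
    where
    bl = ∑[ x ← X ] ⟦ c x y ⟧
    collect : ∀ g p → g · p + 4 · p + 4 · p ≡ (g + 8) · p
    collect = solve-∀

∑-++ : ∀ (xs ys : List A) f → ∑ (xs ++ ys) f ≡ ∑ xs f + ∑ ys f
∑-++ []       ys f = refl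
∑-++ (x ∷ xs) ys f = trans (cong (f x ℕ.+_) (∑-++ xs ys f)) (sym (ℕ.+-assoc (f x) _ _))

∑-map : ∀ (h : A → B) xs f → ∑ (map h xs) f ≡ ∑ xs (f ∘ h)
∑-map h []       f = refl
∑-map h (x ∷ xs) f = cong (f (h x) ℕ.+_) (∑-map h xs f)

∑-product : ∀ {C : Set} (h : A → B → C) xs ys f →
            ∑ (List.cartesianProductWith h xs ys) f ≡ ∑[ x ← xs ] ∑[ y ← ys ] f (h x y)
∑-product h []       ys f = refl
∑-product h (x ∷ xs) ys f =
  trans (∑-++ (map (h x) ys) _ f) (cong₂ _+_ (∑-map (h x) ys f) (∑-product h xs ys f))

length-product : ∀ {C : Set} (h : A → B → C) xs ys →
                 length (List.cartesianProductWith h xs ys) ≡ length xs · length ys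
length-product h []       ys = refl
length-product h (x ∷ xs) ys = trans (List.length-++ (map (h x) ys))
  (cong₂ _+_ (List.length-map (h x) ys) (length-product h xs ys))

-- An asymmetric Kővári-Sós-Turán argument. At density 1 / z, at least |Y| / 2z of the `y` have
-- degree at least |X| / 2z. Half of that degree is reserved for the m vertices used up, so every
-- greedy choice keeps the fraction 1 / 4z, and (4z)^m · u vertices leave u.
dense⇒biclique : ∀ (R : A → B → Bool) z m u X Y → 0 <ⁿ z → 0 <ⁿ m → 0 <ⁿ u →
  Unique X → Unique Y → 4 · z · m ≤ length X → 2 · z · ((4 · z) ^ m · u) ≤ length Y →
  length X · length Y ≤ z · ∑[ y ← Y ] ∑[ x ← X ] ⟦ R x y ⟧ →
  ∃[ xs ] ∃[ ys ] (length xs ≡ m × length ys ≡ u) × (Unique xs × Unique ys) ×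
    ((∀ {x} → x ∈ xs → x ∈ X) × (∀ {y} → y ∈ ys → y ∈ Y)) × Biclique R xs ys
dense⇒biclique {B = B} R z m u X Y 0<z 0<m 0<u uX uY X-large Y-large dense =
  let xs , ys , |xs| , uxs , xs⊆ , uys , ys⊆ , bi , size =
        greedy-biclique R (4 · z) 1 (length X) 0<4z m X Y₁ uX ≤-refl
          (ℕ.<-≤-trans (*-pos (^-pos m 0<4z) 0<u) Y₁-large) degree
      u≤ys = *-cancelˡ-≤-pos ((4 · z) ^ m) (^-pos m 0<4z) (begin
        (4 · z) ^ m · u             ≤⟨ Y₁-large ⟩
        length Y₁                   ≡⟨ ℕ.*-identityˡ _ ⟨
        1 · length Y₁               ≡⟨ cong (_· length Y₁) (ℕ.^-zeroˡ m) ⟨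
        1 ^ m · length Y₁           ≤⟨ size ⟩
        (4 · z) ^ m · length ys     ∎)
  in xs , List.take u ys , (|xs| , take-length u ys u≤ys) ,
     (uxs , Unique.take⁺ u (uys (filterᵇ-unique large-at uY))) ,
     (xs⊆ , λ y∈ → proj₁ (∈-filterᵇ⁻ large-at Y (ys⊆ (take-⊆ u y∈)))) ,
     λ x∈ y∈ → bi x∈ (take-⊆ u y∈)
  where
  open ≤-Reasoning
  deg : B → ℕ
  deg y = ∑[ x ← X ] ⟦ R x y ⟧
  large-at : B → Bool
  -- The `+ 0` is the zero function `g` in the test of `many-large`.
  large-at y = length X + 0 ℕ.≤ᵇ 2 · z · deg y
  Y₁ = filterᵇ large-at Y
  0<4z : 0 <ⁿ 4 · z
  0<4z = *-pos (z<s {3}) 0<z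
  0<X : 0 <ⁿ length X
  0<X = ℕ.<-≤-trans (*-pos 0<4z 0<m) X-large
  deg≤ : ∀ y → deg y ≤ length X
  deg≤ y = ≤-trans (∑-≤-const X _ 1 (λ {x} _ → ⟦ R x y ⟧≤1)) (≤-reflexive (ℕ.*-identityʳ _))
  Y≤Y₁ : length Y · length X ≤ 2 · z · length X · length Y₁
  Y≤Y₁ = many-large Y (λ y → 2 · z · deg y) (λ _ → 0) (2 · z · length X) (length X)
    (λ y → ℕ.*-monoʳ-≤ (2 · z) (deg≤ y)) (begin
      2 · (length Y · length X) + ∑[ _ ← Y ] 0
        ≡⟨ cong (2 · (length Y · length X) ℕ.+_) (trans (∑-const Y 0) (ℕ.*-zeroʳ (length Y))) ⟩
      2 · (length Y · length X) + 0        ≡⟨ ℕ.+-identityʳ _ ⟩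
      2 · (length Y · length X)            ≡⟨ cong (2 ·_) (ℕ.*-comm (length Y) (length X)) ⟩
      2 · (length X · length Y)            ≤⟨ ℕ.*-monoʳ-≤ 2 dense ⟩
      2 · (z · ∑ Y deg)                    ≡⟨ ℕ.*-assoc 2 z (∑ Y deg) ⟨
      2 · z · ∑ Y deg                      ≡⟨ ∑-*ˡ (2 · z) Y deg ⟨
      ∑[ y ← Y ] (2 · z · deg y)           ∎)
  Y₁-large : (4 · z) ^ m · u ≤ length Y₁
  Y₁-large = *-cancelˡ-≤-pos (2 · z) (*-pos (z<s {1}) 0<z) (≤-trans Y-large
    (*-cancelʳ-≤-pos (length X) 0<X (≤-trans Y≤Y₁ (≤-reflexive (swap (2 · z) _ _)))))
    where
    swap : ∀ p q r → p · q · r ≡ p · r · q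
    swap = solve-∀
  degree : ∀ {y} → y ∈ Y₁ → 1 · length X + 4 · z · m ≤ 4 · z · deg y
  degree {y} y∈ = begin
    1 · length X + 4 · z · m        ≡⟨ cong (_+ 4 · z · m) (ℕ.*-identityˡ _) ⟩
    length X + 4 · z · m            ≤⟨ ℕ.+-monoʳ-≤ (length X) X-large ⟩
    length X + length X             ≡⟨ double (length X) ⟩
    2 · (length X + 0)              ≤⟨ ℕ.*-monoʳ-≤ 2 (≤ᵇ-true (length X + 0) (2 · z · deg y) (proj₂ (∈-filterᵇ⁻ large-at Y y∈))) ⟩
    2 · (2 · z · deg y)             ≡⟨ assoc z (deg y) ⟩
    4 · z · deg y                   ∎
    where
    double : ∀ p → p + p ≡ 2 · (p + 0)
    double = solve-∀
    assoc : ∀ p q → 2 · (2 · p · q) ≡ 4 · p · q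
    assoc = solve-∀

-- Pigeonhole over the grids inside a biclique

tuples : ℕ → List A → List (List A)
tuples zero    xs = [] ∷ []
tuples (suc n) xs = List.cartesianProductWith _∷_ xs (tuples n xs)

length-tuples : ∀ n (xs : List A) → length (tuples n xs) ≡ length xs ^ n
length-tuples zero    xs = refl
length-tuples (suc n) xs =
  trans (length-product _∷_ xs (tuples n xs)) (cong (length xs ·_) (length-tuples n xs))

∈-tuples⁺ : ∀ {n} {xs ys : List A} → length ys ≡ n → (∀ {y} → y ∈ ys → y ∈ xs) → ys ∈ tuples n xs
∈-tuples⁺ {ys = []}     refl _   = here refl
∈-tuples⁺ {ys = y ∷ ys} refl ys⊆ =
  Mem.∈-cartesianProductWith⁺ _∷_ (ys⊆ (here refl)) (∈-tuples⁺ refl (ys⊆ ∘ there))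

∈-tuples⁻ : ∀ n {xs ys : List A} → ys ∈ tuples n xs → length ys ≡ n × (∀ {y} → y ∈ ys → y ∈ xs)
∈-tuples⁻ zero    (here refl) = refl , λ ()
∈-tuples⁻ (suc n) {xs} ys∈
  with y , ys′ , y∈ , ys′∈ , refl ← Mem.∈-cartesianProductWith⁻ _∷_ xs (tuples n xs) ys∈ =
  let len , ys′⊆ = ∈-tuples⁻ n ys′∈ in
  cong suc len , λ { (here refl) → y∈ ; (there z∈) → ys′⊆ z∈ }

Cube : {A B C : Set} → (A → B → C → Bool) → ℕ → List A → List B → List C → Set
Cube R n X Y Z = ∃[ xs ] ∃[ ys ] ∃[ zs ] (n ≤ length xs × n ≤ length ys × n ≤ length zs) ×
  (Unique xs × Unique ys × Unique zs) ×
  ((∀ {x} → x ∈ xs → x ∈ X) × (∀ {y} → y ∈ ys → y ∈ Y) × (∀ {z} → z ∈ zs → z ∈ Z)) ×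
  (∀ {x y z} → x ∈ xs → y ∈ ys → z ∈ zs → R x y z ≡ true)

Cube-⊆ : ∀ {C : Set} (R : A → B → C → Bool) n {X X′ : List A} {Y Y′ : List B} {Z Z′ : List C} →
  (∀ {x} → x ∈ X → x ∈ X′) → (∀ {y} → y ∈ Y → y ∈ Y′) → (∀ {z} → z ∈ Z → z ∈ Z′) →
  Cube R n X Y Z → Cube R n X′ Y′ Z′
Cube-⊆ R n X⊆ Y⊆ Z⊆ (xs , ys , zs , sizes , unique , (xs⊆ , ys⊆ , zs⊆) , all) =
  xs , ys , zs , sizes , unique , (X⊆ ∘ xs⊆ , Y⊆ ∘ ys⊆ , Z⊆ ∘ zs⊆) , all

-- Every `v` fits at least one of the |X|^n |Y|^n pairs of tuples, so some pair is fitted by n of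
-- them on average. Ordered tuples with repetitions keep the count simple; `Fits` restores
-- distinctness.
common-grid : ∀ {V : Set} → DecidableEquality A → DecidableEquality B →
  (R : V → A → B → Bool) (n : ℕ) (S : List V) (X : List A) (Y : List B) → 0 <ⁿ n →
  Unique S → 0 <ⁿ length X → 0 <ⁿ length Y →
  n · (length X ^ n · length Y ^ n) ≤ length S → (∀ {v} → v ∈ S → Grid (R v) n X Y) →
  Cube R n S X Y
common-grid {A = A} {B = B} {V} _≟ᴬ_ _≟ᴮ_ R (suc n) S X Y _ uS 0<X 0<Y S-large grids =
  -- Here `n` is one less than the size wanted, so the strict inequality from averaging is the
  -- required bound.
  let (xs , ys) , k∈ , popular = ∑-<⇒∃ Ks (λ _ → n) _ average
      vs                       = filterᵇ (fits (xs , ys)) S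
      n<vs                     = subst (n <ⁿ_) (sym (length-filterᵇ (fits (xs , ys)) S)) popular
      xs∈ , ys∈                = Mem.∈-cartesianProduct⁻ (tuples (suc n) X) (tuples (suc n) Y) k∈
      |xs| , xs⊆               = ∈-tuples⁻ (suc n) xs∈
      |ys| , ys⊆               = ∈-tuples⁻ (suc n) ys∈
      fit                      = λ {v} v∈ → does⇒ (fits? v (xs , ys)) (proj₂ (∈-filterᵇ⁻ (fits (xs , ys)) S v∈))
      -- A tuple is known to be repetition-free only through some vertex that fits it, hence the
      -- need for one.
      v₀ , v₀∈                 = inhabited vs n<vs
      uxs , uys , _            = fit v₀∈
  in vs , xs , ys , (n<vs , ≤-reflexive (sym |xs|) , ≤-reflexive (sym |ys|)) ,
     (filterᵇ-unique _ uS , uxs , uys) ,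
     ((λ v∈ → proj₁ (∈-filterᵇ⁻ (fits (xs , ys)) S v∈)) , xs⊆ , ys⊆) ,
     λ v∈ x∈ y∈ → All.lookup (All.lookup (proj₂ (proj₂ (fit v∈))) x∈) y∈
  where
  open ≤-Reasoning
  Ks = List.cartesianProduct (tuples (suc n) X) (tuples (suc n) Y)
  Fits : V → List A × List B → Set
  Fits v (xs , ys) = Unique xs × Unique ys × All (λ x → All (λ y → R v x y ≡ true) ys) xs
  fits? : ∀ v k → Dec (Fits v k)
  fits? v (xs , ys) = DecUnique.unique? _≟ᴬ_ xs ×-dec DecUnique.unique? _≟ᴮ_ ys ×-dec
    All.all? (λ x → All.all? (λ y → R v x y Bool.≟ true) ys) xs
  fits : List A × List B → V → Bool
  fits k v = does (fits? v k)
  inhabited : ∀ (vs : List V) → n <ⁿ length vs → ∃[ v ] v ∈ vs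
  inhabited (v ∷ vs) _ = v , here refl
  member : ∀ (ks : List (List A × List B)) {k} {p : List A × List B → Bool} → k ∈ ks → p k ≡ true → 1 ≤ ∑[ k ← ks ] ⟦ p k ⟧
  member (k ∷ ks) (here refl) pk rewrite pk = s≤s z≤n
  member (k ∷ ks) {p = p} (there k∈) pk = ≤-trans (member ks k∈ pk) (ℕ.m≤n+m _ ⟦ p k ⟧)
  |Ks| : length Ks ≡ length X ^ suc n · length Y ^ suc n
  |Ks| = trans (length-product _,_ (tuples (suc n) X) (tuples (suc n) Y))
    (cong₂ _·_ (length-tuples (suc n) X) (length-tuples (suc n) Y))
  average : ∑[ _ ← Ks ] n <ⁿ ∑[ k ← Ks ] ∑[ v ← S ] ⟦ fits k v ⟧
  average = begin-strict
    ∑[ _ ← Ks ] n                          ≡⟨ ∑-const Ks n ⟩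
    length Ks · n                          ≡⟨ ℕ.*-comm (length Ks) n ⟩
    n · length Ks                          <⟨ ℕ.m<n+m _ (subst (0 <ⁿ_) (sym |Ks|) (*-pos (^-pos (suc n) 0<X) (^-pos (suc n) 0<Y))) ⟩
    suc n · length Ks                      ≡⟨ cong (suc n ·_) |Ks| ⟩
    suc n · (length X ^ suc n · length Y ^ suc n) ≤⟨ S-large ⟩
    length S                               ≡⟨ ℕ.*-identityʳ _ ⟨
    length S · 1                           ≤⟨ ∑-≥-const S _ 1 (λ {v} v∈ → exists v (grids v∈)) ⟩
    ∑[ v ← S ] ∑[ k ← Ks ] ⟦ fits k v ⟧    ≡⟨ ∑-swap S Ks _ ⟩
    ∑[ k ← Ks ] ∑[ v ← S ] ⟦ fits k v ⟧    ∎
    where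
    exists : ∀ v → Grid (R v) (suc n) X Y → 1 ≤ ∑[ k ← Ks ] ⟦ fits k v ⟧
    exists v (xs , ys , (|xs| , |ys|) , (uxs , uys) , (xs⊆ , ys⊆) , bi) =
      member Ks (Mem.∈-cartesianProduct⁺ (∈-tuples⁺ |xs| xs⊆) (∈-tuples⁺ |ys| ys⊆))
        (dec-true (fits? v (xs , ys)) (uxs , uys , All.tabulate λ x∈ → All.tabulate λ y∈ → bi x∈ y∈))

-- inZ singles out the pairs of G that many of the rectangles p v × q v cover
-- but few of the links of the v hit.  A biclique T × U of such pairs is small
-- enough for a pigeonhole over its n × n grids, and S′ T U are the v whose
-- trace on it is still a large rectangle with a sparse link.
sparse-links⇒cube : ∀ {V : Set} → DecidableEquality A → DecidableEquality B →
  ∀ (c : V → A → B → Bool) (G : A → B → Bool) (p : V → A → Bool) (q : V → B → Bool)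
  n γ e P m u S X Y → 0 <ⁿ n → 0 <ⁿ γ → 0 <ⁿ P → 0 <ⁿ m → 0 <ⁿ u →
  Unique S → Unique X → Unique Y →
  2 · (4 · P) · ((γ + 8) · n) ≤ m → 4 · (4 · P) · (n · 2 ^ e) ≤ u → (γ + 8) ^ n ≤ 2 ^ e · γ ^ n →
  2 · (4 · P) · (n · (m ^ n · u ^ n)) ≤ length S →
  4 · (4 · P) · m ≤ length X → 2 · (4 · P) · ((4 · (4 · P)) ^ m · u) ≤ length Y →
  (∀ {v} → v ∈ S →
    length X · length Y + P · ((γ + 8) · ∑[ y ← Y ] ∑[ x ← X ] ⟦ G x y ∧ ((p v x ∧ q v y) ∧ c v x y) ⟧) ≤
    2 · (P · ∑[ y ← Y ] ∑[ x ← X ] ⟦ G x y ∧ (p v x ∧ q v y) ⟧)) →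
  Cube (λ v x y → not (c v x y)) n S X Y
sparse-links⇒cube {A = A} {B = B} {V} _≟ᴬ_ _≟ᴮ_ c G p q n γ e P m u S X Y 0<n 0<γ 0<P 0<m 0<u
  uS uX uY m-large u-large growth S-large X-large Y-large sparse =
  let T , U , (|T| , |U|) , (uT , uU) , (T⊆ , U⊆) , bi =
        dense⇒biclique (λ x y → inZ (y , x)) z m u X Y 0<z 0<m 0<u uX uY X-large Y-large Z-dense
      S′≥ , grids = trace T U |T| |U| uT uU bi
  in Cube-⊆ (λ v x y → not (c v x y)) n (λ v∈ → proj₁ (∈-filterᵇ⁻ _ S v∈)) T⊆ U⊆
       (common-grid _≟ᴬ_ _≟ᴮ_ (λ v x y → not (c v x y)) n (S′ T U) T U 0<n (filterᵇ-unique _ uS)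
         (subst (0 <ⁿ_) (sym |T|) 0<m) (subst (0 <ⁿ_) (sym |U|) 0<u)
         (subst₂ (λ m u → n · (m ^ n · u ^ n) ≤ length (S′ T U)) (sym |T|) (sym |U|) S′≥) grids)
  where
  open ≤-Reasoning
  a = γ + 8
  z = 4 · P
  0<z : 0 <ⁿ z
  0<z = *-pos (z<s {3}) 0<P
  rect : V → B × A → Bool
  rect v (y , x) = p v x ∧ q v y
  link : V → B × A → Bool
  link v (y , x) = (p v x ∧ q v y) ∧ c v x y
  g : B × A → Bool
  g (y , x) = G x y
  YX = List.cartesianProduct Y X
  covers hits : B × A → ℕ
  covers w = ∑[ v ← S ] ⟦ g w ∧ rect v w ⟧
  hits w   = ∑[ v ← S ] ⟦ g w ∧ link v w ⟧
  inZ : B × A → Bool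
  -- The two summands on the left ask that the rectangles cover `w` at least |S| / 4P times, whence
  -- `z`, and that at most the fraction 2 / a of these covers are hits.
  inZ w = length S + 2 · (P · (a · hits w)) ℕ.≤ᵇ 4 · (P · covers w)
  |YX| : length YX ≡ length X · length Y
  |YX| = trans (length-product _,_ Y X) (ℕ.*-comm (length Y) (length X))
  0<S : 0 <ⁿ length S
  0<S = ℕ.<-≤-trans (*-pos (*-pos (z<s {1}) 0<z) (*-pos 0<n (*-pos (^-pos n 0<m) (^-pos n 0<u)))) S-large

  Z-dense : length X · length Y ≤ z · ∑[ y ← Y ] ∑[ x ← X ] ⟦ inZ (y , x) ⟧
  Z-dense = *-cancelʳ-≤-pos (length S) 0<S (begin
    length X · length Y · length S         ≡⟨ cong (_· length S) |YX| ⟨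
    length YX · length S
      ≤⟨ many-large YX (λ w → 4 · (P · covers w)) (λ w → 2 · (P · (a · hits w))) (4 · (P · length S)) (length S) covers≤ average ⟩
    4 · (P · length S) · length (filterᵇ inZ YX)
      ≡⟨ cong (4 · (P · length S) ·_) (trans (length-filterᵇ inZ YX) (∑-product _,_ Y X _)) ⟩
    4 · (P · length S) · ∑[ y ← Y ] ∑[ x ← X ] ⟦ inZ (y , x) ⟧ ≡⟨ regroup P (length S) _ ⟩
    z · (∑[ y ← Y ] ∑[ x ← X ] ⟦ inZ (y , x) ⟧) · length S ∎)
    where
    regroup : ∀ P s k → 4 · (P · s) · k ≡ 4 · P · k · s
    regroup = solve-∀
    covers≤ : ∀ w → 4 · (P · covers w) ≤ 4 · (P · length S)
    covers≤ w = ℕ.*-monoʳ-≤ 4 (ℕ.*-monoʳ-≤ P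
      (≤-trans (∑-≤-const S _ 1 (λ {v} _ → ⟦ g w ∧ rect v w ⟧≤1)) (≤-reflexive (ℕ.*-identityʳ _))))
    average : 2 · (length YX · length S) + ∑[ w ← YX ] (2 · (P · (a · hits w))) ≤ ∑[ w ← YX ] (4 · (P · covers w))
    average = begin
      2 · (length YX · length S) + ∑[ w ← YX ] (2 · (P · (a · hits w)))
        ≡⟨ cong₂ _+_ (flip (length YX) (length S)) (pull-hits YX) ⟩
      length S · (2 · length YX) + 2 · (P · (a · ∑[ v ← S ] ∑[ w ← YX ] ⟦ g w ∧ link v w ⟧))
        ≡⟨ cong₂ _+_ (∑-const S _) (push-hits YX) ⟨
      ∑[ v ← S ] (2 · length YX) + ∑[ v ← S ] (2 · (P · (a · ∑[ w ← YX ] ⟦ g w ∧ link v w ⟧)))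
        ≡⟨ ∑-+ S _ _ ⟨
      ∑[ v ← S ] (2 · length YX + 2 · (P · (a · ∑[ w ← YX ] ⟦ g w ∧ link v w ⟧)))
        ≤⟨ ∑-mono S at ⟩
      ∑[ v ← S ] (4 · (P · ∑[ w ← YX ] ⟦ g w ∧ rect v w ⟧))
        ≡⟨ ∑-*ˡ 4 S _ ⟩
      4 · ∑[ v ← S ] (P · ∑[ w ← YX ] ⟦ g w ∧ rect v w ⟧)
        ≡⟨ cong (4 ·_) (trans (∑-*ˡ P S _) (cong (P ·_) (∑-swap S YX _))) ⟩
      4 · (P · ∑[ w ← YX ] covers w)
        ≡⟨ cong (4 ·_) (∑-*ˡ P YX _) ⟨
      4 · ∑[ w ← YX ] (P · covers w)
        ≡⟨ ∑-*ˡ 4 YX _ ⟨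
      ∑[ w ← YX ] (4 · (P · covers w)) ∎
      where
      flip : ∀ k l → 2 · (k · l) ≡ l · (2 · k)
      flip = solve-∀
      pull-hits : ∀ W → ∑[ w ← W ] (2 · (P · (a · hits w))) ≡ 2 · (P · (a · ∑[ v ← S ] ∑[ w ← W ] ⟦ g w ∧ link v w ⟧))
      pull-hits W = trans (∑-*ˡ 2 W _) (cong (2 ·_) (trans (∑-*ˡ P W _) (cong (P ·_)
        (trans (∑-*ˡ a W _) (cong (a ·_) (sym (∑-swap S W _)))))))
      push-hits : ∀ W → ∑[ v ← S ] (2 · (P · (a · ∑[ w ← W ] ⟦ g w ∧ link v w ⟧))) ≡ 2 · (P · (a · ∑[ v ← S ] ∑[ w ← W ] ⟦ g w ∧ link v w ⟧))
      push-hits W = trans (∑-*ˡ 2 S _) (cong (2 ·_) (trans (∑-*ˡ P S _) (cong (P ·_) (∑-*ˡ a S _))))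
      at : ∀ {v} → v ∈ S → 2 · length YX + 2 · (P · (a · ∑[ w ← YX ] ⟦ g w ∧ link v w ⟧)) ≤ 4 · (P · ∑[ w ← YX ] ⟦ g w ∧ rect v w ⟧)
      at {v} v∈ = begin
        2 · length YX + 2 · (P · (a · ∑[ w ← YX ] ⟦ g w ∧ link v w ⟧))
          ≡⟨ cong₂ (λ k l → 2 · k + 2 · (P · (a · l))) |YX| (∑-product _,_ Y X _) ⟩
        2 · (length X · length Y) + 2 · (P · (a · ∑[ y ← Y ] ∑[ x ← X ] ⟦ g (y , x) ∧ link v (y , x) ⟧))
          ≡⟨ ℕ.*-distribˡ-+ 2 (length X · length Y) _ ⟨
        2 · (length X · length Y + P · (a · ∑[ y ← Y ] ∑[ x ← X ] ⟦ g (y , x) ∧ link v (y , x) ⟧))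
          ≤⟨ ℕ.*-monoʳ-≤ 2 (sparse v∈) ⟩
        2 · (2 · (P · ∑[ y ← Y ] ∑[ x ← X ] ⟦ g (y , x) ∧ rect v (y , x) ⟧))
          ≡⟨ four P _ ⟩
        4 · (P · ∑[ y ← Y ] ∑[ x ← X ] ⟦ g (y , x) ∧ rect v (y , x) ⟧)
          ≡⟨ cong (λ k → 4 · (P · k)) (∑-product _,_ Y X _) ⟨
        4 · (P · ∑[ w ← YX ] ⟦ g w ∧ rect v w ⟧) ∎
        where
        four : ∀ P k → 2 · (2 · (P · k)) ≡ 4 · (P · k)
        four = solve-∀

  -- The dual of the test for `inZ`, over the pairs of the biclique: the rectangle of `v` meets at
  -- least the fraction 1 / 2z of it, and at most the fraction 2 / a of these pairs lie in the link.
  -- This is the hypothesis of `sparse⇒grid`.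
  S′ : List A → List B → List V
  S′ T U = filterᵇ (λ v → m · u + z · (a · ∑[ w ← List.cartesianProduct U T ] ⟦ link v w ⟧) ℕ.≤ᵇ
                         2 · (z · ∑[ w ← List.cartesianProduct U T ] ⟦ rect v w ⟧)) S

  -- A pair outside `G` has no covers and so fails the test, `S` being nonempty. On the biclique `G`
  -- can thus be dropped from both counts.
  inZ⇒ : ∀ w → inZ w ≡ true →
         length S + 2 · (P · (a · ∑[ v ← S ] ⟦ link v w ⟧)) ≤ 4 · (P · ∑[ v ← S ] ⟦ rect v w ⟧)
  inZ⇒ w w∈Z with g w | ≤ᵇ-true (length S + 2 · (P · (a · hits w))) (4 · (P · covers w)) w∈Z
  ... | true  | le = le
  ... | false | le = contradiction (≤-trans (ℕ.m≤m+n (length S) _) (≤-trans le (≤-reflexive zeros))) (ℕ.<⇒≱ 0<S)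
    where
    zeros : 4 · (P · ∑[ _ ← S ] 0) ≡ 0
    zeros = trans (cong (λ k → 4 · (P · k)) (trans (∑-const S 0) (ℕ.*-zeroʳ (length S))))
                  (trans (cong (4 ·_) (ℕ.*-zeroʳ P)) refl)

  trace : ∀ T U → length T ≡ m → length U ≡ u → Unique T → Unique U →
          Biclique (λ x y → inZ (y , x)) T U →
          n · (m ^ n · u ^ n) ≤ length (S′ T U) ×
          (∀ {v} → v ∈ S′ T U → Grid (λ x y → not (c v x y)) n T U)
  trace T U |T| |U| uT uU bi = many , grid
    where
    W = List.cartesianProduct U T
    |W| : length W ≡ m · u
    |W| = trans (length-product _,_ U T) (trans (cong₂ _·_ |U| |T|) (ℕ.*-comm u m))
    W⊆Z : ∀ {w} → w ∈ W → inZ w ≡ true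
    W⊆Z w∈ = let y∈ , x∈ = Mem.∈-cartesianProduct⁻ U T w∈ in bi x∈ y∈
    0<mu : 0 <ⁿ m · u
    0<mu = *-pos 0<m 0<u
    rects links : V → ℕ
    rects v = ∑[ w ← W ] ⟦ rect v w ⟧
    links v = ∑[ w ← W ] ⟦ link v w ⟧
    rects≤ : ∀ v → 2 · (z · rects v) ≤ 2 · (z · (m · u))
    rects≤ v = ℕ.*-monoʳ-≤ 2 (ℕ.*-monoʳ-≤ z (≤-trans (∑-≤-const W _ 1 (λ {w} _ → ⟦ rect v w ⟧≤1))
      (≤-reflexive (trans (ℕ.*-identityʳ _) |W|))))
    average : 2 · (length S · (m · u)) + ∑[ v ← S ] (z · (a · links v)) ≤ ∑[ v ← S ] (2 · (z · rects v))
    average = begin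
      2 · (length S · (m · u)) + ∑[ v ← S ] (z · (a · links v))
        ≡⟨ cong₂ (λ k l → 2 · (length S · k) + l) (sym |W|)
             (trans (∑-*ˡ z S _) (cong (z ·_) (trans (∑-*ˡ a S _) (cong (a ·_) (∑-swap S W _))))) ⟩
      2 · (length S · length W) + z · (a · ∑[ w ← W ] ∑[ v ← S ] ⟦ link v w ⟧)
        ≡⟨ regroup P a (length S) (length W) _ ⟩
      2 · (length W · length S + 2 · (P · (a · ∑[ w ← W ] ∑[ v ← S ] ⟦ link v w ⟧)))
        ≡⟨ cong (2 ·_) (cong₂ _+_ (∑-const W (length S)) (trans (∑-*ˡ 2 W _) (cong (2 ·_) (trans (∑-*ˡ P W _) (cong (P ·_) (∑-*ˡ a W _)))))) ⟨
      2 · (∑[ w ← W ] length S + ∑[ w ← W ] (2 · (P · (a · ∑[ v ← S ] ⟦ link v w ⟧))))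
        ≡⟨ cong (2 ·_) (∑-+ W _ _) ⟨
      2 · ∑[ w ← W ] (length S + 2 · (P · (a · ∑[ v ← S ] ⟦ link v w ⟧)))
        ≤⟨ ℕ.*-monoʳ-≤ 2 (∑-mono W (λ {w} w∈ → inZ⇒ w (W⊆Z w∈))) ⟩
      2 · ∑[ w ← W ] (4 · (P · ∑[ v ← S ] ⟦ rect v w ⟧))
        ≡⟨ cong (2 ·_) (trans (∑-*ˡ 4 W _) (cong (4 ·_) (∑-*ˡ P W _))) ⟩
      2 · (4 · (P · ∑[ w ← W ] ∑[ v ← S ] ⟦ rect v w ⟧))
        ≡⟨ cong (2 ·_) (ℕ.*-assoc 4 P _) ⟨
      2 · (z · ∑[ w ← W ] ∑[ v ← S ] ⟦ rect v w ⟧)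
        ≡⟨ trans (∑-*ˡ 2 S _) (cong (2 ·_) (trans (∑-*ˡ z S _) (cong (z ·_) (∑-swap S W _)))) ⟨
      ∑[ v ← S ] (2 · (z · rects v)) ∎
      where
      regroup : ∀ P a s w l → 2 · (s · w) + 4 · P · (a · l) ≡ 2 · (w · s + 2 · (P · (a · l)))
      regroup = solve-∀
    many : n · (m ^ n · u ^ n) ≤ length (S′ T U)
    many = *-cancelˡ-≤-pos (2 · z) (*-pos (z<s {1}) 0<z) (≤-trans S-large
      (*-cancelʳ-≤-pos (m · u) 0<mu (≤-trans
        (many-large S (λ v → 2 · (z · rects v)) (λ v → z · (a · links v)) (2 · (z · (m · u))) (m · u) rects≤ average)
        (≤-reflexive (shuffle z (m · u) (length (S′ T U)))))))
      where
      shuffle : ∀ z k l → 2 · (z · k) · l ≡ 2 · z · l · k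
      shuffle = solve-∀
    grid : ∀ {v} → v ∈ S′ T U → Grid (λ x y → not (c v x y)) n T U
    grid {v} v∈ = restrict (sparse⇒grid (c v) n γ z e m u Tᵥ Uᵥ 0<n 0<γ 0<z 0<m 0<u
      (filterᵇ-unique (p v) uT) (filterᵇ-unique (q v) uU)
      (≤-trans (List.length-filter _ T) (≤-reflexive |T|)) (≤-trans (List.length-filter _ U) (≤-reflexive |U|))
      m-large u-large growth (begin
        m · u + z · (a · ∑[ y ← Uᵥ ] ∑[ x ← Tᵥ ] ⟦ c v x y ⟧)
          ≡⟨ cong (λ k → m · u + z · (a · k)) (trans (∑-product _,_ U T _) links≡) ⟨
        m · u + z · (a · links v)            ≤⟨ ≤ᵇ-true (m · u + z · (a · links v)) _ (proj₂ (∈-filterᵇ⁻ _ S v∈)) ⟩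
        2 · (z · rects v)                    ≡⟨ ℕ.*-assoc 2 z (rects v) ⟨
        2 · z · rects v                      ≡⟨ cong (2 · z ·_) (trans (∑-product _,_ U T _) rects≡) ⟩
        2 · z · (length Tᵥ · length Uᵥ)      ∎))
      where
      Tᵥ = filterᵇ (p v) T
      Uᵥ = filterᵇ (q v) U
      rects≡ : ∑[ y ← U ] ∑[ x ← T ] ⟦ p v x ∧ q v y ⟧ ≡ length Tᵥ · length Uᵥ
      rects≡ = begin-equality
        ∑[ y ← U ] ∑[ x ← T ] ⟦ p v x ∧ q v y ⟧      ≡⟨ ∑-cong U (λ y → trans (∑-cong T (λ x → ⟦∧⟧ (p v x) (q v y))) (∑-*ʳ ⟦ q v y ⟧ T _)) ⟩
        ∑[ y ← U ] (∑[ x ← T ] ⟦ p v x ⟧ · ⟦ q v y ⟧) ≡⟨ ∑-*ˡ (∑[ x ← T ] ⟦ p v x ⟧) U _ ⟩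
        ∑[ x ← T ] ⟦ p v x ⟧ · ∑[ y ← U ] ⟦ q v y ⟧  ≡⟨ cong₂ _·_ (length-filterᵇ (p v) T) (length-filterᵇ (q v) U) ⟨
        length Tᵥ · length Uᵥ                        ∎
      links≡ : ∑[ y ← U ] ∑[ x ← T ] ⟦ (p v x ∧ q v y) ∧ c v x y ⟧ ≡ ∑[ y ← Uᵥ ] ∑[ x ← Tᵥ ] ⟦ c v x y ⟧
      links≡ = sym (begin-equality
        ∑[ y ← Uᵥ ] ∑[ x ← Tᵥ ] ⟦ c v x y ⟧                         ≡⟨ ∑-filterᵇ (q v) U _ ⟩
        ∑[ y ← U ] (⟦ q v y ⟧ · ∑[ x ← Tᵥ ] ⟦ c v x y ⟧)            ≡⟨ ∑-cong U (λ y → cong (⟦ q v y ⟧ ·_) (∑-filterᵇ (p v) T _)) ⟩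
        ∑[ y ← U ] (⟦ q v y ⟧ · ∑[ x ← T ] (⟦ p v x ⟧ · ⟦ c v x y ⟧)) ≡⟨ ∑-cong U (λ y → sym (∑-*ˡ ⟦ q v y ⟧ T _)) ⟩
        ∑[ y ← U ] ∑[ x ← T ] (⟦ q v y ⟧ · (⟦ p v x ⟧ · ⟦ c v x y ⟧)) ≡⟨ ∑-cong U (λ y → ∑-cong T (λ x → indicator (p v x) (q v y) (c v x y))) ⟩
        ∑[ y ← U ] ∑[ x ← T ] ⟦ (p v x ∧ q v y) ∧ c v x y ⟧         ∎)
        where
        indicator : ∀ b₁ b₂ b₃ → ⟦ b₂ ⟧ · (⟦ b₁ ⟧ · ⟦ b₃ ⟧) ≡ ⟦ (b₁ ∧ b₂) ∧ b₃ ⟧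
        indicator true  true  true  = refl
        indicator true  true  false = refl
        indicator true  false _     = refl
        indicator false b₂    _     = ℕ.*-zeroʳ ⟦ b₂ ⟧
      restrict : Grid (λ x y → not (c v x y)) n Tᵥ Uᵥ → Grid (λ x y → not (c v x y)) n T U
      restrict (xs , ys , sizes , unique , (xs⊆ , ys⊆) , bi) =
        xs , ys , sizes , unique ,
        ((λ x∈ → proj₁ (∈-filterᵇ⁻ (p v) T (xs⊆ x∈))) , λ y∈ → proj₁ (∈-filterᵇ⁻ (q v) U (ys⊆ y∈))) , bi

-- Greedy embedding along the degeneracy order

same : ∀ {t} → Fin t → Fin t → Bool
same i j = does (i Fin.≟ j)

before : ∀ {t} → Fin t → ℕ → Bool
before i s = toℕ i ℕ.<ᵇ s

same-true : ∀ {t} {i j : Fin t} → same i j ≡ true → i ≡ j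
same-true {i = i} {j} eq with yes i≡j ← i Fin.≟ j = i≡j

same-refl : ∀ {t} (i : Fin t) → same i i ≡ true
same-refl i with i Fin.≟ i
... | yes _ = refl
... | no i≢i = contradiction refl i≢i

before-true : ∀ {t} {i : Fin t} {s} → before i s ≡ true → toℕ i <ⁿ s
before-true eq = ℕ.<ᵇ⇒< _ _ (subst T (sym eq) _)

<⇒before : ∀ {t} {i : Fin t} {s} → toℕ i <ⁿ s → before i s ≡ true
<⇒before {i = i} {s} i<s with before i s in eq
... | true  = refl
... | false = ⊥-elim (subst T eq (ℕ.<⇒<ᵇ i<s))

before-suc : ∀ {t} (i σ : Fin t) {s} q → toℕ σ ≡ s →
             ⟦ before i s ∧ q ⟧ + ⟦ same i σ ∧ q ⟧ ≤ ⟦ before i (suc s) ∧ q ⟧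
before-suc i σ {s} q refl with i Fin.≟ σ
... | no _ = ≤-trans (≤-reflexive (ℕ.+-identityʳ _)) (⟦⟧-mono (before i s ∧ q) (before i (suc s) ∧ q)
      (λ eq → let i<s , q≡ = ∧-true eq in true-∧ (<⇒before {i = i} (ℕ.m<n⇒m<1+n (before-true {i = i} i<s))) q≡))
... | yes refl with before i (toℕ i) in eq
...   | true  = contradiction (before-true {i = i} eq) (ℕ.<-irrefl refl)
...   | false rewrite <⇒before {i = i} (ℕ.n<1+n (toℕ i)) = ≤-refl

⟦⟧-zero : ∀ p → ⟦ p ⟧ ≡ 0 → p ≡ false
⟦⟧-zero false _ = refl

∑-pos⇒∃ : ∀ (xs : List A) f → 0 <ⁿ ∑ xs f → ∃[ x ] x ∈ xs × 0 <ⁿ f x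
∑-pos⇒∃ xs f pos = ∑-<⇒∃ xs (λ _ → 0) f
  (subst (_<ⁿ ∑ xs f) (sym (trans (∑-const xs 0) (ℕ.*-zeroʳ (length xs)))) pos)

∑-zero⇒ : ∀ (xs : List A) f {x} → x ∈ xs → ∑ xs f ≡ 0 → f x ≡ 0
∑-zero⇒ (x ∷ xs) f (here refl) eq = ℕ.m+n≡0⇒m≡0 (f x) eq
∑-zero⇒ (x ∷ xs) f (there x∈)  eq = ∑-zero⇒ xs f x∈ (ℕ.m+n≡0⇒n≡0 (f x) eq)

-- A condition in force only where a positive number of edges asks for it. Elsewhere no edge would
-- pay for the loss that it causes.
guard : ℕ → Bool → Bool
guard zero    _ = true
guard (suc _) b = b

module Embedding {N t : ℕ} {E : Set} (Es : List E) (p₁ p₂ p₃ : E → Fin t)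
  (I : Fin t → List (Fin N)) (c : Fin N → Fin N → Fin N → Bool) (a d B M : ℕ) where

  V = Fin N

  size : Fin t → Subset N → ℕ
  size j X = ∑[ x ← I j ] ⟦ lookup X x ⟧

  pairs : Fin t → Fin t → (V → V → Bool) → ℕ
  pairs j l R = ∑[ y ← I l ] ∑[ x ← I j ] ⟦ R x y ⟧

  -- A vertex is the middle of at most d edges, each of which may rule out one part in `b` of its
  -- interval. The factor `2 · d` limits the total to half of the guaranteed fraction a^(- d) of
  -- candidates.
  b : ℕ
  b = 2 · d · a ^ d

  forward : Fin t → ℕ
  forward k = ∑[ e ← Es ] ⟦ same (p₁ e) k ⟧

  Large : Fin t → Subset N → Set
  Large j X = length (I j) ≤ b · size j X

  -- The only form in which the absence of a red copy enters the embedding. `G` will be the link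
  -- graph just before `v` is placed, so it is common to all `v`, whereas the rectangle `X v`, `Y v`
  -- depends on `v`. The bound `B` serves every `κ ≤ d`.
  FewSparseLinks : Set
  FewSparseLinks = ∀ {e} → e ∈ Es → ∀ κ → κ ≤ d → (G : V → V → Bool) (X Y : V → Subset N) (S : List V) →
    Unique S → (∀ {v} → v ∈ S → v ∈ I (p₁ e)) →
    (∀ {v} → v ∈ S → Large (p₂ e) (X v) × Large (p₃ e) (Y v) ×
      size (p₂ e) (X v) · size (p₃ e) (Y v) ≤
        a ^ κ · pairs (p₂ e) (p₃ e) (λ x y → G x y ∧ (lookup (X v) x ∧ lookup (Y v) y)) ×
      a ^ suc κ · pairs (p₂ e) (p₃ e) (λ x y → G x y ∧ ((lookup (X v) x ∧ lookup (Y v) y) ∧ c v x y)) <ⁿ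
        size (p₂ e) (X v) · size (p₃ e) (Y v)) →
    length S ≤ B

  -- The exponents of 1 / a bounding the losses of a candidate set and of the
  -- density of a link graph once the vertices in positions < s are embedded.
  α : ℕ → Fin t → ℕ
  α s k = ∑[ e ← Es ] ⟦ before (p₂ e) s ∧ same (p₃ e) k ⟧

  κ : ℕ → Fin t → Fin t → ℕ
  κ s j l = ∑[ e ← Es ] ⟦ before (p₁ e) s ∧ (same (p₂ e) j ∧ same (p₃ e) l) ⟧

  record State (s : ℕ) : Set where
    field
      cand : Fin t → V → Bool
      link : Fin t → Fin t → V → V → Bool
      -- The map is total; its values at positions ≥ s are placeholders in the right intervals.
      φ    : Fin t → V
      cand-large : ∀ k → s ≤ toℕ k → length (I k) ≤ a ^ α s k · ∑[ x ← I k ] ⟦ cand k x ⟧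
      link-dense : ∀ j l → s ≤ toℕ j → toℕ j <ⁿ toℕ l → ∀ X Y → Large j X → Large l Y →
        size j X · size l Y ≤ a ^ κ s j l · pairs j l (λ x y → link j l x y ∧ (lookup X x ∧ lookup Y y))
      cand-blue : ∀ k x → s ≤ toℕ k → cand k x ≡ true → ∀ {e} → e ∈ Es → p₃ e ≡ k →
        toℕ (p₂ e) <ⁿ s → c (φ (p₁ e)) (φ (p₂ e)) x ≡ true
      link-blue : ∀ j l x y → s ≤ toℕ j → link j l x y ≡ true → ∀ {e} → e ∈ Es → p₂ e ≡ j → p₃ e ≡ l →
        toℕ (p₁ e) <ⁿ s → c (φ (p₁ e)) x y ≡ true
      φ-blue : ∀ {e} → e ∈ Es → toℕ (p₃ e) <ⁿ s → c (φ (p₁ e)) (φ (p₂ e)) (φ (p₃ e)) ≡ true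
      φ∈I : ∀ k → φ k ∈ I k

  module _ (0<a : 0 <ⁿ a) (0<d : 0 <ⁿ d) (0<M : 0 <ⁿ M) (M-large : 2 · a ^ d · B ≤ M)
    (p₁<p₂ : ∀ {e} → e ∈ Es → toℕ (p₁ e) <ⁿ toℕ (p₂ e))
    (p₂<p₃ : ∀ {e} → e ∈ Es → toℕ (p₂ e) <ⁿ toℕ (p₃ e))
    (deg₂ : ∀ k → ∑[ e ← Es ] ⟦ same (p₂ e) k ⟧ ≤ d)
    (deg₃ : ∀ k → ∑[ e ← Es ] ⟦ same (p₃ e) k ⟧ ≤ d)
    (|I| : ∀ k → length (I k) ≡ M · suc (forward k))
    (I-unique : ∀ k → Unique (I k))
    (few : FewSparseLinks) where

    open ≤-Reasoning

    I-pos : ∀ k → 0 <ⁿ length (I k)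
    I-pos k = subst (0 <ⁿ_) (sym (|I| k)) (*-pos 0<M z<s)

    a^-mono : ∀ {m n} → m ≤ n → a ^ m ≤ a ^ n
    a^-mono = ℕ.^-monoʳ-≤ a {{ℕ.>-nonZero 0<a}}

    α≤d : ∀ s k → α s k ≤ d
    α≤d s k = ≤-trans (∑-mono Es λ {e} _ → ⟦⟧-mono (before (p₂ e) s ∧ same (p₃ e) k) _ (proj₂ ∘ ∧-true)) (deg₃ k)

    κ≤d : ∀ s j l → κ s j l ≤ d
    κ≤d s j l = ≤-trans (∑-mono Es λ {e} _ →
      ⟦⟧-mono (before (p₁ e) s ∧ (same (p₂ e) j ∧ same (p₃ e) l)) _ (λ eq → proj₂ (∧-true {same (p₂ e) j} (proj₂ (∧-true {before (p₁ e) s} eq))))) (deg₃ l)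

    initial : State 0
    initial = record
      { cand = λ _ _ → true
      ; link = λ _ _ _ _ → true
      ; φ = λ k → proj₁ (first (I k) (I-pos k))
      ; cand-large = λ k _ → ≤-trans (≤-reflexive (trans (sym (ℕ.*-identityʳ _)) (sym (∑-const (I k) 1))))
          (ℕ.m≤n*m _ (a ^ α 0 k) {{ℕ.>-nonZero (^-pos (α 0 k) 0<a)}})
      ; link-dense = λ j l _ _ X Y _ _ → ≤-trans (≤-reflexive (sym (rectangle j l X Y)))
          (ℕ.m≤n*m _ (a ^ κ 0 j l) {{ℕ.>-nonZero (^-pos (κ 0 j l) 0<a)}})
      ; cand-blue = λ _ _ _ _ _ _ ()
      ; link-blue = λ _ _ _ _ _ _ _ _ _ ()
      ; φ-blue = λ _ ()
      ; φ∈I = λ k → proj₂ (first (I k) (I-pos k))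
      }
      where
      first : (xs : List V) → 0 <ⁿ length xs → ∃[ x ] x ∈ xs
      first (x ∷ xs) _ = x , here refl
      rectangle : ∀ j l X Y → pairs j l (λ x y → lookup X x ∧ lookup Y y) ≡ size j X · size l Y
      rectangle j l X Y = trans
        (∑-cong (I l) λ y → trans (∑-cong (I j) λ x → ⟦∧⟧ (lookup X x) (lookup Y y)) (∑-*ʳ ⟦ lookup Y y ⟧ (I j) _))
        (∑-*ˡ (size j X) (I l) _)

    module Step (s : ℕ) (σ : Fin t) (σ≡s : toℕ σ ≡ s) (st : State s) where
      open State st

      nbrs : Fin t → V → ℕ
      nbrs l w = ∑[ x ← I l ] ⟦ cand l x ∧ link σ l w x ⟧

      all-cand : Fin t → ℕ
      all-cand l = ∑[ x ← I l ] ⟦ cand l x ⟧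

      isolating : E → V → Bool
      isolating e w = not (all-cand (p₃ e) ℕ.≤ᵇ a ^ κ s σ (p₃ e) · nbrs (p₃ e) w)

      Sparse : E → V → Subset N → Subset N → Set
      Sparse e w X Y = Large (p₂ e) X × Large (p₃ e) Y ×
        a ^ suc (κ s (p₂ e) (p₃ e)) ·
          pairs (p₂ e) (p₃ e) (λ x y → link (p₂ e) (p₃ e) x y ∧ ((lookup X x ∧ lookup Y y) ∧ c w x y)) <ⁿ
        size (p₂ e) X · size (p₃ e) Y

      -- Rectangles have sides of type `Subset` so that this search over all of them is finite and
      -- badness is decidable.
      sparse? : ∀ e w → Dec (∃[ X ] ∃[ Y ] Sparse e w X Y)
      sparse? e w = Sub.anySubset? λ X → Sub.anySubset? λ Y →
        (_ ℕ.≤? _) ×-dec (_ ℕ.≤? _) ×-dec (_ ℕ.<? _)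

      -- Otherwise the isolating candidates and the candidates of the last vertex span a large
      -- rectangle whose rows are all thinner than a^(- κ), against `link-dense`. The summand `W`
      -- collects a deficit of 1 from each such row and makes the contradiction strict.
      isolating-few : ∀ {e} → e ∈ Es → p₂ e ≡ σ →
        b · ∑[ w ← I σ ] ⟦ cand σ w ∧ isolating e w ⟧ ≤ length (I σ)
      isolating-few {e} e∈ refl = ℕ.≮⇒≥ λ large → ℕ.<⇒≱ (ℕ.m<m+n (pairs-weight) (*-pos⁻ʳ b (ℕ.≤-<-trans z≤n large))) (begin
        pairs-weight + W                     ≡⟨ cong (_+ W) (trans (cong (a ^ κ s σ l ·_) (∑-swap (I l) (I σ) _)) (sym (∑-*ˡ (a ^ κ s σ l) (I σ) _))) ⟩
        ∑[ x ← I σ ] (a ^ κ s σ l · ∑[ y ← I l ] ⟦ joint x y ⟧) + W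
          ≡⟨ ∑-+ (I σ) _ _ ⟨
        ∑[ x ← I σ ] (a ^ κ s σ l · ∑[ y ← I l ] ⟦ joint x y ⟧ + ⟦ bad x ⟧)
          ≤⟨ ∑-mono (I σ) (λ {x} _ → pointwise x) ⟩
        ∑[ x ← I σ ] (⟦ bad x ⟧ · all-cand l) ≡⟨ ∑-*ʳ (all-cand l) (I σ) _ ⟩
        W · all-cand l                       ≡⟨ cong₂ _·_ size-X size-Y ⟨
        size σ X · size l Y                  ≤⟨ link-dense σ l (≤-reflexive (sym σ≡s)) (p₂<p₃ e∈) X Y
                                                  (≤-trans (ℕ.<⇒≤ large) (≤-reflexive (cong (b ·_) (sym size-X)))) large-Y ⟩
        pairs-weight ∎)
        where
        l = p₃ e
        bad : V → Bool
        bad w = cand σ w ∧ isolating e w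
        X = tabulate bad
        Y = tabulate (cand l)
        W = ∑[ w ← I σ ] ⟦ bad w ⟧
        joint : V → V → Bool
        joint x y = link σ l x y ∧ (lookup X x ∧ lookup Y y)
        pairs-weight = a ^ κ s σ l · pairs σ l joint
        size-X : size σ X ≡ W
        size-X = ∑-cong (I σ) (λ x → cong ⟦_⟧ (Vec.lookup∘tabulate bad x))
        size-Y : size l Y ≡ all-cand l
        size-Y = ∑-cong (I l) (λ y → cong ⟦_⟧ (Vec.lookup∘tabulate (cand l) y))
        large-Y : Large l Y
        large-Y = begin
          length (I l)                  ≤⟨ cand-large l (subst (_≤ toℕ l) σ≡s (ℕ.<⇒≤ (p₂<p₃ e∈))) ⟩
          a ^ α s l · all-cand l        ≤⟨ ℕ.*-mono-≤ (≤-trans (a^-mono (α≤d s l)) (ℕ.m≤n*m (a ^ d) (2 · d) {{ℕ.>-nonZero (*-pos (z<s {1}) 0<d)}})) (≤-reflexive (sym size-Y)) ⟩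
          b · size l Y                  ∎
        joint-true : ∀ x y → bad x ≡ true → joint x y ≡ cand l y ∧ link σ l x y
        joint-true x y bx = trans (cong₂ (λ p q → link σ l x y ∧ (p ∧ q)) (trans (Vec.lookup∘tabulate bad x) bx) (Vec.lookup∘tabulate (cand l) y))
          (Bool.∧-comm (link σ l x y) (cand l y))
        joint-false : ∀ x y → bad x ≡ false → joint x y ≡ false
        joint-false x y bx = trans (cong (λ p → link σ l x y ∧ (p ∧ lookup Y y)) (trans (Vec.lookup∘tabulate bad x) bx)) (Bool.∧-zeroʳ (link σ l x y))
        pointwise : ∀ x → a ^ κ s σ l · ∑[ y ← I l ] ⟦ joint x y ⟧ + ⟦ bad x ⟧ ≤ ⟦ bad x ⟧ · all-cand l
        pointwise x with bad x in bx
        ... | false = ≤-reflexive (trans (ℕ.+-identityʳ _) (trans (cong (a ^ κ s σ l ·_) (trans (∑-cong (I l) (λ y → cong ⟦_⟧ (joint-false x y bx)))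
                        (trans (∑-const (I l) 0) (ℕ.*-zeroʳ (length (I l)))))) (ℕ.*-zeroʳ (a ^ κ s σ l))))
        ... | true  = begin
          a ^ κ s σ l · ∑[ y ← I l ] ⟦ joint x y ⟧ + 1  ≡⟨ cong (λ k → a ^ κ s σ l · k + 1) (∑-cong (I l) (λ y → cong ⟦_⟧ (joint-true x y bx))) ⟩
          a ^ κ s σ l · nbrs l x + 1                    ≡⟨ ℕ.+-comm _ 1 ⟩
          suc (a ^ κ s σ l · nbrs l x)                  ≤⟨ ≤ᵇ-false (all-cand l) _ (not-true (proj₂ (∧-true {cand σ x} bx))) ⟩
          all-cand l                                    ≡⟨ ℕ.+-identityʳ _ ⟨
          all-cand l + 0                                ∎
          where
          not-true : ∀ {p} → not p ≡ true → p ≡ false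
          not-true {false} _ = refl

      sparse-few : ∀ {e} → e ∈ Es → p₁ e ≡ σ → ∑[ w ← I σ ] ⟦ does (sparse? e w) ⟧ ≤ B
      sparse-few {e} e∈ refl = subst (_≤ B) (length-filterᵇ _ (I σ))
        (few e∈ (κ s j l) (κ≤d s j l) (link j l) X Y (filterᵇ (λ w → does (sparse? e w)) (I σ)) (filterᵇ-unique _ (I-unique σ))
          (λ v∈ → proj₁ (∈-filterᵇ⁻ _ (I σ) v∈))
          (λ {v} v∈ → witness v (proj₂ (∈-filterᵇ⁻ _ (I σ) v∈))))
        where
        j = p₂ e
        l = p₃ e
        X Y : V → Subset N
        -- The witnesses of badness, with an empty default at vertices that are not bad.
        X w with sparse? e w
        ... | yes (X , _) = X
        ... | no  _       = Sub.⊥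
        Y w with sparse? e w
        ... | yes (_ , Y , _) = Y
        ... | no  _           = Sub.⊥
        witness : ∀ v → does (sparse? e v) ≡ true → Large j (X v) × Large l (Y v) ×
          size j (X v) · size l (Y v) ≤ a ^ κ s j l · pairs j l (λ x y → link j l x y ∧ (lookup (X v) x ∧ lookup (Y v) y)) ×
          a ^ suc (κ s j l) · pairs j l (λ x y → link j l x y ∧ ((lookup (X v) x ∧ lookup (Y v) y) ∧ c v x y)) <ⁿ
          size j (X v) · size l (Y v)
        witness v _ with yes (X , Y , large-X , large-Y , sparse) ← sparse? e v =
          large-X , large-Y ,
          link-dense j l (subst (_≤ toℕ j) σ≡s (ℕ.<⇒≤ (p₁<p₂ e∈))) (p₂<p₃ e∈) X Y large-X large-Y , sparse

      choice : ∃[ w ] w ∈ I σ × cand σ w ≡ true ×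
        (∀ {e} → e ∈ Es → p₂ e ≡ σ → all-cand (p₃ e) ≤ a ^ κ s σ (p₃ e) · nbrs (p₃ e) w) ×
        (∀ {e} → e ∈ Es → p₁ e ≡ σ → ¬ (∃[ X ] ∃[ Y ] Sparse e w X Y))
      -- An obstacle count below a 0-1 indicator is zero, and the indicator is then 1: one averaging
      -- yields a candidate free of all obstacles.
      choice = let w , w∈ , lt = ∑-<⇒∃ (I σ) obstacles (λ w → ⟦ cand σ w ⟧) few-obstacles in w , w∈ , good w lt
        where
        isolated sparsified obstacles : V → ℕ
        isolated w   = ∑[ e ← Es ] (⟦ same (p₂ e) σ ⟧ · ⟦ cand σ w ∧ isolating e w ⟧)
        sparsified w = ∑[ e ← Es ] (⟦ same (p₁ e) σ ⟧ · ⟦ does (sparse? e w) ⟧)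
        obstacles w  = isolated w + sparsified w
        guarded : ∀ p {m n} → (p ≡ true → m ≤ n) → ⟦ p ⟧ · m ≤ ⟦ p ⟧ · n
        guarded true  m≤n = ℕ.*-monoʳ-≤ 1 (m≤n refl)
        guarded false _   = z≤n
        isolated-few : b · ∑ (I σ) isolated ≤ d · length (I σ)
        isolated-few = begin
          b · ∑ (I σ) isolated
            ≡⟨ cong (b ·_) (∑-swap (I σ) Es _) ⟩
          b · ∑[ e ← Es ] ∑[ w ← I σ ] (⟦ same (p₂ e) σ ⟧ · ⟦ cand σ w ∧ isolating e w ⟧)
            ≡⟨ ∑-*ˡ b Es _ ⟨
          ∑[ e ← Es ] (b · ∑[ w ← I σ ] (⟦ same (p₂ e) σ ⟧ · ⟦ cand σ w ∧ isolating e w ⟧))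
            ≡⟨ ∑-cong Es (λ e → trans (cong (b ·_) (∑-*ˡ ⟦ same (p₂ e) σ ⟧ (I σ) _)) (exchange b ⟦ same (p₂ e) σ ⟧ _)) ⟩
          ∑[ e ← Es ] (⟦ same (p₂ e) σ ⟧ · (b · ∑[ w ← I σ ] ⟦ cand σ w ∧ isolating e w ⟧))
            ≤⟨ ∑-mono Es (λ {e} e∈ → guarded (same (p₂ e) σ) (λ eq → isolating-few e∈ (same-true eq))) ⟩
          ∑[ e ← Es ] (⟦ same (p₂ e) σ ⟧ · length (I σ))
            ≡⟨ ∑-*ʳ (length (I σ)) Es _ ⟩
          ∑[ e ← Es ] ⟦ same (p₂ e) σ ⟧ · length (I σ)
            ≤⟨ ℕ.*-monoˡ-≤ (length (I σ)) (deg₂ σ) ⟩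
          d · length (I σ) ∎
          where
          exchange : ∀ x y z → x · (y · z) ≡ y · (x · z)
          exchange = solve-∀
        sparsified-few : ∑ (I σ) sparsified ≤ forward σ · B
        sparsified-few = begin
          ∑ (I σ) sparsified
            ≡⟨ ∑-swap (I σ) Es _ ⟩
          ∑[ e ← Es ] ∑[ w ← I σ ] (⟦ same (p₁ e) σ ⟧ · ⟦ does (sparse? e w) ⟧)
            ≡⟨ ∑-cong Es (λ e → ∑-*ˡ ⟦ same (p₁ e) σ ⟧ (I σ) _) ⟩
          ∑[ e ← Es ] (⟦ same (p₁ e) σ ⟧ · ∑[ w ← I σ ] ⟦ does (sparse? e w) ⟧)
            ≤⟨ ∑-mono Es (λ {e} e∈ → guarded (same (p₁ e) σ) (λ eq → sparse-few e∈ (same-true eq))) ⟩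
          ∑[ e ← Es ] (⟦ same (p₁ e) σ ⟧ · B)
            ≡⟨ ∑-*ʳ B Es _ ⟩
          forward σ · B ∎
        -- Scaled by 2a^d, the isolating vertices cost at most |I| and the bad ones at most
        -- `forward σ · M`. The latter is strictly below |I| = M (1 + forward σ), while the
        -- candidates weigh at least 2|I|.
        few-obstacles : ∑ (I σ) obstacles <ⁿ all-cand σ
        few-obstacles = ℕ.*-cancelˡ-< (2 · a ^ d) _ _ (begin-strict
          2 · a ^ d · ∑ (I σ) obstacles
            ≡⟨ trans (cong (2 · a ^ d ·_) (∑-+ (I σ) isolated sparsified)) (ℕ.*-distribˡ-+ (2 · a ^ d) (∑ (I σ) isolated) _) ⟩
          2 · a ^ d · ∑ (I σ) isolated + 2 · a ^ d · ∑ (I σ) sparsified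
            ≤⟨ ℕ.+-mono-≤ (*-cancelˡ-≤-pos d 0<d (≤-trans (≤-reflexive (regroup d (a ^ d) (∑ (I σ) isolated))) isolated-few))
                          (ℕ.*-monoʳ-≤ (2 · a ^ d) sparsified-few) ⟩
          length (I σ) + 2 · a ^ d · (forward σ · B)
            ≡⟨ cong (length (I σ) ℕ.+_) (exchange (2 · a ^ d) (forward σ) B) ⟩
          length (I σ) + forward σ · (2 · a ^ d · B)
            ≤⟨ ℕ.+-monoʳ-≤ (length (I σ)) (ℕ.*-monoʳ-≤ (forward σ) M-large) ⟩
          length (I σ) + forward σ · M
            <⟨ ℕ.+-monoʳ-< (length (I σ)) (ℕ.m<n+m (forward σ · M) 0<M) ⟩
          length (I σ) + suc (forward σ) · M
            ≡⟨ cong (length (I σ) ℕ.+_) (trans (ℕ.*-comm (suc (forward σ)) M) (sym (|I| σ))) ⟩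
          length (I σ) + length (I σ)
            ≡⟨ cong (length (I σ) ℕ.+_) (ℕ.+-identityʳ _) ⟨
          2 · length (I σ)
            ≤⟨ ℕ.*-monoʳ-≤ 2 (≤-trans (cand-large σ (≤-reflexive (sym σ≡s))) (ℕ.*-monoˡ-≤ (all-cand σ) (a^-mono (α≤d s σ)))) ⟩
          2 · (a ^ d · all-cand σ)
            ≡⟨ ℕ.*-assoc 2 (a ^ d) _ ⟨
          2 · a ^ d · all-cand σ ∎)
          where
          regroup : ∀ d k x → d · (2 · k · x) ≡ 2 · d · k · x
          regroup = solve-∀
          exchange : ∀ x y z → x · (y · z) ≡ y · (x · z)
          exchange = solve-∀
        good : ∀ w → obstacles w <ⁿ ⟦ cand σ w ⟧ → cand σ w ≡ true ×
          (∀ {e} → e ∈ Es → p₂ e ≡ σ → all-cand (p₃ e) ≤ a ^ κ s σ (p₃ e) · nbrs (p₃ e) w) ×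
          (∀ {e} → e ∈ Es → p₁ e ≡ σ → ¬ (∃[ X ] ∃[ Y ] Sparse e w X Y))
        good w lt with cand σ w in cw
        ... | true = refl ,
          (λ { {e} e∈ refl → ≤ᵇ-true (all-cand (p₃ e)) _ (not-false (⟦⟧-zero _ (absent (p₂ e) (∑-zero⇒ Es _ e∈ (ℕ.m+n≡0⇒m≡0 _ none))))) }) ,
          (λ { {e} e∈ refl witness → no-witness (sparse? e w) witness (⟦⟧-zero _ (absent (p₁ e) (∑-zero⇒ Es _ e∈ (ℕ.m+n≡0⇒n≡0 _ none)))) })
          where
          none = ℕ.n<1⇒n≡0 lt
          absent : ∀ i {n} → ⟦ same i i ⟧ · n ≡ 0 → n ≡ 0
          absent i {n} eq = trans (sym (ℕ.+-identityʳ n)) (subst (λ p → ⟦ p ⟧ · n ≡ 0) (same-refl i) eq)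
          not-false : ∀ {p} → not p ≡ false → p ≡ true
          not-false {true} _ = refl
          no-witness : ∀ {P : Set} (P? : Dec P) → P → ¬ (does P? ≡ false)
          no-witness (no ¬p) p _ = ¬p p

      module Next (w : V) (w∈I : w ∈ I σ) (w-cand : cand σ w ≡ true)
        (w-nbrs : ∀ {e} → e ∈ Es → p₂ e ≡ σ → all-cand (p₃ e) ≤ a ^ κ s σ (p₃ e) · nbrs (p₃ e) w)
        (w-dense : ∀ {e} → e ∈ Es → p₁ e ≡ σ → ¬ (∃[ X ] ∃[ Y ] Sparse e w X Y)) where

        μ : Fin t → ℕ
        μ l = ∑[ e ← Es ] ⟦ same (p₂ e) σ ∧ same (p₃ e) l ⟧

        ν : Fin t → Fin t → ℕ
        ν j l = ∑[ e ← Es ] ⟦ same (p₁ e) σ ∧ (same (p₂ e) j ∧ same (p₃ e) l) ⟧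

        cand′ : Fin t → V → Bool
        cand′ l x = cand l x ∧ guard (μ l) (link σ l w x)

        link′ : Fin t → Fin t → V → V → Bool
        link′ j l x y = link j l x y ∧ guard (ν j l) (c w x y)

        φ′ : Fin t → V
        φ′ k = if same k σ then w else φ k

        φ′-new : ∀ {k} → k ≡ σ → φ′ k ≡ w
        φ′-new {k} refl rewrite same-refl k = refl

        φ′-old : ∀ {k} → toℕ k <ⁿ s → φ′ k ≡ φ k
        φ′-old {k} k<s with k Fin.≟ σ
        ... | yes refl = contradiction k<s (ℕ.<-irrefl σ≡s)
        ... | no _     = refl

        earlier-or-σ : ∀ {k} → toℕ k <ⁿ suc s → toℕ k <ⁿ s ⊎ k ≡ σ
        earlier-or-σ {k} k<1+s with ℕ.m<1+n⇒m<n∨m≡n k<1+s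
        ... | inj₁ k<s = inj₁ k<s
        ... | inj₂ k≡s = inj₂ (Fin.toℕ-injective (trans k≡s (sym σ≡s)))

        α-step : ∀ k → α s k + μ k ≤ α (suc s) k
        α-step k = ≤-trans (≤-reflexive (sym (∑-+ Es _ _)))
          (∑-mono Es λ {e} _ → before-suc (p₂ e) σ (same (p₃ e) k) σ≡s)

        κ-step : ∀ j l → κ s j l + ν j l ≤ κ (suc s) j l
        κ-step j l = ≤-trans (≤-reflexive (sym (∑-+ Es _ _)))
          (∑-mono Es λ {e} _ → before-suc (p₁ e) σ (same (p₂ e) j ∧ same (p₃ e) l) σ≡s)

        -- The key accounting: passing to the neighbourhood of `w` costs a^κ, one factor for each
        -- link already intersected between σ and l. The edges behind these links have middle σ and
        -- last l, and they are counted in `α` only from now on, so no edge is charged to it twice.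
        κ≤μ : ∀ l → κ s σ l ≤ μ l
        κ≤μ l = ∑-mono Es λ {e} _ →
          ⟦⟧-mono (before (p₁ e) s ∧ (same (p₂ e) σ ∧ same (p₃ e) l)) _ (λ eq → proj₂ (∧-true {before (p₁ e) s} eq))

        edge-of-μ : ∀ l → 0 <ⁿ μ l → ∃[ e ] e ∈ Es × p₂ e ≡ σ × p₃ e ≡ l
        edge-of-μ l pos with e , e∈ , 0<⟦⟧ ← ∑-pos⇒∃ Es _ pos with same (p₂ e) σ in eq₂ | same (p₃ e) l in eq₃
        ... | true | true = e , e∈ , same-true eq₂ , same-true eq₃
        ... | true | false = contradiction 0<⟦⟧ λ ()
        ... | false | _ = contradiction 0<⟦⟧ λ ()

        edge-of-ν : ∀ j l → 0 <ⁿ ν j l → ∃[ e ] e ∈ Es × p₁ e ≡ σ × p₂ e ≡ j × p₃ e ≡ l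
        edge-of-ν j l pos with e , e∈ , 0<⟦⟧ ← ∑-pos⇒∃ Es _ pos
          with same (p₁ e) σ in eq₁ | same (p₂ e) j in eq₂ | same (p₃ e) l in eq₃
        ... | true | true | true = e , e∈ , same-true eq₁ , same-true eq₂ , same-true eq₃
        ... | true | true | false = contradiction 0<⟦⟧ λ ()
        ... | true | false | _ = contradiction 0<⟦⟧ λ ()
        ... | false | _ | _ = contradiction 0<⟦⟧ λ ()

        unguard : ∀ (f : E → Bool) {e b} → e ∈ Es → f e ≡ true → guard (∑[ e ← Es ] ⟦ f e ⟧) b ≡ true → b ≡ true
        unguard f {e} e∈ fe g with ∑ Es (λ e → ⟦ f e ⟧) in eq
        ... | suc _ = g
        ... | zero  = contradiction (trans (cong ⟦_⟧ (sym fe)) (∑-zero⇒ Es (λ e → ⟦ f e ⟧) e∈ eq)) λ ()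

        cand-large′ : ∀ k → suc s ≤ toℕ k → length (I k) ≤ a ^ α (suc s) k · ∑[ x ← I k ] ⟦ cand′ k x ⟧
        cand-large′ k s<k = ≤-trans (cand-large k (ℕ.<⇒≤ s<k)) (by-cases (μ k) refl)
          where
          by-cases : ∀ m → μ k ≡ m → a ^ α s k · all-cand k ≤ a ^ α (suc s) k · ∑[ x ← I k ] ⟦ cand k x ∧ guard (μ k) (link σ k w x) ⟧
          by-cases zero μ≡ = ℕ.*-mono-≤ (a^-mono (≤-trans (ℕ.m≤m+n _ (μ k)) (α-step k)))
            (≤-reflexive (∑-cong (I k) λ x → cong ⟦_⟧ (sym (trans (cong (λ m → cand k x ∧ guard m (link σ k w x)) μ≡) (Bool.∧-identityʳ _)))))
          by-cases (suc m) μ≡ with e , e∈ , p₂≡σ , refl ← edge-of-μ k (subst (0 <ⁿ_) (sym μ≡) z<s) = begin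
            a ^ α s k · all-cand k                          ≤⟨ ℕ.*-monoʳ-≤ (a ^ α s k) (w-nbrs e∈ p₂≡σ) ⟩
            a ^ α s k · (a ^ κ s σ k · nbrs k w)            ≡⟨ ℕ.*-assoc (a ^ α s k) _ _ ⟨
            a ^ α s k · a ^ κ s σ k · nbrs k w              ≡⟨ cong (_· nbrs k w) (ℕ.^-distribˡ-+-* a (α s k) (κ s σ k)) ⟨
            a ^ (α s k + κ s σ k) · nbrs k w                ≤⟨ ℕ.*-monoˡ-≤ (nbrs k w) (a^-mono (≤-trans (ℕ.+-monoʳ-≤ (α s k) (κ≤μ k)) (α-step k))) ⟩
            a ^ α (suc s) k · nbrs k w
              ≡⟨ cong (a ^ α (suc s) k ·_) (∑-cong (I k) λ x → cong (λ m → ⟦ cand k x ∧ guard m (link σ k w x) ⟧) (sym μ≡)) ⟩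
            a ^ α (suc s) k · ∑[ x ← I k ] ⟦ cand k x ∧ guard (μ k) (link σ k w x) ⟧ ∎

        link-dense′ : ∀ j l → suc s ≤ toℕ j → toℕ j <ⁿ toℕ l → ∀ X Y → Large j X → Large l Y →
          size j X · size l Y ≤ a ^ κ (suc s) j l · pairs j l (λ x y → link′ j l x y ∧ (lookup X x ∧ lookup Y y))
        link-dense′ j l s<j j<l X Y large-X large-Y = by-cases (ν j l) refl
          where
          rect : V → V → Bool
          rect x y = lookup X x ∧ lookup Y y
          pairs-cong : ∀ {R R′ : V → V → Bool} → (∀ x y → R x y ≡ R′ x y) → pairs j l R ≡ pairs j l R′
          pairs-cong R≗R′ = ∑-cong (I l) λ y → ∑-cong (I j) λ x → cong ⟦_⟧ (R≗R′ x y)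
          move : ∀ p q r → p ∧ (q ∧ r) ≡ (p ∧ r) ∧ q
          move false _ _ = refl
          move true  q r = Bool.∧-comm q r
          by-cases : ∀ m → ν j l ≡ m → size j X · size l Y ≤
            a ^ κ (suc s) j l · pairs j l (λ x y → (link j l x y ∧ guard (ν j l) (c w x y)) ∧ rect x y)
          by-cases zero ν≡ = begin
            size j X · size l Y           ≤⟨ link-dense j l (ℕ.<⇒≤ s<j) j<l X Y large-X large-Y ⟩
            a ^ κ s j l · pairs j l (λ x y → link j l x y ∧ rect x y)
              ≤⟨ ℕ.*-mono-≤ (a^-mono (≤-trans (ℕ.m≤m+n _ (ν j l)) (κ-step j l)))
                   (≤-reflexive (pairs-cong λ x y → cong (_∧ rect x y)
                     (sym (trans (cong (λ m → link j l x y ∧ guard m (c w x y)) ν≡) (Bool.∧-identityʳ _))))) ⟩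
            a ^ κ (suc s) j l · pairs j l (λ x y → (link j l x y ∧ guard (ν j l) (c w x y)) ∧ rect x y) ∎
          by-cases (suc m) ν≡ with e , e∈ , p₁≡σ , refl , refl ← edge-of-ν j l (subst (0 <ⁿ_) (sym ν≡) z<s) = begin
            size j X · size l Y
              ≤⟨ ℕ.≮⇒≥ (λ sparse → w-dense e∈ p₁≡σ (X , Y , large-X , large-Y , sparse)) ⟩
            a ^ suc (κ s j l) · pairs j l (λ x y → link j l x y ∧ (rect x y ∧ c w x y))
              -- All edges counted by `ν j l` impose the same condition `c w`, so a single factor of
              -- `a` suffices.
              ≤⟨ ℕ.*-mono-≤ (a^-mono (≤-trans (subst (λ m → suc (κ s j l) ≤ κ s j l + m) (sym ν≡) (ℕ.m<m+n (κ s j l) z<s)) (κ-step j l)))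
                   (≤-reflexive (pairs-cong λ x y → trans (move (link j l x y) (rect x y) (c w x y))
                     (cong (λ m → (link j l x y ∧ guard m (c w x y)) ∧ rect x y) (sym ν≡)))) ⟩
            a ^ κ (suc s) j l · pairs j l (λ x y → (link j l x y ∧ guard (ν j l) (c w x y)) ∧ rect x y) ∎

        next : State (suc s)
        next = record
          { cand = cand′
          ; link = link′
          ; φ = φ′
          ; cand-large = cand-large′
          ; link-dense = link-dense′
          ; cand-blue = cand-blue′
          ; link-blue = link-blue′
          ; φ-blue = φ-blue′
          ; φ∈I = φ′∈I
          }
          where
          c-cong : ∀ {x x′ y y′ z z′} → x ≡ x′ → y ≡ y′ → z ≡ z′ → c x′ y′ z′ ≡ true → c x y z ≡ true
          c-cong refl refl refl eq = eq
          cand-blue′ : ∀ k x → suc s ≤ toℕ k → cand′ k x ≡ true → ∀ {e} → e ∈ Es → p₃ e ≡ k →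
            toℕ (p₂ e) <ⁿ suc s → c (φ′ (p₁ e)) (φ′ (p₂ e)) x ≡ true
          cand-blue′ k x s<k ck {e} e∈ p₃≡k p₂<1+s with earlier-or-σ p₂<1+s
          ... | inj₁ p₂<s = c-cong (φ′-old (ℕ.<-trans (p₁<p₂ e∈) p₂<s)) (φ′-old p₂<s) refl
            (cand-blue k x (ℕ.<⇒≤ s<k) (proj₁ (∧-true ck)) e∈ p₃≡k p₂<s)
          -- The first vertex is already placed, so adjacency to `w` in the link graph is blueness
          -- of the triple: `link-blue` turns into `cand-blue`.
          ... | inj₂ p₂≡σ = c-cong (φ′-old p₁<s) (φ′-new p₂≡σ) refl
            (link-blue σ k w x (≤-reflexive (sym σ≡s))
              (unguard (λ e → same (p₂ e) σ ∧ same (p₃ e) k) e∈ (true-∧ (is p₂≡σ) (is p₃≡k)) (proj₂ (∧-true {cand k x} ck)))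
              e∈ p₂≡σ p₃≡k p₁<s)
            where
            p₁<s = ℕ.<-≤-trans (p₁<p₂ e∈) (≤-reflexive (trans (cong toℕ p₂≡σ) σ≡s))
            is : ∀ {i j : Fin t} → i ≡ j → same i j ≡ true
            is {i} refl = same-refl i
          link-blue′ : ∀ j l x y → suc s ≤ toℕ j → link′ j l x y ≡ true → ∀ {e} → e ∈ Es → p₂ e ≡ j → p₃ e ≡ l →
            toℕ (p₁ e) <ⁿ suc s → c (φ′ (p₁ e)) x y ≡ true
          link-blue′ j l x y s<j lk {e} e∈ p₂≡j p₃≡l p₁<1+s with earlier-or-σ p₁<1+s
          ... | inj₁ p₁<s = c-cong (φ′-old p₁<s) refl refl
            (link-blue j l x y (ℕ.<⇒≤ s<j) (proj₁ (∧-true lk)) e∈ p₂≡j p₃≡l p₁<s)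
          ... | inj₂ p₁≡σ = c-cong (φ′-new p₁≡σ) refl refl
            (unguard (λ e → same (p₁ e) σ ∧ (same (p₂ e) j ∧ same (p₃ e) l)) e∈
              (true-∧ (is p₁≡σ) (true-∧ (is p₂≡j) (is p₃≡l))) (proj₂ (∧-true {link j l x y} lk)))
            where
            is : ∀ {i j : Fin t} → i ≡ j → same i j ≡ true
            is {i} refl = same-refl i
          φ-blue′ : ∀ {e} → e ∈ Es → toℕ (p₃ e) <ⁿ suc s → c (φ′ (p₁ e)) (φ′ (p₂ e)) (φ′ (p₃ e)) ≡ true
          φ-blue′ {e} e∈ p₃<1+s with earlier-or-σ p₃<1+s
          ... | inj₁ p₃<s = c-cong (φ′-old (ℕ.<-trans (p₁<p₂ e∈) (ℕ.<-trans (p₂<p₃ e∈) p₃<s)))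
            (φ′-old (ℕ.<-trans (p₂<p₃ e∈) p₃<s)) (φ′-old p₃<s) (φ-blue e∈ p₃<s)
          ... | inj₂ p₃≡σ = c-cong (φ′-old (ℕ.<-trans (p₁<p₂ e∈) p₂<s)) (φ′-old p₂<s) (φ′-new p₃≡σ)
            (cand-blue σ w (≤-reflexive (sym σ≡s)) w-cand e∈ p₃≡σ p₂<s)
            where
            p₂<s = ℕ.<-≤-trans (p₂<p₃ e∈) (≤-reflexive (trans (cong toℕ p₃≡σ) σ≡s))
          φ′∈I : ∀ k → φ′ k ∈ I k
          φ′∈I k with k Fin.≟ σ
          ... | yes refl = w∈I
          ... | no _     = φ∈I k

      next : State (suc s)
      next = let w , w∈I , w-cand , w-nbrs , w-dense = choice in Next.next w w∈I w-cand w-nbrs w-dense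

    states : ∀ s → s ≤ t → State s
    states zero    _   = initial
    states (suc s) s<t = Step.next s (Fin.fromℕ< s<t) (Fin.toℕ-fromℕ< s<t) (states s (ℕ.<⇒≤ s<t))

    embedding : ∃[ φ ] (∀ k → φ k ∈ I k) × (∀ {e} → e ∈ Es → c (φ (p₁ e)) (φ (p₂ e)) (φ (p₃ e)) ≡ true)
    embedding = let open State (states t ≤-refl) in φ , φ∈I , λ {e} e∈ → φ-blue e∈ (Fin.toℕ<n (p₃ e))

-- Deciding the arrow relation

module _ {t N : ℕ} (φ : Fin t → Fin N) where

  ∈-image⁺ : ∀ {e u} → u Sub.∈ e → φ u Sub.∈ image φ e
  ∈-image⁺ {e} {u} u∈e = Vec.lookup⇒[]= (φ u) _ (trans (Vec.lookup∘tabulate _ (φ u)) (dec-true (Fin.any? _) (u , u∈e , refl)))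

  ∈-image⁻ : ∀ {e v} → v Sub.∈ image φ e → ∃[ u ] u Sub.∈ e × φ u ≡ v
  ∈-image⁻ {e} {v} v∈ with Fin.any? (λ u → (u Sub.∈? e) ×-dec (φ u Fin.≟ v)) | trans (sym (Vec.lookup∘tabulate (λ v → does (Fin.any? λ u → (u Sub.∈? e) ×-dec (φ u Fin.≟ v))) v)) (Vec.[]=⇒lookup v∈)
  ... | yes found | _ = found
  ... | no _      | ()

image-cong : ∀ {t N} {φ ψ : Fin t → Fin N} → (∀ u → φ u ≡ ψ u) → ∀ e → image φ e ≡ image ψ e
image-cong {φ = φ} {ψ} φ≗ψ e = Sub.⊆-antisym (sub φ ψ φ≗ψ) (sub ψ φ (sym ∘ φ≗ψ))
  where
  sub : ∀ φ ψ → (∀ u → φ u ≡ ψ u) → image φ e Sub.⊆ image ψ e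
  sub φ ψ φ≗ψ v∈ with u , u∈e , refl ← ∈-image⁻ φ {e} v∈ = subst (Sub._∈ image ψ e) (sym (φ≗ψ u)) (∈-image⁺ ψ u∈e)

Contains-mono : ∀ {k N t} (G G′ : OrderedGraph k N) (H : OrderedGraph k t) →
                (∀ e → Edge G e → Edge G′ e) → Contains G H → Contains G′ H
Contains-mono G G′ H G⊆G′ (φ , inj , mono , copy) = φ , inj , mono , λ e e∈ → G⊆G′ _ (copy e e∈)

-- Maps are coded as numbers by `finToFun`. The condition on all edges is tested by searching for a
-- violating subset and is recovered by stability of the decidable `Edge G`.
contains? : ∀ {k N t} (G : OrderedGraph k N) (H : OrderedGraph k t) → Dec (Contains G H)
contains? {N = N} {t} G H = map′ (λ (i , copy) → Fin.finToFun i , copy) encode (Fin.any? λ i → copy? (Fin.finToFun i))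
  where
  IsCopy : (Fin t → Fin N) → Set
  IsCopy φ = (∀ {x y} → φ x ≡ φ y → x ≡ y) × (∀ {x y} → x Fin.≤ y → φ x Fin.≤ φ y) ×
             (∀ e → Edge H e → Edge G (image φ e))
  copy? : ∀ φ → Dec (IsCopy φ)
  copy? φ =
    map′ (λ inj {x} {y} → inj x y) (λ inj x y → inj) (Fin.all? λ x → Fin.all? λ y → (φ x Fin.≟ φ y) →-dec (x Fin.≟ y)) ×-dec
    map′ (λ mono {x} {y} → mono x y) (λ mono x y → mono) (Fin.all? λ x → Fin.all? λ y → (x Fin.≤? y) →-dec (φ x Fin.≤? φ y)) ×-dec
    map′ (λ none e e∈ → decidable-stable (edge? G (image φ e)) λ ¬e∈ → none (e , e∈ , ¬e∈))
         (λ copy (e , e∈ , ¬e∈) → ¬e∈ (copy e e∈))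
         (¬? (Sub.anySubset? λ e → edge? H e ×-dec ¬? (edge? G (image φ e))))
  encode : Contains G H → ∃[ i ] IsCopy (Fin.finToFun {N} {t} i)
  encode (φ , inj , mono , copy) = Fin.funToFin φ ,
    (λ {x} {y} eq → inj (trans (sym (same-φ x)) (trans eq (same-φ y)))) ,
    (λ {x} {y} x≤y → subst₂ Fin._≤_ (sym (same-φ x)) (sym (same-φ y)) (mono x≤y)) ,
    λ e e∈ → subst (Edge G) (image-cong (λ u → sym (same-φ u)) e) (copy e e∈)
    where
    same-φ : ∀ u → Fin.finToFun (Fin.funToFin φ) u ≡ φ u
    same-φ = Fin.finToFun-funToFin φ

-- Splitting on the first vertex turns a function on subsets of `suc N` into two on subsets of `N`.
-- Functions rebuilt this way agree only pointwise with the original, hence the condition that `P`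
-- respect pointwise equality.
anyColouring? : ∀ N (P : (Subset N → Colour) → Set) → (∀ {f g} → (∀ e → f e ≡ g e) → P f → P g) →
                (∀ f → Dec (P f)) → Dec (∃ P)
anyColouring? zero P resp P? = map′
  (λ { (inj₁ p) → _ , p ; (inj₂ p) → _ , p })
  (λ (f , p) → by-value f p (f Vec.[]) refl)
  (P? (λ _ → red) ⊎-dec P? (λ _ → blue))
  where
  by-value : ∀ f → P f → ∀ col → f Vec.[] ≡ col → P (λ _ → red) ⊎ P (λ _ → blue)
  by-value f p red  eq = inj₁ (resp (λ { Vec.[] → eq }) p)
  by-value f p blue eq = inj₂ (resp (λ { Vec.[] → eq }) p)
anyColouring? (suc N) P resp P? = map′
  (λ (f , g , p) → join f g , p)
  (λ (h , p) → h ∘ (inside Vec.∷_) , h ∘ (outside Vec.∷_) , resp (λ { (true Vec.∷ _) → refl ; (false Vec.∷ _) → refl }) p)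
  (anyColouring? N (λ f → ∃[ g ] P (join f g))
    (λ f≗ (g , p) → g , resp (λ { (true Vec.∷ e) → f≗ e ; (false Vec.∷ _) → refl }) p)
    λ f → anyColouring? N (λ g → P (join f g))
      (λ g≗ → resp (λ { (true Vec.∷ _) → refl ; (false Vec.∷ e) → g≗ e }))
      λ g → P? (join f g))
  where
  join : (f g : Subset N → Colour) → Subset (suc N) → Colour
  join f g (true  Vec.∷ e) = f e
  join f g (false Vec.∷ e) = g e

arrows? : ∀ {k s t} (G : OrderedGraph k s) (H : OrderedGraph k t) N → Dec (Arrows N G H)
arrows? {k} G H N = map′ to from (¬? (anyColouring? N (λ f → ¬ Good f) (λ f≗g ¬good good → ¬good (good-resp (sym ∘ f≗g) good)) λ f → ¬? (good? f)))
  where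
  class-of : (Subset N → Colour) → Colour → OrderedGraph k N
  class-of f = colourClass λ e _ → f e
  Good : (Subset N → Colour) → Set
  Good f = Contains (class-of f blue) G ⊎ Contains (class-of f red) H
  good? : ∀ f → Dec (Good f)
  good? f = contains? (class-of f blue) G ⊎-dec contains? (class-of f red) H
  good-resp : ∀ {f g} → (∀ e → f e ≡ g e) → Good f → Good g
  good-resp {f} {g} f≗g (inj₁ copy) = inj₁ (Contains-mono (class-of f blue) (class-of g blue) G (λ e (p , eq) → p , trans (sym (f≗g e)) eq) copy)
  good-resp {f} {g} f≗g (inj₂ copy) = inj₂ (Contains-mono (class-of f red) (class-of g red) H (λ e (p , eq) → p , trans (sym (f≗g e)) eq) copy)
  from : Arrows N G H → ¬ (∃[ f ] ¬ Good f)
  from arrows (f , ¬good) = ¬good (arrows (λ e _ → f e))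
  to : ¬ (∃[ f ] ¬ Good f) → Arrows N G H
  to none χ = restore (decidable-stable (good? f) λ ¬good → none (f , ¬good))
    where
    -- `red` is a default off the k-sets. On k-sets `f` agrees with `χ` by `refl`, because the size
    -- proof taken by `χ` is irrelevant.
    f : Subset N → Colour
    f e with Sub.∣ e ∣ ℕ.≟ k
    ... | yes p = χ e p
    ... | no _  = red
    f-χ : ∀ e → (p : Sub.∣ e ∣ ≡ k) → f e ≡ χ e p
    f-χ e p with Sub.∣ e ∣ ℕ.≟ k
    ... | yes _ = refl
    ... | no ¬p = contradiction p ¬p
    restore : Good f → Contains (colourClass χ blue) G ⊎ Contains (colourClass χ red) H
    restore (inj₁ copy) = inj₁ (Contains-mono (class-of f blue) (colourClass χ blue) G (λ e (p , eq) → p , trans (sym (f-χ e p)) eq) copy)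
    restore (inj₂ copy) = inj₂ (Contains-mono (class-of f red) (colourClass χ red) H (λ e (p , eq) → p , trans (sym (f-χ e p)) eq) copy)

least : ∀ {P : ℕ → Set} → (∀ n → Dec (P n)) → ∀ {n} → P n → ∃[ r ] (P r × (∀ m → P m → r ≤ m))
least {P} P? {n} pn with below (suc n)
  where
  below : ∀ k → (∃[ r ] (P r × (∀ m → P m → r ≤ m))) ⊎ (∀ m → m <ⁿ k → ¬ P m)
  below zero = inj₂ λ _ ()
  below (suc k) with below k
  ... | inj₁ found = inj₁ found
  ... | inj₂ none with P? k
  ...   | yes pk = inj₁ (k , pk , λ m pm → ℕ.≮⇒≥ λ m<k → none m m<k pm)
  ...   | no ¬pk = inj₂ λ m m<1+k pm → case ℕ.m<1+n⇒m<n∨m≡n m<1+k of λ where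
            (inj₁ m<k)  → none m m<k pm
            (inj₂ refl) → ¬pk pm
... | inj₁ found = found
... | inj₂ none  = contradiction pn (none n (ℕ.n<1+n n))

-- Deciding the arrow relation turns one value with the property into the least one, so the
-- existence of the Ramsey number comes together with its upper bound.
ramsey-number : ∀ {k s t} (G : OrderedGraph k s) (H : OrderedGraph k t) {N} → Arrows N G H →
                ∃[ r ] IsRamseyNumber G H r × r ≤ N
ramsey-number G H arrows = let r , arrows-r , minimal = least (arrows? G H) arrows in
  r , (arrows-r , minimal) , minimal _ arrows

-- Finite sets of vertices

unique⇒length≤ : ∀ {xs ys : List A} → Unique xs → (∀ {x} → x ∈ xs → x ∈ ys) → length xs ≤ length ys
unique⇒length≤ {xs = []} _ _ = z≤n
unique⇒length≤ {xs = x ∷ xs} {ys} (x∉ ∷ uxs) xs⊆ with as , bs , refl ← Mem.∈-∃++ (xs⊆ (here refl)) =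
  ≤-trans (s≤s (unique⇒length≤ uxs λ y∈ → skip as (λ y≡x → All.lookup x∉ y∈ (sym y≡x)) (xs⊆ (there y∈))))
    (≤-reflexive (sym (trans (List.length-++ as) (trans (ℕ.+-suc (length as) (length bs)) (cong suc (sym (List.length-++ as)))))))
  where
  skip : ∀ as {bs : List _} {x y} → y ≢ x → y ∈ as ++ x ∷ bs → y ∈ as ++ bs
  skip []       y≢x (here y≡x) = contradiction y≡x y≢x
  skip []       y≢x (there y∈) = y∈
  skip (a ∷ as) y≢x (here y≡a) = here y≡a
  skip (a ∷ as) y≢x (there y∈) = there (skip as y≢x y∈)

elements : ∀ {n} → Subset n → List (Fin n)
elements Vec.[]          = []
elements (true Vec.∷ p)  = zero ∷ map suc (elements p)
elements (false Vec.∷ p) = map suc (elements p)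

length-elements : ∀ {n} (p : Subset n) → length (elements p) ≡ Sub.∣ p ∣
length-elements Vec.[]          = refl
length-elements (true Vec.∷ p)  = cong suc (trans (List.length-map suc (elements p)) (length-elements p))
length-elements (false Vec.∷ p) = trans (List.length-map suc (elements p)) (length-elements p)

elements-sorted : ∀ {n} (p : Subset n) → AllPairs Fin._<_ (elements p)
elements-sorted Vec.[]          = []
elements-sorted (true Vec.∷ p)  = All.map⁺ (All.tabulate λ _ → z<s) ∷ AllPairs.map⁺ (AllPairs.map s<s (elements-sorted p))
elements-sorted (false Vec.∷ p) = AllPairs.map⁺ (AllPairs.map s<s (elements-sorted p))

elements-unique : ∀ {n} (p : Subset n) → Unique (elements p)
elements-unique p = AllPairs.map Fin.<⇒≢ (elements-sorted p)

∈-elements⁺ : ∀ {n} {p : Subset n} {x} → x Sub.∈ p → x ∈ elements p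
∈-elements⁺ {p = true Vec.∷ p}  Vec.here       = here refl
∈-elements⁺ {p = true Vec.∷ p}  (Vec.there x∈) = there (Mem.∈-map⁺ suc (∈-elements⁺ x∈))
∈-elements⁺ {p = false Vec.∷ p} (Vec.there x∈) = Mem.∈-map⁺ suc (∈-elements⁺ x∈)

∈-elements⁻ : ∀ {n} (p : Subset n) {x} → x ∈ elements p → x Sub.∈ p
∈-elements⁻ (true Vec.∷ p)  (here refl) = Vec.here
∈-elements⁻ (true Vec.∷ p)  (there x∈) with _ , y∈ , refl ← Mem.∈-map⁻ suc x∈ = Vec.there (∈-elements⁻ p y∈)
∈-elements⁻ (false Vec.∷ p) x∈         with _ , y∈ , refl ← Mem.∈-map⁻ suc x∈ = Vec.there (∈-elements⁻ p y∈)

∈-tabulate⁺ : ∀ {n} {f : Fin n → Bool} {x} → f x ≡ true → x Sub.∈ tabulate f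
∈-tabulate⁺ {f = f} {x} fx = Vec.lookup⇒[]= x (tabulate f) (trans (Vec.lookup∘tabulate f x) fx)

∈-tabulate⁻ : ∀ {n} (f : Fin n → Bool) {x} → x Sub.∈ tabulate f → f x ≡ true
∈-tabulate⁻ f {x} x∈ = trans (sym (Vec.lookup∘tabulate f x)) (Vec.[]=⇒lookup x∈)

tri : ∀ {n} → Fin n → Fin n → Fin n → Subset n
tri x y z = Sub.⁅ x ⁆ Sub.∪ (Sub.⁅ y ⁆ Sub.∪ Sub.⁅ z ⁆)

∈-tri⁺ : ∀ {n} {x y z v : Fin n} → v ∈ x ∷ y ∷ z ∷ [] → v Sub.∈ tri x y z
∈-tri⁺ {x = x} (here refl)                         = Sub.x∈p∪q⁺ (inj₁ (Sub.x∈⁅x⁆ x))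
∈-tri⁺ {y = y} (there (here refl))                 = Sub.x∈p∪q⁺ (inj₂ (Sub.x∈p∪q⁺ (inj₁ (Sub.x∈⁅x⁆ y))))
∈-tri⁺ {z = z} (there (there (here refl)))         = Sub.x∈p∪q⁺ (inj₂ (Sub.x∈p∪q⁺ (inj₂ (Sub.x∈⁅x⁆ z))))

∈-tri⁻ : ∀ {n} (x y z : Fin n) {v} → v Sub.∈ tri x y z → v ∈ x ∷ y ∷ z ∷ []
∈-tri⁻ x y z v∈ with Sub.x∈p∪q⁻ Sub.⁅ x ⁆ _ v∈
... | inj₁ v∈x = here (Sub.x∈⁅y⁆⇒x≡y x v∈x)
... | inj₂ v∈yz with Sub.x∈p∪q⁻ Sub.⁅ y ⁆ _ v∈yz
...   | inj₁ v∈y = there (here (Sub.x∈⁅y⁆⇒x≡y y v∈y))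
...   | inj₂ v∈z = there (there (here (Sub.x∈⁅y⁆⇒x≡y z v∈z)))

tri-cong : ∀ {n} (x y z x′ y′ z′ : Fin n) →
  (∀ {v} → v ∈ x ∷ y ∷ z ∷ [] → v ∈ x′ ∷ y′ ∷ z′ ∷ []) →
  (∀ {v} → v ∈ x′ ∷ y′ ∷ z′ ∷ [] → v ∈ x ∷ y ∷ z ∷ []) → tri x y z ≡ tri x′ y′ z′
tri-cong x y z x′ y′ z′ sub sup = Sub.⊆-antisym (∈-tri⁺ ∘ sub ∘ ∈-tri⁻ x y z) (∈-tri⁺ ∘ sup ∘ ∈-tri⁻ x′ y′ z′)

tri-swap₁₂ : ∀ {n} (x y z : Fin n) → tri x y z ≡ tri y x z
tri-swap₁₂ x y z = tri-cong x y z y x z swap swap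
  where
  swap : ∀ {x y z v : Fin _} → v ∈ x ∷ y ∷ z ∷ [] → v ∈ y ∷ x ∷ z ∷ []
  swap (here eq)          = there (here eq)
  swap (there (here eq))  = here eq
  swap (there (there v∈)) = there (there v∈)

tri-swap₂₃ : ∀ {n} (x y z : Fin n) → tri x y z ≡ tri x z y
tri-swap₂₃ x y z = cong (Sub.⁅ x ⁆ Sub.∪_) (Sub.∪-comm Sub.⁅ y ⁆ Sub.⁅ z ⁆)

distinct₃ : ∀ {n} {x y z : Fin n} → x ≢ y → x ≢ z → y ≢ z → Unique (x ∷ y ∷ z ∷ [])
distinct₃ x≢y x≢z y≢z = (x≢y ∷ x≢z ∷ []) ∷ (y≢z ∷ []) ∷ [] ∷ []

∣tri∣ : ∀ {n} {x y z : Fin n} → x ≢ y → x ≢ z → y ≢ z → Sub.∣ tri x y z ∣ ≡ 3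
∣tri∣ {x = x} {y} {z} x≢y x≢z y≢z = trans (sym (length-elements (tri x y z))) (ℕ.≤-antisym
  (unique⇒length≤ (elements-unique (tri x y z)) (∈-tri⁻ x y z ∘ ∈-elements⁻ (tri x y z)))
  (unique⇒length≤ (distinct₃ x≢y x≢z y≢z) (∈-elements⁺ ∘ ∈-tri⁺)))

⊇-tri⇒≡ : ∀ {n} {e : Subset n} {x y z} → Sub.∣ e ∣ ≡ 3 → x ≢ y → x ≢ z → y ≢ z →
          x Sub.∈ e → y Sub.∈ e → z Sub.∈ e → e ≡ tri x y z
⊇-tri⇒≡ {e = e} {x} {y} {z} |e| x≢y x≢z y≢z x∈ y∈ z∈ = Sub.⊆-antisym e⊆ ⊆e
  where
  mem : ∀ {v} → v ∈ x ∷ y ∷ z ∷ [] → v Sub.∈ e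
  mem (here refl)                 = x∈
  mem (there (here refl))         = y∈
  mem (there (there (here refl))) = z∈
  ⊆e : tri x y z Sub.⊆ e
  ⊆e v∈ = mem (∈-tri⁻ x y z v∈)
  e⊆ : e Sub.⊆ tri x y z
  e⊆ {v} v∈ with v Fin.≟ x | v Fin.≟ y | v Fin.≟ z
  ... | yes refl | _ | _ = ∈-tri⁺ (here refl)
  ... | no _ | yes refl | _ = ∈-tri⁺ (there (here refl))
  ... | no _ | no _ | yes refl = ∈-tri⁺ (there (there (here refl)))
  ... | no v≢x | no v≢y | no v≢z = contradiction
    (unique⇒length≤ {xs = v ∷ x ∷ y ∷ z ∷ []} ((v≢x ∷ v≢y ∷ v≢z ∷ []) ∷ distinct₃ x≢y x≢z y≢z)
      (λ { (here refl) → ∈-elements⁺ v∈ ; (there w∈) → ∈-elements⁺ (mem w∈) }))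
    (λ 4≤ → ℕ.<-irrefl (sym (trans (length-elements e) |e|)) 4≤)

image-tri : ∀ {t N} (φ : Fin t → Fin N) x y z → image φ (tri x y z) ≡ tri (φ x) (φ y) (φ z)
image-tri φ x y z = Sub.⊆-antisym to from
  where
  to : image φ (tri x y z) Sub.⊆ tri (φ x) (φ y) (φ z)
  to v∈ with u , u∈ , refl ← ∈-image⁻ φ v∈ = ∈-tri⁺ (Mem.∈-map⁺ φ (∈-tri⁻ x y z u∈))
  from : tri (φ x) (φ y) (φ z) Sub.⊆ image φ (tri x y z)
  from v∈ with u , u∈ , refl ← Mem.∈-map⁻ φ {xs = x ∷ y ∷ z ∷ []} (∈-tri⁻ (φ x) (φ y) (φ z) v∈) = ∈-image⁺ φ (∈-tri⁺ u∈)

-- Copies of the complete tripartite graph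

sorted-lookup : ∀ {n} {xs : List (Fin n)} → AllPairs Fin._<_ xs → ∀ {i j} → i Fin.< j →
                List.lookup xs i Fin.< List.lookup xs j
sorted-lookup (x< ∷ _)  {zero}  {suc j} _         = All.lookup x< (Mem.∈-lookup j)
sorted-lookup (_ ∷ xs<) {suc i} {suc j} (s<s i<j) = sorted-lookup xs< i<j

-- The list is sorted by passing to a `Subset` and listing its elements in increasing order.
increasing-enumeration : ∀ {n N} {xs : List (Fin N)} → Unique xs → n ≤ length xs →
  ∃[ f ] (∀ {i j : Fin n} → i Fin.< j → f i Fin.< f j) × (∀ i → f i ∈ xs)
increasing-enumeration {n} {N} {xs} uxs n≤ = (λ i → List.lookup els (Fin.inject≤ i n≤els)) ,
  (λ {i} {j} i<j → sorted-lookup (elements-sorted S)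
    (subst₂ _<ⁿ_ (sym (Fin.toℕ-inject≤ i n≤els)) (sym (Fin.toℕ-inject≤ j n≤els)) i<j)) ,
  λ i → els⊆ (Mem.∈-lookup (Fin.inject≤ i n≤els))
  where
  listed : Fin N → Bool
  listed x = does (DecMem._∈?_ Fin._≟_ x xs)
  S   = tabulate listed
  els = elements S
  els⊆ : ∀ {x} → x ∈ els → x ∈ xs
  els⊆ {x} x∈ = does⇒ (DecMem._∈?_ Fin._≟_ x xs) (∈-tabulate⁻ listed (∈-elements⁻ S x∈))
  n≤els : n ≤ length els
  n≤els = ≤-trans n≤ (unique⇒length≤ uxs λ {x} x∈ → ∈-elements⁺ (∈-tabulate⁺ (dec-true (DecMem._∈?_ Fin._≟_ x xs) x∈)))

tripartite-copy : ∀ {n N} (G : OrderedGraph 3 N) (f : Fin 3 → Fin n → Fin N) →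
  (∀ j {i i′} → i Fin.< i′ → f j i Fin.< f j i′) → (∀ {j j′} i i′ → j Fin.< j′ → f j i Fin.< f j′ i′) →
  (∀ i₀ i₁ i₂ → Edge G (tri (f zero i₀) (f (suc zero) i₁) (f (suc (suc zero)) i₂))) →
  Contains G (completeTripartite n)
tripartite-copy {n} {N} G f f-mono f-block f-edge = φ , injective , preserves , copy
  where
  part : Fin (3 · n) → Fin 3
  part v = proj₁ (Fin.remQuot {3} n v)
  index : Fin (3 · n) → Fin n
  index v = proj₂ (Fin.remQuot {3} n v)
  φ : Fin (3 · n) → Fin N
  φ v = f (part v) (index v)
  v≡ : ∀ v → Fin.combine (part v) (index v) ≡ v
  v≡ = Fin.combine-remQuot {3} n
  strict : ∀ {v w} → v Fin.< w → φ v Fin.< φ w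
  strict {v} {w} v<w with Fin.<-cmp (part v) (part w)
  ... | tri< lt _ _ = f-block (index v) (index w) lt
  ... | tri> _ _ gt = contradiction (subst₂ Fin._<_ (v≡ w) (v≡ v) (Fin.combine-monoˡ-< (index w) (index v) gt)) (ℕ.<-asym v<w)
  ... | tri≈ _ eq _ = subst (λ j → f (part v) (index v) Fin.< f j (index w)) eq (f-mono (part v)
    (ℕ.+-cancelˡ-< (n · toℕ (part v)) _ _ (subst₂ _<ⁿ_
      (trans (cong toℕ (sym (v≡ v))) (Fin.toℕ-combine (part v) (index v)))
      (trans (cong toℕ (sym (v≡ w))) (trans (Fin.toℕ-combine (part w) (index w)) (cong (λ j → n · toℕ j + toℕ (index w)) (sym eq))))
      v<w)))
  injective : ∀ {v w} → φ v ≡ φ w → v ≡ w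
  injective {v} {w} eq with Fin.<-cmp v w
  ... | tri< lt _ _ = contradiction eq (Fin.<⇒≢ (strict lt))
  ... | tri≈ _ v≡w _ = v≡w
  ... | tri> _ _ gt = contradiction (sym eq) (Fin.<⇒≢ (strict gt))
  preserves : ∀ {v w} → v Fin.≤ w → φ v Fin.≤ φ w
  preserves {v} {w} v≤w with Fin.<-cmp v w
  ... | tri< lt _ _ = ℕ.<⇒≤ (strict lt)
  ... | tri≈ _ refl _ = ≤-refl
  ... | tri> _ _ gt = contradiction v≤w (ℕ.<⇒≱ gt)
  member : ∀ {m} (p : Subset m) → Sub.∣ p ∣ ≡ 1 → ∃[ x ] x Sub.∈ p
  member p |p| with elements p in eq | trans (length-elements p) |p|
  ... | x ∷ _ | _ = x , ∈-elements⁻ p (subst (x ∈_) (sym eq) (here refl))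
  copy : ∀ e → Edge (completeTripartite n) e → Edge G (image φ e)
  copy e (|e| , one) = subst (Edge G) (sym image≡) (f-edge (index x₀) (index x₁) (index x₂))
    where
    vertex : ∀ j → ∃[ x ] x Sub.∈ e × part x ≡ j
    vertex j = let x , x∈ = member (e Sub.∩ class n j) (one j)
                   x∈e , x∈j = Sub.x∈p∩q⁻ e (class n j) x∈
               in x , x∈e , does⇒ (Fin.quotient n x Fin.≟ j) (∈-tabulate⁻ _ x∈j)
    x₀ = proj₁ (vertex zero)
    x₁ = proj₁ (vertex (suc zero))
    x₂ = proj₁ (vertex (suc (suc zero)))
    part≡ : ∀ j → part (proj₁ (vertex j)) ≡ j
    part≡ j = proj₂ (proj₂ (vertex j))
    differ : ∀ {i j} → i ≢ j → proj₁ (vertex i) ≢ proj₁ (vertex j)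
    differ {i} {j} i≢j eq = i≢j (trans (sym (part≡ i)) (trans (cong part eq) (part≡ j)))
    image≡ : image φ e ≡ tri (f zero (index x₀)) (f (suc zero) (index x₁)) (f (suc (suc zero)) (index x₂))
    image≡ = trans (cong (image φ) (⊇-tri⇒≡ |e| (differ λ ()) (differ λ ()) (differ λ ())
        (proj₁ (proj₂ (vertex zero))) (proj₁ (proj₂ (vertex (suc zero)))) (proj₁ (proj₂ (vertex (suc (suc zero)))))))
      (trans (image-tri φ x₀ x₁ x₂) (trans (cong (λ j → tri (f j (index x₀)) (φ x₁) (φ x₂)) (part≡ zero))
        (trans (cong (λ j → tri (f zero (index x₀)) (f j (index x₁)) (φ x₂)) (part≡ (suc zero)))
          (cong (λ j → tri (f zero (index x₀)) (f (suc zero) (index x₁)) (f j (index x₂))) (part≡ (suc (suc zero)))))))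

sorted-cube⇒copy : ∀ {n N} (G : OrderedGraph 3 N) (xs ys zs : List (Fin N)) →
  n ≤ length xs → n ≤ length ys → n ≤ length zs → Unique xs → Unique ys → Unique zs →
  (∀ {x y} → x ∈ xs → y ∈ ys → x Fin.< y) → (∀ {y z} → y ∈ ys → z ∈ zs → y Fin.< z) →
  (∀ {x y z} → x ∈ xs → y ∈ ys → z ∈ zs → Edge G (tri x y z)) → Contains G (completeTripartite n)
sorted-cube⇒copy {n} {N} G xs ys zs xs≥ ys≥ zs≥ uxs uys uzs xs<ys ys<zs edges =
  let f , f-mono , f∈ = increasing-enumeration uxs xs≥
      g , g-mono , g∈ = increasing-enumeration uys ys≥
      h , h-mono , h∈ = increasing-enumeration uzs zs≥
      fgh : Fin 3 → Fin n → Fin N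
      fgh = λ { zero → f ; (suc zero) → g ; (suc (suc zero)) → h }
  in tripartite-copy G fgh
       (λ { zero → f-mono ; (suc zero) → g-mono ; (suc (suc zero)) → h-mono })
       (λ { {zero} {suc zero} i i′ _ → xs<ys (f∈ i) (g∈ i′)
          ; {zero} {suc (suc zero)} i i′ _ → ℕ.<-trans (xs<ys (f∈ i) (g∈ i)) (ys<zs (g∈ i) (h∈ i′))
          ; {suc zero} {suc (suc zero)} i i′ _ → ys<zs (g∈ i) (h∈ i′)
          ; {zero} {zero} _ _ ()
          ; {suc zero} {zero} _ _ ()
          ; {suc zero} {suc zero} _ _ (s<s ())
          ; {suc (suc zero)} {zero} _ _ ()
          ; {suc (suc zero)} {suc zero} _ _ (s<s ())
          ; {suc (suc zero)} {suc (suc zero)} _ _ (s<s (s<s ())) })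
       (λ i₀ i₁ i₂ → edges (f∈ i₀) (g∈ i₁) (h∈ i₂))

-- Consecutive intervals of prescribed lengths

∑-allFin : ∀ {t} (f : Fin (suc t) → ℕ) → ∑ (allFin (suc t)) f ≡ f zero + ∑ (allFin t) (f ∘ suc)
∑-allFin {t} f = cong (f zero ℕ.+_)
  (trans (cong (λ xs → ∑ xs f) (sym (List.map-tabulate id suc))) (∑-map suc (allFin t) f))

abstract

  total : ∀ {t} → (Fin t → ℕ) → ℕ
  total {zero}  w = 0
  total {suc t} w = w zero + total (w ∘ suc)

  interval : ∀ {t} (w : Fin t → ℕ) → Fin t → List (Fin (total w))
  interval w zero    = map (Fin._↑ˡ total (w ∘ suc)) (allFin (w zero))
  interval w (suc v) = map (w zero Fin.↑ʳ_) (interval (w ∘ suc) v)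

  length-interval : ∀ {t} (w : Fin t → ℕ) v → length (interval w v) ≡ w v
  length-interval w zero    = trans (List.length-map _ (allFin (w zero))) (List.length-tabulate id)
  length-interval w (suc v) = trans (List.length-map _ (interval (w ∘ suc) v)) (length-interval (w ∘ suc) v)

  interval-unique : ∀ {t} (w : Fin t → ℕ) v → Unique (interval w v)
  interval-unique w zero    = Unique.map⁺ (Fin.↑ˡ-injective _ _ _) (Unique.allFin⁺ (w zero))
  interval-unique w (suc v) = Unique.map⁺ (Fin.↑ʳ-injective (w zero) _ _) (interval-unique (w ∘ suc) v)

  interval-< : ∀ {t} (w : Fin t → ℕ) {v v′} → v Fin.< v′ →
               ∀ {x y} → x ∈ interval w v → y ∈ interval w v′ → x Fin.< y
  interval-< w {zero} {suc v′} _ x∈ y∈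
    with i , _ , refl ← Mem.∈-map⁻ _ x∈ | j , _ , refl ← Mem.∈-map⁻ (w zero Fin.↑ʳ_) {xs = interval (w ∘ suc) v′} y∈ =
    subst₂ _<ⁿ_ (sym (Fin.toℕ-↑ˡ i _)) (sym (Fin.toℕ-↑ʳ (w zero) j)) (ℕ.<-≤-trans (Fin.toℕ<n i) (ℕ.m≤m+n _ _))
  interval-< w {suc v} {suc v′} (s<s v<v′) x∈ y∈
    with i , i∈ , refl ← Mem.∈-map⁻ (w zero Fin.↑ʳ_) {xs = interval (w ∘ suc) v} x∈
       | j , j∈ , refl ← Mem.∈-map⁻ (w zero Fin.↑ʳ_) {xs = interval (w ∘ suc) v′} y∈ =
    subst₂ _<ⁿ_ (sym (Fin.toℕ-↑ʳ (w zero) i)) (sym (Fin.toℕ-↑ʳ (w zero) j)) (ℕ.+-monoʳ-< (w zero) (interval-< (w ∘ suc) v<v′ i∈ j∈))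

  total≡∑ : ∀ {t} (w : Fin t → ℕ) → total w ≡ ∑ (allFin t) w
  total≡∑ {zero}  w = refl
  total≡∑ {suc t} w = trans (cong (w zero ℕ.+_) (total≡∑ (w ∘ suc))) (sym (∑-allFin w))

∑-same : ∀ {t} (i : Fin t) → ∑[ k ← allFin t ] ⟦ same i k ⟧ ≡ 1
∑-same {suc t} zero = trans (∑-allFin (λ k → ⟦ same {suc t} zero k ⟧)) (cong suc (trans (∑-const (allFin t) 0) (ℕ.*-zeroʳ (length (allFin t)))))
∑-same {suc t} (suc i) = trans (∑-allFin (λ k → ⟦ same (suc i) k ⟧)) (∑-same i)

-- The roles of `v₁`, `v₂`, `v₃` will come from the degeneracy order, while the classes of the copy
-- run from left to right. Each of the six relative orders is handled by permuting the sides of the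
-- cube.
cube⇒copy : ∀ {n t} (w : Fin t → ℕ) (G : OrderedGraph 3 (total w)) (R : Fin (total w) → Fin (total w) → Fin (total w) → Bool)
  {v₁ v₂ v₃ : Fin t} → v₁ ≢ v₂ → v₁ ≢ v₃ → v₂ ≢ v₃ →
  (∀ {x y z} → x ∈ interval w v₁ → y ∈ interval w v₂ → z ∈ interval w v₃ → R x y z ≡ true → Edge G (tri x y z)) →
  Cube R n (interval w v₁) (interval w v₂) (interval w v₃) → Contains G (completeTripartite n)
cube⇒copy w G R {v₁} {v₂} {v₃} 1≢2 1≢3 2≢3 edge (xs , ys , zs , (xs≥ , ys≥ , zs≥) , (uxs , uys , uzs) , (xs⊆ , ys⊆ , zs⊆) , all) =
  by-order (Fin.<-cmp v₁ v₂) (Fin.<-cmp v₁ v₃) (Fin.<-cmp v₂ v₃)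
  where
  edges : ∀ {x y z} → x ∈ xs → y ∈ ys → z ∈ zs → Edge G (tri x y z)
  edges x∈ y∈ z∈ = edge (xs⊆ x∈) (ys⊆ y∈) (zs⊆ z∈) (all x∈ y∈ z∈)
  1<2 : v₁ Fin.< v₂ → ∀ {x y} → x ∈ xs → y ∈ ys → x Fin.< y
  1<2 lt x∈ y∈ = interval-< w lt (xs⊆ x∈) (ys⊆ y∈)
  2<1 : v₂ Fin.< v₁ → ∀ {y x} → y ∈ ys → x ∈ xs → y Fin.< x
  2<1 lt y∈ x∈ = interval-< w lt (ys⊆ y∈) (xs⊆ x∈)
  1<3 : v₁ Fin.< v₃ → ∀ {x z} → x ∈ xs → z ∈ zs → x Fin.< z
  1<3 lt x∈ z∈ = interval-< w lt (xs⊆ x∈) (zs⊆ z∈)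
  3<1 : v₃ Fin.< v₁ → ∀ {z x} → z ∈ zs → x ∈ xs → z Fin.< x
  3<1 lt z∈ x∈ = interval-< w lt (zs⊆ z∈) (xs⊆ x∈)
  2<3 : v₂ Fin.< v₃ → ∀ {y z} → y ∈ ys → z ∈ zs → y Fin.< z
  2<3 lt y∈ z∈ = interval-< w lt (ys⊆ y∈) (zs⊆ z∈)
  3<2 : v₃ Fin.< v₂ → ∀ {z y} → z ∈ zs → y ∈ ys → z Fin.< y
  3<2 lt z∈ y∈ = interval-< w lt (zs⊆ z∈) (ys⊆ y∈)
  by-order : _ → _ → _ → _
  by-order (tri≈ _ eq _) _ _ = contradiction eq 1≢2
  by-order _ (tri≈ _ eq _) _ = contradiction eq 1≢3
  by-order _ _ (tri≈ _ eq _) = contradiction eq 2≢3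
  by-order (tri< lt12 _ _) _ (tri< lt23 _ _) =
    sorted-cube⇒copy G xs ys zs xs≥ ys≥ zs≥ uxs uys uzs (1<2 lt12) (2<3 lt23) edges
  by-order (tri< lt12 _ _) (tri< lt13 _ _) (tri> _ _ lt32) =
    sorted-cube⇒copy G xs zs ys xs≥ zs≥ ys≥ uxs uzs uys (1<3 lt13) (3<2 lt32)
      λ x∈ z∈ y∈ → subst (Edge G) (tri-swap₂₃ _ _ _) (edges x∈ y∈ z∈)
  by-order (tri< lt12 _ _) (tri> _ _ lt31) (tri> _ _ lt32) =
    sorted-cube⇒copy G zs xs ys zs≥ xs≥ ys≥ uzs uxs uys (3<1 lt31) (1<2 lt12)
      λ z∈ x∈ y∈ → subst (Edge G) (trans (tri-swap₂₃ _ _ _) (tri-swap₁₂ _ _ _)) (edges x∈ y∈ z∈)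
  by-order (tri> _ _ lt21) (tri< lt13 _ _) _ =
    sorted-cube⇒copy G ys xs zs ys≥ xs≥ zs≥ uys uxs uzs (2<1 lt21) (1<3 lt13)
      λ y∈ x∈ z∈ → subst (Edge G) (tri-swap₁₂ _ _ _) (edges x∈ y∈ z∈)
  by-order (tri> _ _ lt21) (tri> _ _ lt31) (tri< lt23 _ _) =
    sorted-cube⇒copy G ys zs xs ys≥ zs≥ xs≥ uys uzs uxs (2<3 lt23) (3<1 lt31)
      λ y∈ z∈ x∈ → subst (Edge G) (trans (tri-swap₁₂ _ _ _) (tri-swap₂₃ _ _ _)) (edges x∈ y∈ z∈)
  by-order (tri> _ _ lt21) (tri> _ _ lt31) (tri> _ _ lt32) =
    sorted-cube⇒copy G zs ys xs zs≥ ys≥ xs≥ uzs uys uxs (3<2 lt32) (2<1 lt21)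
      λ z∈ y∈ x∈ → subst (Edge G) (trans (tri-swap₁₂ _ _ _) (trans (tri-swap₂₃ _ _ _) (tri-swap₁₂ _ _ _))) (edges x∈ y∈ z∈)

-- Positions of the vertices of an edge in a degeneracy ordering

all-subsets : ∀ {t} (e : Subset t) → e ∈ subsets t
all-subsets Vec.[]          = here refl
all-subsets (true Vec.∷ e)  = Mem.∈-++⁺ˡ (Mem.∈-map⁺ (inside Vec.∷_) (all-subsets e))
all-subsets (false Vec.∷ e) = Mem.∈-++⁺ʳ _ (Mem.∈-map⁺ (outside Vec.∷_) (all-subsets e))

module Positions {t : ℕ} (u : Permutation′ (suc t)) where

  u-injective : ∀ {i j} → u ⟨$⟩ʳ i ≡ u ⟨$⟩ʳ j → i ≡ j
  u-injective eq = trans (sym (inverseˡ u)) (trans (cong (u ⟨$⟩ˡ_) eq) (inverseˡ u))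

  u⁻¹-injective : ∀ {v w} → u ⟨$⟩ˡ v ≡ u ⟨$⟩ˡ w → v ≡ w
  u⁻¹-injective eq = trans (sym (inverseʳ u)) (trans (cong (u ⟨$⟩ʳ_) eq) (inverseʳ u))

  -- Pulled back along the ordering, so that `elements` lists the vertices in degeneracy order
  -- instead of natural order.
  positions : Subset (suc t) → Subset (suc t)
  positions e = tabulate λ i → lookup e (u ⟨$⟩ʳ i)

  ∈-positions⁻ : ∀ e {i} → i Sub.∈ positions e → u ⟨$⟩ʳ i Sub.∈ e
  ∈-positions⁻ e i∈ = Vec.lookup⇒[]= _ e (∈-tabulate⁻ (λ i → lookup e (u ⟨$⟩ʳ i)) i∈)

  ∈-positions⁺ : ∀ e {v} → v Sub.∈ e → u ⟨$⟩ˡ v Sub.∈ positions e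
  ∈-positions⁺ e {v} v∈ = ∈-tabulate⁺ {f = λ i → lookup e (u ⟨$⟩ʳ i)} (trans (cong (lookup e) (inverseʳ u)) (Vec.[]=⇒lookup v∈))

  ∣positions∣ : ∀ e → length (elements (positions e)) ≡ Sub.∣ e ∣
  ∣positions∣ e = trans (ℕ.≤-antisym
    (subst (_≤ length (elements e)) (List.length-map (u ⟨$⟩ʳ_) (elements (positions e)))
      (unique⇒length≤ (Unique.map⁺ u-injective (elements-unique (positions e)))
        λ v∈ → case Mem.∈-map⁻ (u ⟨$⟩ʳ_) v∈ of λ where
          (i , i∈ , refl) → ∈-elements⁺ (∈-positions⁻ e (∈-elements⁻ (positions e) i∈))))
    (subst (_≤ length (elements (positions e))) (List.length-map (u ⟨$⟩ˡ_) (elements e))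
      (unique⇒length≤ (Unique.map⁺ u⁻¹-injective (elements-unique e))
        λ i∈ → case Mem.∈-map⁻ (u ⟨$⟩ˡ_) i∈ of λ where
          (v , v∈ , refl) → ∈-elements⁺ (∈-positions⁺ e (∈-elements⁻ e v∈)))))
    (length-elements e)

  abstract

    -- zero is a junk value for sets without three elements.
    first middle last : Subset (suc t) → Fin (suc t)
    first e with elements (positions e)
    ... | i ∷ _ = i
    ... | _     = zero
    middle e with elements (positions e)
    ... | _ ∷ j ∷ _ = j
    ... | _         = zero
    last e with elements (positions e)
    ... | _ ∷ _ ∷ k ∷ _ = k
    ... | _             = zero

    in-order : ∀ e → Sub.∣ e ∣ ≡ 3 → first e Fin.< middle e × middle e Fin.< last e ×
      (u ⟨$⟩ʳ first e Sub.∈ e × u ⟨$⟩ʳ middle e Sub.∈ e × u ⟨$⟩ʳ last e Sub.∈ e)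
    in-order e |e| with elements (positions e) | trans (∣positions∣ e) |e| | elements-sorted (positions e)
                        | (λ {i} → ∈-positions⁻ e {i} ∘ ∈-elements⁻ (positions e))
    ... | i ∷ j ∷ k ∷ [] | refl | (i<j ∷ _ ∷ []) ∷ (j<k ∷ []) ∷ _ | mem =
      i<j , j<k , mem (here refl) , mem (there (here refl)) , mem (there (there (here refl)))

  edge≡tri : ∀ e → Sub.∣ e ∣ ≡ 3 → e ≡ tri (u ⟨$⟩ʳ first e) (u ⟨$⟩ʳ middle e) (u ⟨$⟩ʳ last e)
  edge≡tri e |e| = let f<m , m<l , f∈ , m∈ , l∈ = in-order e |e| in
    ⊇-tri⇒≡ |e| (Fin.<⇒≢ f<m ∘ u-injective) (Fin.<⇒≢ (ℕ.<-trans f<m m<l) ∘ u-injective) (Fin.<⇒≢ m<l ∘ u-injective) f∈ m∈ l∈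

count-filter : ∀ {P Q : A → Set} (P? : ∀ x → Dec (P x)) (Q? : ∀ x → Dec (Q x)) (q : A → Bool) xs →
  (∀ {x} → P x → q x ≡ true → Q x) → ∑[ x ← filter P? xs ] ⟦ q x ⟧ ≤ length (filter Q? xs)
count-filter P? Q? q []       _   = z≤n
count-filter P? Q? q (x ∷ xs) imp with P? x | Q? x
... | no _  | no _  = count-filter P? Q? q xs imp
... | no _  | yes _ = ℕ.m≤n⇒m≤1+n (count-filter P? Q? q xs imp)
... | yes p | yes _ = ℕ.+-mono-≤ ⟦ q x ⟧≤1 (count-filter P? Q? q xs imp)
... | yes p | no ¬Q with q x in qx
...   | true  = contradiction (imp p qx) ¬Q
...   | false = count-filter P? Q? q xs imp

-- From the parameters to a blue or a red copy

module Arrowing {t : ℕ} (H : OrderedGraph 3 (suc t)) (d n γ e m u M : ℕ) where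

  a b P z bad-bound : ℕ
  a = γ + 8
  b = 2 · d · a ^ d
  -- A rectangle with large sides keeps 1 / b² of all pairs, and the link graph has density at least
  -- a^(- d) on it, so 1 / `P` bounds its share below. In `bad-bound` the factor `2 · z` is the loss
  -- from bad vertices to those with a sparse trace on the biclique.
  P = b · b · a ^ d
  z = 4 · P
  bad-bound = 2 · z · (n · (m ^ n · u ^ n))

  module _ (0<d : 0 <ⁿ d) (0<n : 0 <ⁿ n) (0<γ : 0 <ⁿ γ) (0<m : 0 <ⁿ m) (0<u : 0 <ⁿ u) (0<M : 0 <ⁿ M)
    (m-large : 2 · z · (a · n) ≤ m) (u-large : 4 · z · (n · 2 ^ e) ≤ u) (growth : a ^ n ≤ 2 ^ e · γ ^ n)
    (M-large₁ : 4 · z · m ≤ M) (M-large₂ : 2 · z · ((4 · z) ^ m · u) ≤ M) (M-large₃ : 2 · a ^ d · bad-bound ≤ M)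
    (σ : Permutation′ (suc t)) (degenerate : ∀ i → card (backEdge? H σ i) ≤ d) where

    open Positions σ

    0<a : 0 <ⁿ a
    0<a = ℕ.<-≤-trans 0<γ (ℕ.m≤m+n γ 8)

    0<P : 0 <ⁿ P
    0<P = *-pos (*-pos 0<b 0<b) (^-pos d 0<a)
      where
      0<b : 0 <ⁿ b
      0<b = *-pos (*-pos (z<s {1}) 0<d) (^-pos d 0<a)

    Es : List (Subset (suc t))
    Es = filter (edge? H) (subsets (suc t))

    E⇒3 : ∀ {f} → f ∈ Es → Sub.∣ f ∣ ≡ 3
    E⇒3 f∈ = uniform H (proj₂ (Mem.∈-filter⁻ (edge? H) {xs = subsets (suc t)} f∈))

    first<middle : ∀ {f} → f ∈ Es → first f Fin.< middle f
    first<middle {f} f∈ = proj₁ (in-order f (E⇒3 f∈))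

    middle<last : ∀ {f} → f ∈ Es → middle f Fin.< last f
    middle<last {f} f∈ = proj₁ (proj₂ (in-order f (E⇒3 f∈)))

    -- An edge meets an earlier vertex at its middle position, so it is a back edge there; likewise
    -- at its last position.
    deg-middle : ∀ k → ∑[ f ← Es ] ⟦ same (middle f) k ⟧ ≤ d
    deg-middle k = ≤-trans (count-filter (edge? H) (backEdge? H σ k) (λ f → same (middle f) k) (subsets (suc t))
      (λ {f} f∈ eq → back f f∈ (same-true eq))) (degenerate k)
      where
      back : ∀ f → Edge H f → middle f ≡ k → BackEdge H σ k f
      back f f∈ refl = let f<m , _ , i∈ , j∈ , _ = in-order f (uniform H f∈) in f∈ , j∈ , first f , f<m , i∈

    deg-last : ∀ k → ∑[ f ← Es ] ⟦ same (last f) k ⟧ ≤ d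
    deg-last k = ≤-trans (count-filter (edge? H) (backEdge? H σ k) (λ f → same (last f) k) (subsets (suc t))
      (λ {f} f∈ eq → back f f∈ (same-true eq))) (degenerate k)
      where
      back : ∀ f → Edge H f → last f ≡ k → BackEdge H σ k f
      back f f∈ refl = let _ , m<l , _ , j∈ , k∈ = in-order f (uniform H f∈) in f∈ , k∈ , middle f , m<l , j∈

    weight : Fin (suc t) → ℕ
    weight v = M · suc (∑[ f ← Es ] ⟦ same (σ ⟨$⟩ʳ first f) v ⟧)

    N : ℕ
    N = total weight

    edges≤ : length Es ≤ suc t · d
    edges≤ = begin
      length Es                                             ≡⟨ trans (∑-const Es 1) (ℕ.*-identityʳ _) ⟨
      ∑[ _ ← Es ] 1                                         ≡⟨ ∑-cong Es (λ f → ∑-same (last f)) ⟨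
      ∑[ f ← Es ] ∑[ k ← allFin (suc t) ] ⟦ same (last f) k ⟧ ≡⟨ ∑-swap Es (allFin (suc t)) _ ⟩
      ∑[ k ← allFin (suc t) ] ∑[ f ← Es ] ⟦ same (last f) k ⟧ ≤⟨ ∑-≤-const (allFin (suc t)) _ d (λ {k} _ → deg-last k) ⟩
      length (allFin (suc t)) · d                           ≡⟨ cong (_· d) (List.length-tabulate {n = suc t} id) ⟩
      suc t · d                                             ∎
      where open ≤-Reasoning

    N≤ : N ≤ suc t · (M · suc d)
    N≤ = begin
      N                                                     ≡⟨ total≡∑ weight ⟩
      ∑[ v ← allFin (suc t) ] (M · suc (∑[ f ← Es ] ⟦ same (σ ⟨$⟩ʳ first f) v ⟧))
        ≡⟨ trans (∑-*ˡ M (allFin (suc t)) _) (cong (M ·_) (∑-+ (allFin (suc t)) (λ _ → 1) _)) ⟩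
      M · (∑[ _ ← allFin (suc t) ] 1 + ∑[ v ← allFin (suc t) ] ∑[ f ← Es ] ⟦ same (σ ⟨$⟩ʳ first f) v ⟧)
        ≡⟨ cong₂ (λ x y → M · (x + y)) (trans (∑-const (allFin (suc t)) 1) (trans (ℕ.*-identityʳ _) (List.length-tabulate {n = suc t} id)))
             (trans (∑-swap (allFin (suc t)) Es _) (trans (∑-cong Es (λ f → ∑-same (σ ⟨$⟩ʳ first f))) (trans (∑-const Es 1) (ℕ.*-identityʳ _)))) ⟩
      M · (suc t + length Es)                               ≤⟨ ℕ.*-monoʳ-≤ M (ℕ.+-monoʳ-≤ (suc t) edges≤) ⟩
      M · (suc t + suc t · d)                               ≡⟨ regroup M (suc t) d ⟩
      suc t · (M · suc d)                                   ∎
      where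
      open ≤-Reasoning
      regroup : ∀ M t d → M · (t + t · d) ≡ t · (M · suc d)
      regroup = solve-∀

    slot : Fin (suc t) → List (Fin N)
    slot k = interval weight (σ ⟨$⟩ʳ k)

    module _ (χ : Colouring 3 N) where

      Blue Red : OrderedGraph 3 N
      Blue = colourClass χ blue
      Red  = colourClass χ red

      isBlue : Fin N → Fin N → Fin N → Bool
      isBlue x y z = does (edge? Blue (tri x y z))

      open Embedding Es first middle last slot isBlue a d bad-bound M
        using (forward; Large; size; pairs; FewSparseLinks; embedding)

      |slot| : ∀ k → length (slot k) ≡ M · suc (forward k)
      |slot| k = trans (length-interval weight (σ ⟨$⟩ʳ k)) (cong (λ x → M · suc x) (∑-cong Es λ f → cong ⟦_⟧ (same-σ (first f))))
        where
        same-σ : ∀ i → same (σ ⟨$⟩ʳ i) (σ ⟨$⟩ʳ k) ≡ same i k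
        same-σ i with i Fin.≟ k
        ... | yes refl = same-refl (σ ⟨$⟩ʳ i)
        ... | no i≢k   = dec-false (_ Fin.≟ _) (i≢k ∘ u-injective)

      M≤slot : ∀ k → M ≤ length (slot k)
      M≤slot k = ≤-trans (ℕ.m≤m*n M (suc (forward k))) (≤-reflexive (sym (|slot| k)))

      -- `isBlue` is also false on triples with repeated vertices. Distinct slots are disjoint,
      -- which excludes these and leaves red as the only alternative.
      red-edge : ∀ {i j k} → i ≢ j → i ≢ k → j ≢ k → ∀ {x y z} → x ∈ slot i → y ∈ slot j → z ∈ slot k →
                 not (isBlue x y z) ≡ true → Edge Red (tri x y z)
      red-edge {i} {j} {k} i≢j i≢k j≢k {x} {y} {z} x∈ y∈ z∈ ¬blue =
        |xyz| , is-red (χ (tri x y z) |xyz|) refl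
        where
        apart : ∀ {i j} → i ≢ j → ∀ {x y} → x ∈ slot i → y ∈ slot j → x ≢ y
        apart {i} {j} i≢j x∈ y∈ with Fin.<-cmp (σ ⟨$⟩ʳ i) (σ ⟨$⟩ʳ j)
        ... | tri< lt _ _ = Fin.<⇒≢ (interval-< weight lt x∈ y∈)
        ... | tri≈ _ eq _ = contradiction (u-injective eq) i≢j
        ... | tri> _ _ gt = Fin.<⇒≢ (interval-< weight gt y∈ x∈) ∘ sym
        |xyz| : Sub.∣ tri x y z ∣ ≡ 3
        |xyz| = ∣tri∣ (apart i≢j x∈ y∈) (apart i≢k x∈ z∈) (apart j≢k y∈ z∈)
        is-red : ∀ col → χ (tri x y z) |xyz| ≡ col → χ (tri x y z) |xyz| ≡ red
        is-red red  eq = eq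
        is-red blue eq = contradiction (trans (cong not (sym (dec-true (edge? Blue (tri x y z)) (|xyz| , eq)))) ¬blue) λ ()

      few : ¬ Contains Red (completeTripartite n) → FewSparseLinks
      few no-red {f} f∈ κ κ≤d G X Y S uS S⊆ bad = ℕ.≮⇒≥ λ bound<S →
        no-red (cube⇒copy weight Red (λ x y z → not (isBlue x y z)) (i≢j ∘ u-injective) (i≢k ∘ u-injective) (j≢k ∘ u-injective)
          (red-edge i≢j i≢k j≢k)
          (Cube-⊆ (λ x y z → not (isBlue x y z)) n S⊆ id id
            (sparse-links⇒cube Fin._≟_ Fin._≟_ isBlue G (λ v → lookup (X v)) (λ v → lookup (Y v)) n γ e P m u S (slot j) (slot k)
              0<n 0<γ 0<P 0<m 0<u uS (interval-unique weight _) (interval-unique weight _)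
              m-large u-large growth (ℕ.<⇒≤ bound<S) (≤-trans M-large₁ (M≤slot j)) (≤-trans M-large₂ (M≤slot k)) sparse)))
        where
        open ≤-Reasoning
        i = first f
        j = middle f
        k = last f
        i≢j : i ≢ j
        i≢j = Fin.<⇒≢ (first<middle f∈)
        i≢k : i ≢ k
        i≢k = Fin.<⇒≢ (ℕ.<-trans (first<middle f∈) (middle<last f∈))
        j≢k : j ≢ k
        j≢k = Fin.<⇒≢ (middle<last f∈)
        sparse : ∀ {v} → v ∈ S →
          length (slot j) · length (slot k) +
            P · (a · pairs j k (λ x y → G x y ∧ ((lookup (X v) x ∧ lookup (Y v) y) ∧ isBlue v x y))) ≤
          2 · (P · pairs j k (λ x y → G x y ∧ (lookup (X v) x ∧ lookup (Y v) y)))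
        sparse {v} v∈ = let large-X , large-Y , dense , sparse = bad v∈ in begin
          length (slot j) · length (slot k) + P · (a · hits)
            ≤⟨ ℕ.+-mono-≤ (ℕ.*-mono-≤ large-X large-Y) (≤-reflexive (split hits)) ⟩
          b · sX · (b · sY) + K · (a ^ suc κ · hits)
            ≤⟨ ℕ.+-mono-≤ (≤-trans (≤-reflexive (collect b sX sY)) (ℕ.*-mono-≤ b²≤K dense)) (ℕ.*-monoʳ-≤ K (≤-trans (ℕ.<⇒≤ sparse) dense)) ⟩
          K · (a ^ κ · covers) + K · (a ^ κ · covers)
            ≡⟨ cong (λ x → x + x) (trans (sym (ℕ.*-assoc K (a ^ κ) covers)) (cong (_· covers) K·aᵏ)) ⟩
          P · covers + P · covers
            ≡⟨ cong (P · covers ℕ.+_) (ℕ.+-identityʳ _) ⟨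
          2 · (P · covers) ∎
          where
          sX = size j (X v)
          sY = size k (Y v)
          hits   = pairs j k (λ x y → G x y ∧ ((lookup (X v) x ∧ lookup (Y v) y) ∧ isBlue v x y))
          covers = pairs j k (λ x y → G x y ∧ (lookup (X v) x ∧ lookup (Y v) y))
          -- The missing powers of `a` are supplied here, so that `K · a ^ κ` is `P` for every
          -- `κ ≤ d`. Largeness with density bounds the number of all pairs by `P · covers`, and
          -- sparseness with density bounds `P · (a · hits)` by the same.
          K = b · b · a ^ (d ∸ κ)
          b²≤K : b · b ≤ K
          b²≤K = ℕ.m≤m*n (b · b) (a ^ (d ∸ κ)) {{ℕ.>-nonZero (^-pos (d ∸ κ) 0<a)}}
          K·aᵏ : K · a ^ κ ≡ P
          K·aᵏ = trans (ℕ.*-assoc (b · b) _ _) (cong (b · b ·_)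
            (trans (sym (ℕ.^-distribˡ-+-* a (d ∸ κ) κ)) (cong (a ^_) (ℕ.m∸n+n≡m κ≤d))))
          split : ∀ h → P · (a · h) ≡ K · (a ^ suc κ · h)
          split h = trans (cong (_· (a · h)) (sym K·aᵏ)) (regroup K (a ^ κ) a h)
            where
            regroup : ∀ K p a h → K · p · (a · h) ≡ K · (a · p · h)
            regroup = solve-∀
          collect : ∀ b x y → b · x · (b · y) ≡ b · b · (x · y)
          collect = solve-∀

      relabel : (ψ : Fin (suc t) → Fin N) → (∀ k → ψ k ∈ slot k) →
        (∀ {f} → f ∈ Es → isBlue (ψ (first f)) (ψ (middle f)) (ψ (last f)) ≡ true) → Contains Blue H
      relabel ψ ψ∈ ψ-blue = φ , injective , preserves , copy
        where
        φ : Fin (suc t) → Fin N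
        φ v = ψ (σ ⟨$⟩ˡ v)
        φ∈ : ∀ v → φ v ∈ interval weight v
        φ∈ v = subst (λ w → φ v ∈ interval weight w) (inverseʳ σ) (ψ∈ (σ ⟨$⟩ˡ v))
        injective : ∀ {v w} → φ v ≡ φ w → v ≡ w
        injective {v} {w} eq with Fin.<-cmp v w
        ... | tri< lt _ _ = contradiction eq (Fin.<⇒≢ (interval-< weight lt (φ∈ v) (φ∈ w)))
        ... | tri≈ _ v≡w _ = v≡w
        ... | tri> _ _ gt = contradiction (sym eq) (Fin.<⇒≢ (interval-< weight gt (φ∈ w) (φ∈ v)))
        preserves : ∀ {v w} → v Fin.≤ w → φ v Fin.≤ φ w
        preserves {v} {w} v≤w with Fin.<-cmp v w
        ... | tri< lt _ _ = ℕ.<⇒≤ (interval-< weight lt (φ∈ v) (φ∈ w))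
        ... | tri≈ _ refl _ = ≤-refl
        ... | tri> _ _ gt = contradiction v≤w (ℕ.<⇒≱ gt)
        copy : ∀ f → Edge H f → Edge Blue (image φ f)
        copy f f∈ = subst (Edge Blue) (sym image≡)
          (does⇒ (edge? Blue (tri (ψ (first f)) (ψ (middle f)) (ψ (last f))))
            (ψ-blue (Mem.∈-filter⁺ (edge? H) (all-subsets f) f∈)))
          where
          tri-≡ : ∀ {x x′ y y′ z z′ : Fin N} → x ≡ x′ → y ≡ y′ → z ≡ z′ → tri x y z ≡ tri x′ y′ z′
          tri-≡ refl refl refl = refl
          φσ : ∀ i → φ (σ ⟨$⟩ʳ i) ≡ ψ i
          φσ i = cong ψ (inverseˡ σ)
          image≡ : image φ f ≡ tri (ψ (first f)) (ψ (middle f)) (ψ (last f))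
          image≡ = trans (cong (image φ) (edge≡tri f (uniform H f∈))) (trans (image-tri φ _ _ _)
            (tri-≡ (φσ (first f)) (φσ (middle f)) (φσ (last f))))

      blue-copy : ¬ Contains Red (completeTripartite n) → Contains Blue H
      blue-copy no-red =
        let ψ , ψ∈ , ψ-blue = embedding 0<a 0<d 0<M M-large₃ first<middle middle<last deg-middle deg-last |slot|
              (λ k → interval-unique weight _) (few no-red)
        in relabel ψ ψ∈ ψ-blue

    arrows : Arrows N H (completeTripartite n)
    arrows χ with contains? (Red χ) (completeTripartite n)
    ... | yes copy  = inj₂ copy
    ... | no no-red = inj₁ (blue-copy χ no-red)

-- The choice of parameters

root : ∀ k n → 0 <ⁿ n → ∃[ r ] suc r ^ suc k ≤ n × n <ⁿ suc (suc r) ^ suc k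
root k (suc zero) _ = 0 , ≤-reflexive (ℕ.^-zeroˡ (suc k)) ,
  ℕ.<-≤-trans (s<s z<s) (ℕ.^-monoʳ-≤ 2 {1} {suc k} (s≤s z≤n))
root k (suc (suc n)) _ with r , rᵏ≤n , n<r+1ᵏ ← root k (suc n) z<s with suc (suc r) ^ suc k ℕ.≤? suc (suc n)
... | yes r+1ᵏ≤ = suc r , r+1ᵏ≤ , ℕ.≤-<-trans n<r+1ᵏ (ℕ.^-monoˡ-< (suc k) (ℕ.n<1+n (suc (suc r))))
... | no  ≰     = r , ℕ.m≤n⇒m≤1+n rᵏ≤n , ℕ.≰⇒> ≰

-- Bernoulli's inequality (1 - 8 / a)^k ≥ 1 - 8k / a for a = γ + 8, with `j` for the numerator a -
-- 8k to avoid truncated subtraction.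
bernoulli : ∀ γ k j → γ + 8 ≡ 8 · k + j → (γ + 8) ^ k · j ≤ γ ^ k · (γ + 8)
bernoulli γ zero    j eq = ≤-reflexive (trans (ℕ.+-identityʳ j) (trans (sym eq) (sym (ℕ.+-identityʳ _))))
bernoulli γ (suc k) j eq = begin
  (γ + 8) · (γ + 8) ^ k · j          ≡⟨ rearrange (γ + 8) ((γ + 8) ^ k) j ⟩
  (γ + 8) ^ k · ((γ + 8) · j)        ≤⟨ ℕ.*-monoʳ-≤ ((γ + 8) ^ k) step ⟩
  (γ + 8) ^ k · (γ · (j + 8))        ≡⟨ rearrange′ ((γ + 8) ^ k) γ (j + 8) ⟩
  γ · ((γ + 8) ^ k · (j + 8))        ≤⟨ ℕ.*-monoʳ-≤ γ (bernoulli γ k (j + 8) (trans eq (shift k j))) ⟩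
  γ · (γ ^ k · (γ + 8))              ≡⟨ ℕ.*-assoc γ (γ ^ k) _ ⟨
  γ · γ ^ k · (γ + 8)                ∎
  where
  open ≤-Reasoning
  rearrange : ∀ x y z → x · y · z ≡ y · (x · z)
  rearrange = solve-∀
  rearrange′ : ∀ x y z → x · (y · z) ≡ y · (x · z)
  rearrange′ = solve-∀
  shift : ∀ k j → 8 · suc k + j ≡ 8 · k + (j + 8)
  shift = solve-∀
  j≤γ : j ≤ γ
  j≤γ = ℕ.+-cancelʳ-≤ 8 j γ (≤-trans (ℕ.m≤n+m (j + 8) (8 · k)) (≤-reflexive (trans (sym (shift k j)) (sym eq))))
  step : (γ + 8) · j ≤ γ · (j + 8)
  step = begin
    (γ + 8) · j        ≡⟨ ℕ.*-distribʳ-+ j γ 8 ⟩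
    γ · j + 8 · j      ≤⟨ ℕ.+-monoʳ-≤ (γ · j) (ℕ.*-monoʳ-≤ 8 j≤γ) ⟩
    γ · j + 8 · γ      ≡⟨ cong (γ · j ℕ.+_) (ℕ.*-comm 8 γ) ⟩
    γ · j + γ · 8      ≡⟨ ℕ.*-distribˡ-+ γ j 8 ⟨
    γ · (j + 8)        ∎

^-distribʳ-* : ∀ x y k → (x · y) ^ k ≡ x ^ k · y ^ k
^-distribʳ-* x y zero    = refl
^-distribʳ-* x y (suc k) = trans (cong (x · y ·_) (^-distribʳ-* x y k)) (interchange x y (x ^ k) (y ^ k))
  where
  interchange : ∀ a b c d → a · b · (c · d) ≡ a · c · (b · d)
  interchange = solve-∀

-- (1 − 1 / 2r)ʳ ≥ 1 / 2 for r = suc r′.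
growth-bound : ∀ r′ e n → n ≤ suc r′ · e → (16 · r′ + 8 + 8) ^ n ≤ 2 ^ e · (16 · r′ + 8) ^ n
-- Multiplying by `γ ^ (r · e ∸ n)` fills the exponent up to `r · e`, which splits into e blocks of
-- length r, each costing a factor 2.
growth-bound r′ e n n≤re = *-cancelʳ-≤-pos (γ ^ (r · e ∸ n)) (^-pos (r · e ∸ n) 0<γ) (begin
  a ^ n · γ ^ (r · e ∸ n)               ≤⟨ ℕ.*-monoʳ-≤ (a ^ n) (ℕ.^-monoˡ-≤ (r · e ∸ n) (ℕ.m≤m+n γ 8)) ⟩
  a ^ n · a ^ (r · e ∸ n)               ≡⟨ join a ⟩
  (a ^ r) ^ e                           ≤⟨ ℕ.^-monoˡ-≤ e once ⟩
  (2 · γ ^ r) ^ e                       ≡⟨ ^-distribʳ-* 2 (γ ^ r) e ⟩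
  2 ^ e · (γ ^ r) ^ e                   ≡⟨ cong (2 ^ e ·_) (join γ) ⟨
  2 ^ e · (γ ^ n · γ ^ (r · e ∸ n))     ≡⟨ ℕ.*-assoc (2 ^ e) _ _ ⟨
  2 ^ e · γ ^ n · γ ^ (r · e ∸ n)       ∎)
  where
  open ≤-Reasoning
  r = suc r′
  γ = 16 · r′ + 8
  a = γ + 8
  0<γ : 0 <ⁿ γ
  0<γ = ℕ.<-≤-trans (z<s {7}) (ℕ.m≤n+m 8 (16 · r′))
  join : ∀ x → x ^ n · x ^ (r · e ∸ n) ≡ (x ^ r) ^ e
  join x = trans (sym (ℕ.^-distribˡ-+-* x n (r · e ∸ n))) (trans (cong (x ^_) (ℕ.m+[n∸m]≡n n≤re)) (sym (ℕ.^-*-assoc x r e)))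
  once : a ^ r ≤ 2 · γ ^ r
  once = *-cancelʳ-≤-pos (8 · r) (*-pos (z<s {7}) (z<s {r′})) (≤-trans (bernoulli γ r (8 · r) (two-halves r′))
    (≤-reflexive (trans (cong (γ ^ r ·_) (a≡ r′)) (regroup (γ ^ r) r))))
    where
    two-halves : ∀ r′ → 16 · r′ + 8 + 8 ≡ 8 · suc r′ + 8 · suc r′
    two-halves = solve-∀
    a≡ : ∀ r′ → 16 · r′ + 8 + 8 ≡ 16 · suc r′
    a≡ = solve-∀
    regroup : ∀ x r → x · (16 · r) ≡ 2 · x · (8 · r)
    regroup = solve-∀

-- A record, so that unification can read the exponent off the type; it could not invert `2 ^ i`.
record _≤2^_ (x i : ℕ) : Set where
  constructor bounded
  field bound : x ≤ 2 ^ i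

open _≤2^_

2^-refl : ∀ i → (2 ^ i) ≤2^ i
2^-refl i = bounded ≤-refl

2^-* : ∀ {x y i j} → x ≤2^ i → y ≤2^ j → (x · y) ≤2^ (i + j)
2^-* {i = i} {j} (bounded x≤) (bounded y≤) =
  bounded (≤-trans (ℕ.*-mono-≤ x≤ y≤) (≤-reflexive (sym (ℕ.^-distribˡ-+-* 2 i j))))

2^-^ : ∀ {x i} k → x ≤2^ i → (x ^ k) ≤2^ (i · k)
2^-^ {i = i} k (bounded x≤) = bounded (≤-trans (ℕ.^-monoˡ-≤ k x≤) (≤-reflexive (ℕ.^-*-assoc 2 i k)))

2^-mono : ∀ {x i j} → x ≤2^ i → i ≤ j → x ≤2^ j
2^-mono (bounded x≤) i≤j = bounded (≤-trans x≤ (ℕ.^-monoʳ-≤ 2 i≤j))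

n<2^n : ∀ n → n <ⁿ 2 ^ n
n<2^n zero    = z<s
n<2^n (suc n) = begin-strict
  suc n            <⟨ s<s (n<2^n n) ⟩
  1 + 2 ^ n        ≤⟨ ℕ.+-monoˡ-≤ (2 ^ n) (^-pos n (z<s {1})) ⟩
  2 ^ n + 2 ^ n    ≡⟨ cong (2 ^ n ℕ.+_) (ℕ.+-identityʳ _) ⟨
  2 ^ suc n        ∎
  where open ≤-Reasoning

-- Read off from the lower bounds on `M`, in units of `n · e`: 102 = 36 + 66 comes from `M-large₃`,
-- the 1 from the factor `2 ^ e` of `u`, and 23 from 4z ≤ 2^(23L) in the power (4z)^m. The last
-- factor bounds `L · m`, using m = 32 d² a^(3d+1) n and a = 16r.
rate : ℕ → ℕ
rate d = 102 · d + 1 + 23 · (32 · (d · d · d) · (16 ^ (3 · d + 1)))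

n≤2^n : ∀ n → n ≤2^ n
n≤2^n n = bounded (ℕ.<⇒≤ (n<2^n n))

module Parameters (d r γ n e : ℕ) (0<d : 0 <ⁿ d) (0<r : 0 <ⁿ r) (0<n : 0 <ⁿ n) (a≡16r : γ + 8 ≡ 16 · r)
  (rᵏ≤n : r ^ (8 · d) ≤ n) (n<r+1ᵏ : n <ⁿ suc r ^ (8 · d)) (n≤re : n ≤ r · e) where

  open ≤-Reasoning

  a b P z m u q L : ℕ
  a = γ + 8
  b = 2 · d · a ^ d
  P = b · b · a ^ d
  z = 4 · P
  m = 2 · z · (a · n)
  u = 4 · z · (n · 2 ^ e)
  -- The budget for exponents, of order n² / r once `e` is n / r up to a constant factor. Every
  -- factor polynomial in n is 2^O(L), since n < (r + 1)^(8d) and r + 1 ≤ 2^r.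
  q = n · e
  L = d · r

  -- The place where r must be a small power of n: `m` contributes r^(3d+1), the logarithm `L` one
  -- more r, and replacing n by `e` a third, so r^(3d+3) ≤ n is needed.
  r^≤e : r ^ (3 · d + 2) ≤ e
  r^≤e = *-cancelˡ-≤-pos r 0<r (begin
    r ^ suc (3 · d + 2)     ≤⟨ ℕ.^-monoʳ-≤ r {{ℕ.>-nonZero 0<r}} exponents ⟩
    r ^ (8 · d)             ≤⟨ rᵏ≤n ⟩
    n                       ≤⟨ n≤re ⟩
    r · e                   ∎)
    where
    exponents : suc (3 · d + 2) ≤ 8 · d
    exponents = begin
      suc (3 · d + 2)      ≡⟨ ℕ.+-suc (3 · d) 2 ⟨
      3 · d + 3            ≤⟨ ℕ.+-monoʳ-≤ (3 · d) (ℕ.*-monoʳ-≤ 3 0<d) ⟩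
      3 · d + 3 · d        ≡⟨ ℕ.*-distribʳ-+ d 3 3 ⟨
      6 · d                ≤⟨ ℕ.*-monoˡ-≤ d (ℕ.m≤m+n 6 2) ⟩
      8 · d                ∎

  r≤e : r ≤ e
  r≤e = ≤-trans (≤-trans (≤-reflexive (sym (ℕ.^-identityʳ r))) (ℕ.^-monoʳ-≤ r {{ℕ.>-nonZero 0<r}} (≤-trans (s≤s z≤n) (ℕ.m≤n+m 2 (3 · d))))) r^≤e

  1≤L : 1 ≤ L
  1≤L = *-pos 0<d 0<r

  r≤L : r ≤ L
  r≤L = ℕ.m≤n*m r d {{ℕ.>-nonZero 0<d}}

  d≤L : d ≤ L
  d≤L = ℕ.m≤m*n d r {{ℕ.>-nonZero 0<r}}

  L≤dq : L ≤ d · q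
  L≤dq = ℕ.*-monoʳ-≤ d (≤-trans r≤e (ℕ.m≤n*m e n {{ℕ.>-nonZero 0<n}}))

  L·n≤dq : L · n ≤ d · q
  L·n≤dq = begin
    d · r · n       ≡⟨ regroup d r n ⟩
    d · (n · r)     ≤⟨ ℕ.*-monoʳ-≤ d (ℕ.*-monoʳ-≤ n r≤e) ⟩
    d · (n · e)     ∎
    where
    regroup : ∀ d r n → d · r · n ≡ d · (n · r)
    regroup = solve-∀

  two : 2 ≤2^ L
  two = bounded (ℕ.^-monoʳ-≤ 2 1≤L)

  four : 4 ≤2^ (2 · L)
  four = bounded (ℕ.^-monoʳ-≤ 2 (ℕ.*-monoʳ-≤ 2 1≤L))

  a≤′ : a ≤2^ (5 · r)
  a≤′ = 2^-mono (subst (_≤2^ (4 + r)) (sym a≡16r) (2^-* (2^-refl 4) (n≤2^n r))) (begin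
    4 + r        ≤⟨ ℕ.+-monoˡ-≤ r (ℕ.*-monoʳ-≤ 4 0<r) ⟩
    4 · r + r    ≡⟨ solve r ⟩
    5 · r        ∎)
    where
    solve : ∀ r → 4 · r + r ≡ 5 · r
    solve = solve-∀

  a≤ : a ≤2^ (5 · L)
  a≤ = 2^-mono a≤′ (ℕ.*-monoʳ-≤ 5 r≤L)

  -- Starting from the bound in r rather than in `L`, the power d only turns r into `L`.
  aᵈ≤ : (a ^ d) ≤2^ (5 · L)
  aᵈ≤ = 2^-mono (2^-^ d a≤′) (≤-reflexive (solve d r))
    where
    solve : ∀ d r → 5 · r · d ≡ 5 · (d · r)
    solve = solve-∀

  b≤ : b ≤2^ (7 · L)
  b≤ = 2^-mono (2^-* (2^-* two (2^-mono (n≤2^n d) d≤L)) aᵈ≤) (≤-reflexive (solve L))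
    where
    solve : ∀ L → L + L + 5 · L ≡ 7 · L
    solve = solve-∀

  z≤ : z ≤2^ (21 · L)
  z≤ = 2^-mono (2^-* four (2^-* (2^-* b≤ b≤) aᵈ≤)) (≤-reflexive (solve L))
    where
    solve : ∀ L → 2 · L + (7 · L + 7 · L + 5 · L) ≡ 21 · L
    solve = solve-∀

  n≤ : n ≤2^ (8 · L)
  n≤ = 2^-mono (bounded (≤-trans (ℕ.<⇒≤ n<r+1ᵏ) (bound (2^-^ (8 · d) (bounded {i = r} (n<2^n r)))))) (≤-reflexive (solve d r))
    where
    solve : ∀ d r → r · (8 · d) ≡ 8 · (d · r)
    solve = solve-∀

  m≤ : m ≤2^ (35 · L)
  m≤ = 2^-mono (2^-* (2^-* two z≤) (2^-* a≤ n≤)) (≤-reflexive (solve L))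
    where
    solve : ∀ L → L + 21 · L + (5 · L + 8 · L) ≡ 35 · L
    solve = solve-∀

  u≤ : u ≤2^ (31 · L + e)
  u≤ = 2^-mono (2^-* (2^-* four z≤) (2^-* n≤ (2^-refl e))) (≤-reflexive (solve L e))
    where
    solve : ∀ L e → 2 · L + 21 · L + (8 · L + e) ≡ 31 · L + e
    solve = solve-∀

  -- The factors of m that depend on d alone are collected in the rate.
  L·m≤ : L · m ≤ 32 · (d · d · d) · 16 ^ (3 · d + 1) · q
  L·m≤ = begin
    L · m
      ≡⟨ expand d r n (a ^ d) a ⟩
    32 · (d · d · d) · (a ^ d · a ^ d · a ^ d · a · r) · n
      ≡⟨ cong (λ x → 32 · (d · d · d) · x · n) powers ⟩
    32 · (d · d · d) · (16 ^ (3 · d + 1) · r ^ (3 · d + 2)) · n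
      ≤⟨ ℕ.*-monoˡ-≤ n (ℕ.*-monoʳ-≤ (32 · (d · d · d)) (ℕ.*-monoʳ-≤ (16 ^ (3 · d + 1)) r^≤e)) ⟩
    32 · (d · d · d) · (16 ^ (3 · d + 1) · e) · n
      ≡⟨ collect (32 · (d · d · d)) (16 ^ (3 · d + 1)) e n ⟩
    32 · (d · d · d) · 16 ^ (3 · d + 1) · q ∎
    where
    expand : ∀ d r n A a → d · r · (2 · (4 · (2 · d · A · (2 · d · A) · A)) · (a · n)) ≡ 32 · (d · d · d) · (A · A · A · a · r) · n
    expand = solve-∀
    collect : ∀ x y e n → x · (y · e) · n ≡ x · y · (n · e)
    collect = solve-∀
    powers : a ^ d · a ^ d · a ^ d · a · r ≡ 16 ^ (3 · d + 1) · r ^ (3 · d + 2)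
    powers = begin-equality
      a ^ d · a ^ d · a ^ d · a · r
        ≡⟨ cong (_· r) (cong₂ _·_ (cube (a ^ d)) (sym (ℕ.^-identityʳ a))) ⟩
      (a ^ d) ^ 3 · a ^ 1 · r
        ≡⟨ cong (λ x → x · a ^ 1 · r) (trans (ℕ.^-*-assoc a d 3) (cong (a ^_) (ℕ.*-comm d 3))) ⟩
      a ^ (3 · d) · a ^ 1 · r
        ≡⟨ cong (_· r) (ℕ.^-distribˡ-+-* a (3 · d) 1) ⟨
      a ^ (3 · d + 1) · r
        ≡⟨ cong (_· r) (trans (cong (_^ (3 · d + 1)) a≡16r) (^-distribʳ-* 16 r (3 · d + 1))) ⟩
      16 ^ (3 · d + 1) · r ^ (3 · d + 1) · r
        ≡⟨ trans (ℕ.*-assoc (16 ^ (3 · d + 1)) _ r) (cong (16 ^ (3 · d + 1) ·_) (trans (ℕ.*-comm _ r) (cong (r ^_) (sym (ℕ.+-suc (3 · d) 1))))) ⟩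
      16 ^ (3 · d + 1) · r ^ (3 · d + 2) ∎
      where
      cube : ∀ x → x · x · x ≡ x ^ 3
      cube x = trans (ℕ.*-assoc x x x) (cong (λ y → x · (x · y)) (sym (ℕ.*-identityʳ x)))

  M : ℕ
  M = 2 ^ (rate d · q)

  K₁ : ℕ
  K₁ = 32 · (d · d · d) · 16 ^ (3 · d + 1)

  M-large₁ : 4 · z · m ≤ M
  M-large₁ = bound (2^-mono (2^-* (2^-* four z≤) m≤) (begin
    2 · L + 21 · L + 35 · L              ≡⟨ solve L ⟩
    58 · L                               ≤⟨ ℕ.*-mono-≤ (ℕ.m≤m+n 58 44) L≤dq ⟩
    102 · (d · q)                        ≡⟨ ℕ.*-assoc 102 d q ⟨
    102 · d · q                          ≤⟨ ℕ.*-monoˡ-≤ q (≤-trans (ℕ.m≤m+n (102 · d) 1) (ℕ.m≤m+n (102 · d + 1) (23 · K₁))) ⟩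
    rate d · q                           ∎))
    where
    solve : ∀ L → 2 · L + 21 · L + 35 · L ≡ 58 · L
    solve = solve-∀

  M-large₂ : 2 · z · ((4 · z) ^ m · u) ≤ M
  M-large₂ = bound (2^-mono (2^-* (2^-* two z≤) (2^-* (2^-^ m (2^-* four z≤)) u≤)) (begin
    L + 21 · L + ((2 · L + 21 · L) · m + (31 · L + e))
      ≡⟨ solve L m e ⟩
    53 · L + e + 23 · (L · m)
      ≤⟨ ℕ.+-mono-≤ (ℕ.+-mono-≤ (ℕ.*-mono-≤ (ℕ.m≤m+n 53 49) L≤dq) (ℕ.m≤n*m e n {{ℕ.>-nonZero 0<n}})) (ℕ.*-monoʳ-≤ 23 L·m≤) ⟩
    102 · (d · q) + q + 23 · (K₁ · q)
      ≡⟨ collect d q K₁ ⟩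
    rate d · q ∎))
    where
    solve : ∀ L m e → L + 21 · L + ((2 · L + 21 · L) · m + (31 · L + e)) ≡ 53 · L + e + 23 · (L · m)
    solve = solve-∀
    collect : ∀ d q K → 102 · (d · q) + q + 23 · (K · q) ≡ (102 · d + 1 + 23 · K) · q
    collect = solve-∀

  M-large₃ : 2 · a ^ d · (2 · z · (n · (m ^ n · u ^ n))) ≤ M
  M-large₃ = bound (2^-mono (2^-* (2^-* two aᵈ≤) (2^-* (2^-* two z≤) (2^-* n≤ (2^-* (2^-^ n m≤) (2^-^ n u≤))))) (begin
    L + 5 · L + (L + 21 · L + (8 · L + (35 · L · n + (31 · L + e) · n)))
      ≡⟨ solve L n e ⟩
    36 · L + 66 · (L · n) + n · e
      ≤⟨ ℕ.+-monoˡ-≤ (n · e) (ℕ.+-monoˡ-≤ (66 · (L · n)) (ℕ.*-monoʳ-≤ 36 (ℕ.m≤m*n L n {{ℕ.>-nonZero 0<n}}))) ⟩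
    36 · (L · n) + 66 · (L · n) + n · e
      ≡⟨ cong (_+ n · e) (sym (ℕ.*-distribʳ-+ (L · n) 36 66)) ⟩
    102 · (L · n) + q
      ≤⟨ ℕ.+-monoˡ-≤ q (ℕ.*-monoʳ-≤ 102 L·n≤dq) ⟩
    102 · (d · q) + q
      ≡⟨ collect d q ⟩
    (102 · d + 1) · q
      ≤⟨ ℕ.*-monoˡ-≤ q (ℕ.m≤m+n (102 · d + 1) (23 · K₁)) ⟩
    rate d · q ∎))
    where
    solve : ∀ L n e → L + 5 · L + (L + 21 · L + (8 · L + (35 · L · n + (31 · L + e) · n))) ≡ 36 · L + 66 · (L · n) + n · e
    solve = solve-∀
    collect : ∀ d q → 102 · (d · q) + q ≡ (102 · d + 1) · q
    collect = solve-∀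

  M·suc-d≤ : M · suc d ≤ 2 ^ ((rate d + d) · q)
  M·suc-d≤ = bound (2^-mono (2^-* (2^-refl (rate d · q)) (bounded {i = d} (n<2^n d))) (begin
    rate d · q + d              ≤⟨ ℕ.+-monoʳ-≤ (rate d · q) (≤-trans d≤L L≤dq) ⟩
    rate d · q + d · q          ≡⟨ ℕ.*-distribʳ-+ q (rate d) d ⟨
    (rate d + d) · q            ∎))

-- The bound in terms of rational numbers

^-cancelˡ-≤ : ∀ k {x y} → 0 <ⁿ k → x ^ k ≤ y ^ k → x ≤ y
^-cancelˡ-≤ k 0<k xᵏ≤yᵏ = ℕ.≮⇒≥ λ y<x → ℕ.<⇒≱ (ℕ.^-monoˡ-< k {{ℕ.>-nonZero 0<k}} y<x) xᵏ≤yᵏ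

^ℕ-fraction : ∀ Y R k → ∃[ W ] mkℚᵘ (+ Y) R ^ℕ k ≡ mkℚᵘ (+ (Y ^ k)) W × suc W ≡ suc R ^ k
^ℕ-fraction Y R zero    = 0 , refl , refl
^ℕ-fraction Y R (suc k) with W , eq , W≡ ← ^ℕ-fraction Y R k =
  W + R · suc W ,
  trans (cong (mkℚᵘ (+ Y) R *_) eq) (cong (λ i → mkℚᵘ i (W + R · suc W)) (sym (ℤ.pos-* Y (Y ^ k)))) ,
  cong (suc R ·_) W≡

PowerAtMost⁻ : ∀ b .{{_ : NonZero b}} s y p → ↥ s ≡ + p → PowerAtMost b s y →
  ∃[ Y ] ∃[ R ] y ≡ mkℚᵘ (+ Y) R × b ^ p · suc R ^ (↧ₙ s) ≤ Y ^ (↧ₙ s)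
PowerAtMost⁻ b s (mkℚᵘ (-[1+ Y ]) R) p s≡ (ℚ.*≤* () , _)
PowerAtMost⁻ b s (mkℚᵘ (+ Y) R) p s≡ (_ , le) = Y , R , refl , numerators (↧ₙ s) (subst (λ i → (b ^ℤ i) ℚ.≤ (mkℚᵘ (+ Y) R ^ℕ (↧ₙ s))) s≡ le)
  where
  numerators : ∀ k → (+ (b ^ p) / 1) ℚ.≤ (mkℚᵘ (+ Y) R ^ℕ k) → b ^ p · suc R ^ k ≤ Y ^ k
  numerators k le with W , eq , W≡ ← ^ℕ-fraction Y R k with ℚ.*≤* le′ ← subst ((+ (b ^ p) / 1) ℚ.≤_) eq le =
    subst₂ _≤_ (cong (b ^ p ·_) W≡) (ℕ.*-identityʳ (Y ^ k))
      (ℤ.drop‿+≤+ (subst₂ ℤ._≤_ (sym (ℤ.pos-* (b ^ p) (suc W))) (sym (ℤ.pos-* (Y ^ k) 1)) le′))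

-- With k the denominator of `s`, the hypothesis on `E` is the k-th power of E ≤ C n^s. Any
-- admissible y satisfies n^s ≤ y, so E ≤ C y, and then 2^E ≤ z; roots are avoided by comparing
-- powers.
expBound : ∀ r t E C n .{{_ : NonZero n}} s p → r ≤ t · 2 ^ E → ↥ s ≡ + p → E ^ (↧ₙ s) ≤ C ^ (↧ₙ s) · n ^ p →
           ExpBound r t (+ C / 1) n s
expBound r t E C n s p r≤ s≡ E≤ y z hy hz
  with Y , R , refl , y≥ ← PowerAtMost⁻ n s y p s≡ hy
  with Z , W , refl , z≥ ← PowerAtMost⁻ 2 ((+ C / 1) * mkℚᵘ (+ Y) R) z (C · Y) (sym (ℤ.pos-* C Y)) hz =
  ℚ.*≤* (subst₂ ℤ._≤_ (ℤ.pos-* r (suc (W + 0)))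
    (trans (ℤ.pos-* (t · Z) 1) (cong (ℤ._* + 1) (ℤ.pos-* t Z))) (ℤ.+≤+ bound′))
  where
  open ≤-Reasoning
  k = ↧ₙ s
  0<k : 0 <ⁿ k
  0<k = z<s
  ER≤CY : E · suc R ≤ C · Y
  ER≤CY = ^-cancelˡ-≤ k 0<k (begin
    (E · suc R) ^ k              ≡⟨ ^-distribʳ-* E (suc R) k ⟩
    E ^ k · suc R ^ k            ≤⟨ ℕ.*-monoˡ-≤ (suc R ^ k) E≤ ⟩
    C ^ k · n ^ p · suc R ^ k    ≡⟨ ℕ.*-assoc (C ^ k) (n ^ p) _ ⟩
    C ^ k · (n ^ p · suc R ^ k)  ≤⟨ ℕ.*-monoʳ-≤ (C ^ k) y≥ ⟩
    C ^ k · Y ^ k                ≡⟨ ^-distribʳ-* C Y k ⟨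
    (C · Y) ^ k                  ∎)
  2ᴱW≤Z : 2 ^ E · suc W ≤ Z
  -- `suc (R + 0)` is the unreduced denominator of C y as the product of rationals computes it.
  2ᴱW≤Z = ^-cancelˡ-≤ (suc (R + 0)) z<s (begin
    (2 ^ E · suc W) ^ suc (R + 0)                 ≡⟨ ^-distribʳ-* (2 ^ E) (suc W) (suc (R + 0)) ⟩
    (2 ^ E) ^ suc (R + 0) · suc W ^ suc (R + 0)   ≡⟨ cong (_· suc W ^ suc (R + 0)) (ℕ.^-*-assoc 2 E (suc (R + 0))) ⟩
    2 ^ (E · suc (R + 0)) · suc W ^ suc (R + 0)
      ≤⟨ ℕ.*-monoˡ-≤ (suc W ^ suc (R + 0)) (ℕ.^-monoʳ-≤ 2 (≤-trans (≤-reflexive (cong (λ x → E · suc x) (ℕ.+-identityʳ R))) ER≤CY)) ⟩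
    2 ^ (C · Y) · suc W ^ suc (R + 0)             ≤⟨ z≥ ⟩
    Z ^ suc (R + 0)                               ∎)
  bound′ : r · suc (W + 0) ≤ t · Z · 1
  bound′ = begin
    r · suc (W + 0)           ≡⟨ cong (λ x → r · suc x) (ℕ.+-identityʳ W) ⟩
    r · suc W                 ≤⟨ ℕ.*-monoˡ-≤ (suc W) r≤ ⟩
    t · 2 ^ E · suc W         ≡⟨ ℕ.*-assoc t (2 ^ E) (suc W) ⟩
    t · (2 ^ E · suc W)       ≤⟨ ℕ.*-monoʳ-≤ t 2ᴱW≤Z ⟩
    t · Z                     ≡⟨ ℕ.*-identityʳ (t · Z) ⟨
    t · Z · 1                 ∎

-- With j = k + 1, n < (r + 1)^j and r + 1 ≤ 2r give 1 / r ≤ 2 n^(- 1 / j). Hence e ≤ 2n / r ≤ 4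
-- n^(1 - 1 / j), and the claim is the j-th power of K n e ≤ 4 K n^(2 - 1 / j).
rate-bound : ∀ k K r n e → 0 <ⁿ r → 0 <ⁿ n → r ^ suc k ≤ n → n <ⁿ suc r ^ suc k → r · e ≤ n + n →
             (K · (n · e)) ^ suc k ≤ (4 · K) ^ suc k · n ^ (k + suc k)
rate-bound k K r n e 0<r 0<n rᵏ≤n n<r+1ᵏ re≤2n = *-cancelʳ-≤-pos n 0<n (begin
  (K · (n · e)) ^ j · n              ≤⟨ ℕ.*-monoʳ-≤ ((K · (n · e)) ^ j) (≤-trans (ℕ.<⇒≤ n<r+1ᵏ) (ℕ.^-monoˡ-≤ j 1+r≤2r)) ⟩
  (K · (n · e)) ^ j · (r + r) ^ j    ≡⟨ ^-distribʳ-* (K · (n · e)) (r + r) j ⟨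
  (K · (n · e) · (r + r)) ^ j        ≡⟨ cong (_^ j) (regroup K n e r) ⟩
  (2 · K · n · (r · e)) ^ j          ≤⟨ ℕ.^-monoˡ-≤ j (ℕ.*-monoʳ-≤ (2 · K · n) re≤2n) ⟩
  (2 · K · n · (n + n)) ^ j          ≡⟨ cong (_^ j) (regroup′ K n) ⟩
  (4 · K · (n · n)) ^ j              ≡⟨ trans (^-distribʳ-* (4 · K) (n · n) j) (cong ((4 · K) ^ j ·_) (^-distribʳ-* n n j)) ⟩
  (4 · K) ^ j · (n ^ j · n ^ j)      ≡⟨ cong ((4 · K) ^ j ·_) (trans (ℕ.*-assoc n (n ^ k) (n ^ j)) (trans (ℕ.*-comm n _) (cong (_· n) (sym (ℕ.^-distribˡ-+-* n k j))))) ⟩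
  (4 · K) ^ j · (n ^ (k + j) · n)    ≡⟨ ℕ.*-assoc ((4 · K) ^ j) _ n ⟨
  (4 · K) ^ j · n ^ (k + j) · n      ∎)
  where
  open ≤-Reasoning
  j = suc k
  1+r≤2r : suc r ≤ r + r
  1+r≤2r = ℕ.+-monoˡ-≤ r 0<r
  regroup : ∀ K n e r → K · (n · e) · (r + r) ≡ 2 · K · n · (r · e)
  regroup = solve-∀
  regroup′ : ∀ K n → 2 · K · n · (n + n) ≡ 4 · K · (n · n)
  regroup′ = solve-∀

-- The bound on the Ramsey number

ramsey-bound : ∀ d′ t (H : OrderedGraph 3 t) → WeaklyDegenerate (suc d′) H → ∀ n → 0 <ⁿ n → ∀ r′ →
  suc r′ ^ (8 · suc d′) ≤ n → n <ⁿ suc (suc r′) ^ (8 · suc d′) → ∀ e → n ≤ suc r′ · e →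
  ∃[ ρ ] IsRamseyNumber H (completeTripartite n) ρ × ρ ≤ t · 2 ^ ((rate (suc d′) + suc d′) · (n · e))
-- Without vertices the empty map is a copy already for N = 0. A 3-graph on no vertices has no
-- edges.
ramsey-bound d′ zero H _ n _ _ _ _ _ _ =
  let ρ , isρ , ρ≤0 = ramsey-number H (completeTripartite n) {0} (λ χ → inj₁ ((λ ()) , (λ { {()} }) , (λ { {()} }) ,
        λ { Vec.[] e∈ → contradiction (uniform H e∈) λ () }))
  in ρ , isρ , ρ≤0
ramsey-bound d′ (suc t) H (σ , degenerate) n 0<n r′ rᵏ≤n n<r+1ᵏ e n≤re =
  let ρ , isρ , ρ≤N = ramsey-number H (completeTripartite n)
        (Arrowing.arrows H d n γ e m u M (z<s {d′}) 0<n 0<γ 0<m 0<u 0<M ≤-refl ≤-refl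
          (growth-bound r′ e n n≤re) M-large₁ M-large₂ M-large₃ σ degenerate)
  in ρ , isρ , ≤-trans ρ≤N (≤-trans
    (Arrowing.N≤ H d n γ e m u M (z<s {d′}) 0<n 0<γ 0<m 0<u 0<M ≤-refl ≤-refl
          (growth-bound r′ e n n≤re) M-large₁ M-large₂ M-large₃ σ degenerate)
    (ℕ.*-monoʳ-≤ (suc t) M·suc-d≤))
  where
  d = suc d′
  γ = 16 · r′ + 8
  a≡16r : ∀ r′ → 16 · r′ + 8 + 8 ≡ 16 · suc r′
  a≡16r = solve-∀
  open Parameters d (suc r′) γ n e (z<s {d′}) (z<s {r′}) 0<n (a≡16r r′) rᵏ≤n n<r+1ᵏ n≤re
    using (a; b; z; m; u; M; M-large₁; M-large₂; M-large₃; M·suc-d≤)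
  0<γ : 0 <ⁿ γ
  0<γ = ℕ.<-≤-trans (z<s {7}) (ℕ.m≤n+m 8 (16 · r′))
  0<a : 0 <ⁿ a
  0<a = ℕ.<-≤-trans 0<γ (ℕ.m≤m+n γ 8)
  0<b : 0 <ⁿ b
  0<b = *-pos (*-pos (z<s {1}) (z<s {d′})) (^-pos d 0<a)
  0<z : 0 <ⁿ z
  0<z = *-pos (z<s {3}) (*-pos (*-pos 0<b 0<b) (^-pos d 0<a))
  0<m : 0 <ⁿ m
  0<m = *-pos (*-pos (z<s {1}) 0<z) (*-pos 0<a 0<n)
  0<u : 0 <ⁿ u
  0<u = *-pos (*-pos (z<s {3}) 0<z) (*-pos 0<n (^-pos e (z<s {1})))
  0<M : 0 <ⁿ M
  0<M = ^-pos (rate d · (n · e)) (z<s {1})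

next-multiple : ∀ n r′ → suc r′ ≤ n → ∃[ e ] n ≤ suc r′ · e × suc r′ · e ≤ n + n
-- One more than the floor, even if r divides n; as r ≤ n, the excess stays within `n + n`.
next-multiple n r′ r≤n = suc (n ℕ./ r) , lower , upper
  where
  open ≤-Reasoning
  r = suc r′
  lower : n ≤ r · suc (n ℕ./ r)
  lower = begin
    n                              ≡⟨ ℕ.m≡m%n+[m/n]*n n r ⟩
    n ℕ.% r + n ℕ./ r · r          ≤⟨ ℕ.+-monoˡ-≤ (n ℕ./ r · r) (ℕ.<⇒≤ (ℕ.m%n<n n r)) ⟩
    suc (n ℕ./ r) · r              ≡⟨ ℕ.*-comm (suc (n ℕ./ r)) r ⟩
    r · suc (n ℕ./ r)              ∎
  upper : r · suc (n ℕ./ r) ≤ n + n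
  upper = begin
    r · suc (n ℕ./ r)              ≡⟨ ℕ.*-comm r (suc (n ℕ./ r)) ⟩
    r + n ℕ./ r · r                ≤⟨ ℕ.+-mono-≤ r≤n (ℕ.m/n*n≤m n r) ⟩
    n + n                          ∎

exponent : ℕ → ℚᵘ
exponent d′ = (+ 2 / 1) - (+ 1 / 8) * (+ 1 / suc d′)

degenerate-bound : ∀ d′ t (H : OrderedGraph 3 t) → WeaklyDegenerate (suc d′) H → ∀ n .{{_ : NonZero n}} →
  ∃[ ρ ] IsRamseyNumber H (completeTripartite n) ρ ×
         ExpBound ρ t (+ (4 · (rate (suc d′) + suc d′)) / 1) n (exponent d′)
degenerate-bound d′ t H degenerate (suc n′)
  with r′ , rᵏ≤n , n<r+1ᵏ ← root (d′ + 7 · suc d′) (suc n′) z<s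
  with e , n≤re , re≤2n ← next-multiple (suc n′) r′ (≤-trans
    (≤-trans (≤-reflexive (sym (ℕ.^-identityʳ (suc r′)))) (ℕ.^-monoʳ-≤ (suc r′) {1} {suc (d′ + 7 · suc d′)} (s≤s z≤n))) rᵏ≤n) =
  let ρ , isρ , ρ≤ = ramsey-bound d′ t H degenerate n z<s r′ rᵏ≤n n<r+1ᵏ e n≤re
  in ρ , isρ , expBound ρ t (K · (n · e)) (4 · K) n (exponent d′) (k + suc k) ρ≤ numerator
       (subst (λ j → (K · (n · e)) ^ j ≤ (4 · K) ^ j · n ^ (k + suc k)) (sym denominator)
         (rate-bound k K (suc r′) n e z<s z<s rᵏ≤n n<r+1ᵏ re≤2n))
  where
  n = suc n′
  K = rate (suc d′) + suc d′
  -- Chosen so that `suc k` is 8d; then 2 - 1 / 8d is (k + suc k) / suc k.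
  k = d′ + 7 · suc d′
  denominator : ↧ₙ exponent d′ ≡ suc k
  denominator = cong suc (ℕ.+-identityʳ k)
  numerator : ↥ exponent d′ ≡ + (k + suc k)
  numerator = cong (λ x → + (k + suc x)) (ℕ.+-identityʳ k)

theorem1p4 : Σ[ c ∈ ℚᵘ ] 0ℚᵘ < c ×
    (∀ (d : ℕ) .{{_ : NonZero d}} →
    Σ[ C ∈ ℚᵘ ] 0ℚᵘ < C ×
    (∀ (t : ℕ) (H : OrderedGraph 3 t) → WeaklyDegenerate d H →
    ∀ (n : ℕ) .{{_ : NonZero n}} →
    ∃[ r ] IsRamseyNumber H (completeTripartite n) r ×
    ExpBound r t C n ((+ 2 / 1) - c * (+ 1 / d))))
theorem1p4 = (+ 1 / 8) , ℚ.*<* (ℤ.+<+ z<s) , λ where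
  (suc d′) → (+ (4 · (rate (suc d′) + suc d′)) / 1) ,
    ℚ.*<* (subst (+ 0 ℤ.<_) (ℤ.pos-* (4 · (rate (suc d′) + suc d′)) 1) (ℤ.+<+ z<s)) ,
    degenerate-bound d′
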